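{- A copy of $(\mathbb{N},+,\times)$ can be coded in $\mathcal{R}_m$ without parameters: there are first-order formulas $\varphi_{num}(x)$, $\varphi_\equiv(x,y)$, $\varphi_+(x,y,z)$, $\varphi_\times(x,y,z)$ in the language of partial orders, without parameters, such that $D=\{x:\mathcal{R}_m\models\varphi_{num}(x)\}$ is nonempty, $\varphi_\equiv$ defines an equivalence relation $\equiv$ on $D$, $\varphi_+$ and $\varphi_\times$ define on $D$ ternary relations compatible with $\equiv$ which are graphs of binary operations on $D/{\equiv}$, and the resulting structure $(D/{\equiv},+,\times)$ is isomorphic to $(\mathbb{N},+,\times)$.
   Context: $\mathcal{R}_m$ is the partial order of many-one degrees of c.e. sets ($X\le_m Y$ iff some computable $f$, possibly with values TRUE/FALSE, satisfies $n\in X\Leftrightarrow f(n)\in Y$). -}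

module Defs where

open import Data.Nat using (ℕ; zero; suc; _+_; _*_; _<_)
open import Data.Fin using (Fin)
open import Data.Vec using (Vec; []; _∷_; lookup)
open import Data.Product using (Σ; ∃; _×_; _,_)
open import Data.Sum using (_⊎_)
open import Data.Unit using (⊤)
open import Data.Empty using (⊥)
open import Relation.Nullary using (¬_)
open import Relation.Binary.PropositionalEquality using (_≡_)
open import Function.Bundles using (_⇔_)
open import Axiom.ExcludedMiddle using (ExcludedMiddle)
open import Level using (0ℓ)

data PR : ℕ → Set where
  zer  : ∀ {n} → PR n
  succ : PR 1
  proj : ∀ {n} → Fin n → PR n
  comp : ∀ {m n} → PR m → Vec (PR n) m → PR n
  prec : ∀ {n} → PR n → PR (suc (suc n)) → PR (suc n)
  mu   : ∀ {n} → PR (suc n) → PR n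

mutual
  data Eval : ∀ {n} → PR n → Vec ℕ n → ℕ → Set where
    ev-zer  : ∀ {n} {xs : Vec ℕ n} → Eval zer xs 0
    ev-succ : ∀ {x} → Eval succ (x ∷ []) (suc x)
    ev-proj : ∀ {n} {i : Fin n} {xs} → Eval (proj i) xs (lookup xs i)
    ev-comp : ∀ {m n} {f : PR m} {gs : Vec (PR n) m} {xs ys v} →
              EvalVec gs xs ys → Eval f ys v → Eval (comp f gs) xs v
    ev-prec0 : ∀ {n} {f : PR n} {g : PR (suc (suc n))} {xs v} →
               Eval f xs v → Eval (prec f g) (0 ∷ xs) v
    ev-precS : ∀ {n} {f : PR n} {g : PR (suc (suc n))} {y xs w v} →
               Eval (prec f g) (y ∷ xs) w → Eval g (y ∷ w ∷ xs) v →
               Eval (prec f g) (suc y ∷ xs) v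
    ev-mu : ∀ {n} {f : PR (suc n)} {xs y} →
            Eval f (y ∷ xs) 0 →
            (∀ z → z < y → Σ ℕ λ k → Eval f (z ∷ xs) (suc k)) →
            Eval (mu f) xs y

  data EvalVec : ∀ {m n} → Vec (PR n) m → Vec ℕ n → Vec ℕ m → Set where
    []  : ∀ {n} {xs : Vec ℕ n} → EvalVec [] xs []
    _∷_ : ∀ {m n} {g : PR n} {gs : Vec (PR n) m} {xs y ys} →
          Eval g xs y → EvalVec gs xs ys → EvalVec (g ∷ gs) xs (y ∷ ys)

Computable : (ℕ → ℕ) → Set
Computable f = Σ (PR 1) λ c → ∀ n → Eval c (n ∷ []) (f n)

-- Every c.e. set is W_e = dom(φ_e) for some code e : PR 1.
CE : Set
CE = PR 1

W : CE → ℕ → Set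
W e n = Σ ℕ λ v → Eval e (n ∷ []) v

-- Membership of a value of a reduction in Y, where the reduction may also
-- output FALSE or TRUE; coding: 0 = FALSE, 1 = TRUE, k+2 = the number k.
InTF : (ℕ → Set) → ℕ → Set
InTF Y 0             = ⊥
InTF Y 1             = ⊤
InTF Y (suc (suc k)) = Y k

_≤m_ : CE → CE → Set
a ≤m b = Σ (ℕ → ℕ) λ f → Computable f × (∀ n → W a n ⇔ InTF (W b) (f n))

-- many-one equivalence = equality in the degree structure R_m
_≡m_ : CE → CE → Set
a ≡m b = (a ≤m b) × (b ≤m a)

data Formula (n : ℕ) : Set where
  _≤'_ : Fin n → Fin n → Formula n
  _≐_  : Fin n → Fin n → Formula n
  ⊥'   : Formula n
  ¬'_  : Formula n → Formula n
  _∧'_ : Formula n → Formula n → Formula n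
  _∨'_ : Formula n → Formula n → Formula n
  _⇒'_ : Formula n → Formula n → Formula n
  ∀'   : Formula (suc n) → Formula n
  ∃'   : Formula (suc n) → Formula n

-- Tarskian satisfaction in R_m.  Elements are represented by c.e. indices;
-- ≤ is ≤_m and = is ≡_m, so this is satisfaction in the quotient R_m.
-- (The connectives are the constructive ones; the theorem assumes excluded
-- middle, so this coincides with classical satisfaction.)
Sat : ∀ {n} → Formula n → Vec CE n → Set
Sat (i ≤' j) ρ = lookup ρ i ≤m lookup ρ j
Sat (i ≐ j)  ρ = lookup ρ i ≡m lookup ρ j
Sat ⊥'       ρ = ⊥
Sat (¬' φ)   ρ = ¬ Sat φ ρ
Sat (φ ∧' ψ) ρ = Sat φ ρ × Sat ψ ρ
Sat (φ ∨' ψ) ρ = Sat φ ρ ⊎ Sat ψ ρ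
Sat (φ ⇒' ψ) ρ = Sat φ ρ → Sat ψ ρ
Sat (∀' φ)   ρ = (x : CE) → Sat φ (x ∷ ρ)
Sat (∃' φ)   ρ = Σ CE λ x → Sat φ (x ∷ ρ)

record CodesArithmetic (φnum : Formula 1) (φeq : Formula 2)
                       (φadd φmul : Formula 3) : Set where
  private
    D : CE → Set
    D x = Sat φnum (x ∷ [])
    E : CE → CE → Set
    E x y = Sat φeq (x ∷ y ∷ [])
    A : CE → CE → CE → Set
    A x y z = Sat φadd (x ∷ y ∷ z ∷ [])
    M : CE → CE → CE → Set
    M x y z = Sat φmul (x ∷ y ∷ z ∷ [])
  field
    nonempty : Σ CE D
    E-refl   : ∀ x → D x → E x x
    E-sym    : ∀ x y → D x → D y → E x y → E y x
    E-trans  : ∀ x y z → D x → D y → D z → E x y → E y z → E x z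
    A-compat : ∀ x x′ y y′ z z′ → D x → D x′ → D y → D y′ → D z → D z′ →
               E x x′ → E y y′ → E z z′ → A x y z → A x′ y′ z′
    M-compat : ∀ x x′ y y′ z z′ → D x → D x′ → D y → D y′ → D z → D z′ →
               E x x′ → E y y′ → E z z′ → M x y z → M x′ y′ z′
    A-total  : ∀ x y → D x → D y → Σ CE λ z → D z × A x y z
    A-func   : ∀ x y z z′ → D x → D y → D z → D z′ →
               A x y z → A x y z′ → E z z′
    M-total  : ∀ x y → D x → D y → Σ CE λ z → D z × M x y z
    M-func   : ∀ x y z z′ → D x → D y → D z → D z′ →
               M x y z → M x y z′ → E z z′
    h        : CE → ℕ
    h-resp   : ∀ x y → D x → D y → E x y → h x ≡ h y
    h-inj    : ∀ x y → D x → D y → h x ≡ h y → E x y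
    h-surj   : ∀ n → Σ CE λ x → D x × h x ≡ n
    h-add    : ∀ x y z → D x → D y → D z → A x y z → h z ≡ h x + h y
    h-mul    : ∀ x y z → D x → D y → D z → M x y z → h z ≡ h x * h y

-- The number n is coded by the degrees x for which [0,x] is a chain with n elements besides 0.
--
-- One injury-free construction enumerates an equivalence relation on ℕ by collapsing points.  The
-- points are arranged in levels of countably many chains, above external points which are never
-- identified with each other.  A requirement acts at most once: either it collapses an element of a
-- given c.e. set R into a given point on the same or a lower level of the same chain, or, for a
-- computable γ, it makes some t true and γ t false.  So every level keeps infinitely many classes; if R
-- meets infinitely many surviving classes on levels ≥ l of a chain, then every point on levels ≤ l is
-- equivalent to an element of R.  For a c.e. set E of external points let S_J be the saturation of E
-- on the levels below J of one chain, and S that on the whole chain.  It follows that every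
-- c.e. C ≤ S satisfies S ≤ C, C ≤ E, or C ≡ S_J for some J ≥ 1.  If E is trivial, these degrees
-- form a chain of type ω + 1 below S, and different chains have incomparable atoms.  For arbitrary E,
-- S_1 is a strong cover of E as soon as E is the join of two incomparable degrees.
--
-- By distributivity, a join of strong covers of the joins aⱼ ∨ mⱼ codes a finite relation between two
-- disjoint chains, and going through a third, fresh chain removes disjointness.  Hence finite order
-- isomorphisms between intervals are coded by parameters, which defines equality, sum and product.
-- Finiteness of x is expressed by embedding x into every limit w whose elements have successors: the
-- chains of type ω + 1 are such w.
module Submission where

open import Defs
open import Data.Nat as ℕ
open import Data.Nat.Properties
open import Data.Fin using (Fin; zero; suc; toℕ; fromℕ<)
open import Data.Fin.Properties using (pigeonhole; toℕ-fromℕ<; toℕ<n)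
open import Data.Vec using (Vec; []; _∷_; lookup; tabulate)
open import Data.Vec.Properties using (tabulate∘lookup)
open import Data.Product using (Σ; _×_; _,_; proj₁; proj₂)
open import Data.Sum using (_⊎_; inj₁; inj₂)
open import Data.Unit using (tt)
open import Data.Empty using (⊥; ⊥-elim)
open import Function.Bundles using (_⇔_; mk⇔; Equivalence)
open import Relation.Binary.Definitions using (tri<; tri≈; tri>)
open import Relation.Binary.PropositionalEquality
open import Relation.Nullary using (¬_; Dec; yes; no)
open import Level using (0ℓ)
open import Axiom.ExcludedMiddle using (ExcludedMiddle)

-- Requirements never conflict, because merged points stay merged and an action asks for nothing
-- more. The only thing to protect is the supply of classes, and counting does it: an action removes
-- at most two roots, both at or above the `guard` of its requirement.
--
-- Linking makes reductions invertible. If the values of a reduction to S meet infinitely many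
-- surviving classes, every point of the levels concerned merges with some value, and waiting for
-- this turns a question about the point into one about an argument of the reduction. If they meet
-- only finitely many on the levels from J on, these classes never become external, so they lie
-- outside S and a finite table deals with them.
--
-- Separation makes degrees distinct over a trivial E. For other E it says too little, since
-- membership of an external value need not be decidable; but if E is a join, a value has a
-- decidable side, and linking points with values of one side is enough. The truth values of
-- reductions are represented by the external points `ext 0` and `ext 1`, so that a reduction
-- becomes a map between points.

open Equivalence using (to; from)

-- Programs for numerical functions: expressions, search and pairing.

module PrimitiveRecursion where

  Fn : ℕ → Set
  Fn zero    = ℕ
  Fn (suc k) = ℕ → Fn k

  infixl 5 _$$_
  _$$_ : ∀ {k} → Fn k → Vec ℕ k → ℕ
  f $$ []       = f
  f $$ (x ∷ xs) = f x $$ xs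

  Comp : ∀ k → Fn k → Set
  Comp k f = Σ (PR k) λ c → ∀ xs → Eval c xs (f $$ xs)

  natrec : ℕ → (ℕ → ℕ → ℕ) → ℕ → ℕ
  natrec b s zero    = b
  natrec b s (suc n) = s n (natrec b s n)

  -- Expressions with variables replace hand-written `PR` terms. A `call` carries the program of the
  -- called function, so that every compiled function can serve as a primitive, and `computedBy`
  -- reduces computability to an equation between values.
  data Exp (n : ℕ) : Set where
    var  : Fin n → Exp n
    lit  : ℕ → Exp n
    rec  : Exp n → Exp (suc (suc n)) → Exp n → Exp n
    call : ∀ {k} (f : Fn k) → Comp k f → Vec (Exp n) k → Exp n

  mutual
    ⟦_⟧ : ∀ {n} → Exp n → Vec ℕ n → ℕ
    ⟦ var i ⟧ ρ       = lookup ρ i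
    ⟦ lit a ⟧ ρ       = a
    ⟦ rec b s t ⟧ ρ   = natrec (⟦ b ⟧ ρ) (λ y w → ⟦ s ⟧ (y ∷ w ∷ ρ)) (⟦ t ⟧ ρ)
    ⟦ call f _ es ⟧ ρ = f $$ ⟦ es ⟧* ρ

    ⟦_⟧* : ∀ {n k} → Vec (Exp n) k → Vec ℕ n → Vec ℕ k
    ⟦ [] ⟧* ρ     = []
    ⟦ e ∷ es ⟧* ρ = ⟦ e ⟧ ρ ∷ ⟦ es ⟧* ρ

  projections : ∀ n → Vec (PR n) n
  projections n = tabulate proj

  evalTabulate : ∀ {m n} (g : Fin m → Fin n) (xs : Vec ℕ n) →
                 EvalVec (tabulate (λ i → proj (g i))) xs (tabulate (λ i → lookup xs (g i)))
  evalTabulate {zero}  g xs = []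
  evalTabulate {suc m} g xs = ev-proj ∷ evalTabulate (λ i → g (suc i)) xs

  evalProjections : ∀ {n} (xs : Vec ℕ n) → EvalVec (projections n) xs xs
  evalProjections xs = subst (EvalVec _ xs) (tabulate∘lookup xs) (evalTabulate (λ i → i) xs)

  numeral : ∀ {n} → ℕ → PR n
  numeral zero    = zer
  numeral (suc a) = comp succ (numeral a ∷ [])

  evalNumeral : ∀ {n} a {xs : Vec ℕ n} → Eval (numeral a) xs a
  evalNumeral zero    = ev-zer
  evalNumeral (suc a) = ev-comp (evalNumeral a ∷ []) ev-succ

  mutual
    compile : ∀ {n} → Exp n → PR n
    compile (var i)            = proj i
    compile (lit a)            = numeral a
    compile (rec b s t)        = comp (prec (compile b) (compile s)) (compile t ∷ projections _)
    compile (call f (c , _) es) = comp c (compile* es)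

    compile* : ∀ {n k} → Vec (Exp n) k → Vec (PR n) k
    compile* []       = []
    compile* (e ∷ es) = compile e ∷ compile* es

  evalRec : ∀ {n} {f : PR n} {g : PR (suc (suc n))} {xs} b (s : ℕ → ℕ → ℕ) →
            Eval f xs b → (∀ y w → Eval g (y ∷ w ∷ xs) (s y w)) →
            ∀ k → Eval (prec f g) (k ∷ xs) (natrec b s k)
  evalRec b s ef eg zero    = ev-prec0 ef
  evalRec b s ef eg (suc k) = ev-precS (evalRec b s ef eg k) (eg k _)

  mutual
    evalCompile : ∀ {n} (e : Exp n) ρ → Eval (compile e) ρ (⟦ e ⟧ ρ)
    evalCompile (var i) ρ              = ev-proj
    evalCompile (lit a) ρ              = evalNumeral a
    evalCompile (rec b s t) ρ          =
      ev-comp (evalCompile t ρ ∷ evalProjections ρ)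
              (evalRec _ _ (evalCompile b ρ) (λ y w → evalCompile s (y ∷ w ∷ ρ)) (⟦ t ⟧ ρ))
    evalCompile (call f (c , ev) es) ρ = ev-comp (evalCompile* es ρ) (ev (⟦ es ⟧* ρ))

    evalCompile* : ∀ {n k} (es : Vec (Exp n) k) ρ → EvalVec (compile* es) ρ (⟦ es ⟧* ρ)
    evalCompile* [] ρ       = []
    evalCompile* (e ∷ es) ρ = evalCompile e ρ ∷ evalCompile* es ρ

  abstract
    computedBy : ∀ {n} (f : Fn n) (e : Exp n) → (∀ ρ → ⟦ e ⟧ ρ ≡ f $$ ρ) → Comp n f
    computedBy f e eq = compile e , λ ρ → subst (Eval _ ρ) (eq ρ) (evalCompile e ρ)

  computable : ∀ {f} → Comp 1 f → Computable f
  computable (c , ev) = c , λ n → ev (n ∷ [])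

  comp₁ : ∀ {f} → Computable f → Comp 1 f
  comp₁ (c , ev) = c , λ { (n ∷ []) → ev n }

  v0 : ∀ {n} → Exp (suc n)
  v0 = var zero
  v1 : ∀ {n} → Exp (suc (suc n))
  v1 = var (suc zero)
  v2 : ∀ {n} → Exp (suc (suc (suc n)))
  v2 = var (suc (suc zero))
  v3 : ∀ {n} → Exp (suc (suc (suc (suc n))))
  v3 = var (suc (suc (suc zero)))
  v4 : ∀ {n} → Exp (suc (suc (suc (suc (suc n)))))
  v4 = var (suc (suc (suc (suc zero))))

  ifz : ℕ → ℕ → ℕ → ℕ
  ifz zero    a b = a
  ifz (suc _) a b = b

  sucC : Comp 1 suc
  sucC = succ , λ { (x ∷ []) → ev-succ }

  sucE : ∀ {n} → Exp n → Exp n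
  sucE a = call suc sucC (a ∷ [])

  predC : Comp 1 pred
  predC = computedBy pred (rec (lit 0) v0 v0) λ { (zero ∷ []) → refl ; (suc x ∷ []) → refl }

  predE : ∀ {n} → Exp n → Exp n
  predE a = call pred predC (a ∷ [])

  ifzC : Comp 3 ifz
  -- The step of `rec` sees the counter and the previous value as its first two variables, so `v4`
  -- is the third argument of `ifz`.
  ifzC = computedBy ifz (rec v1 v4 v0)
    λ { (zero ∷ a ∷ b ∷ []) → refl ; (suc x ∷ a ∷ b ∷ []) → refl }

  ifzE : ∀ {n} → Exp n → Exp n → Exp n → Exp n
  ifzE c a b = call ifz ifzC (c ∷ a ∷ b ∷ [])

  infixl 6 _+E_ _∸E_
  infixl 7 _*E_

  +C : Comp 2 _+_
  +C = computedBy _+_ (rec v1 (sucE v1) v0) λ { (a ∷ b ∷ []) → go a b }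
    where
    go : ∀ a b → natrec b (λ _ w → suc w) a ≡ a + b
    go zero b    = refl
    go (suc a) b = cong suc (go a b)

  _+E_ : ∀ {n} → Exp n → Exp n → Exp n
  a +E b = call _+_ +C (a ∷ b ∷ [])

  *C : Comp 2 _*_
  *C = computedBy _*_ (rec (lit 0) (v3 +E v1) v0) λ { (a ∷ b ∷ []) → go a b }
    where
    go : ∀ a b → natrec 0 (λ _ w → b + w) a ≡ a * b
    go zero b    = refl
    go (suc a) b = cong (b +_) (go a b)

  _*E_ : ∀ {n} → Exp n → Exp n → Exp n
  a *E b = call _*_ *C (a ∷ b ∷ [])

  ∸C : Comp 2 _∸_
  ∸C = computedBy _∸_ (rec v0 (predE v1) v1) λ { (a ∷ b ∷ []) → go a b }
    where
    go : ∀ a b → natrec a (λ _ w → pred w) b ≡ a ∸ b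
    go a zero    = refl
    go a (suc b) = trans (cong pred (go a b)) (pred[m∸n]≡m∸[1+n] a b)

  _∸E_ : ∀ {n} → Exp n → Exp n → Exp n
  a ∸E b = call _∸_ ∸C (a ∷ b ∷ [])

  -- Truth values are numbers, with 0 for "true"; so + is conjunction and * is disjunction.

  neq : ℕ → ℕ → ℕ
  neq a b = (a ∸ b) + (b ∸ a)

  neqC : Comp 2 neq
  neqC = computedBy neq ((v0 ∸E v1) +E (v1 ∸E v0)) λ { (a ∷ b ∷ []) → refl }

  neqE : ∀ {n} → Exp n → Exp n → Exp n
  neqE a b = call neq neqC (a ∷ b ∷ [])

  neq⇒≡ : ∀ {a b} → neq a b ≡ 0 → a ≡ b
  neq⇒≡ {a} {b} p = ≤-antisym (m∸n≡0⇒m≤n (m+n≡0⇒m≡0 (a ∸ b) p)) (m∸n≡0⇒m≤n (m+n≡0⇒n≡0 (a ∸ b) p))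

  ≡⇒neq : ∀ {a b} → a ≡ b → neq a b ≡ 0
  ≡⇒neq {a} refl rewrite n∸n≡0 a = refl

  neg : ℕ → ℕ
  neg a = 1 ∸ a

  negC : Comp 1 neg
  negC = computedBy neg (lit 1 ∸E v0) λ { (a ∷ []) → refl }

  negE : ∀ {n} → Exp n → Exp n
  negE a = call neg negC (a ∷ [])

  neg⇒≢0 : ∀ {a} → neg a ≡ 0 → a ≢ 0
  neg⇒≢0 {zero} ()
  neg⇒≢0 {suc a} _ ()

  ≢0⇒neg : ∀ {a} → a ≢ 0 → neg a ≡ 0
  ≢0⇒neg {zero} h  = ⊥-elim (h refl)
  ≢0⇒neg {suc a} h = 0∸n≡0 a

  ifz-zero : ∀ {c a b} → c ≡ 0 → ifz c a b ≡ a
  ifz-zero refl = refl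

  ifz-nonzero : ∀ {c a b} → c ≢ 0 → ifz c a b ≡ b
  ifz-nonzero {zero} h  = ⊥-elim (h refl)
  ifz-nonzero {suc c} h = refl


  least : (g : ℕ → ℕ) → ∀ k → g k ≡ 0 → Σ ℕ λ s → (g s ≡ 0) × (∀ z → z < s → g z ≢ 0)
  least g zero p = 0 , p , λ z ()
  least g (suc k) p with g 0 ≟ 0
  ... | yes q = 0 , q , λ z ()
  ... | no q with least (λ z → g (suc z)) k p
  ... | s , r , h = suc s , r , λ { zero _ → q ; (suc z) (s≤s lt) → h z lt }

  nonzero-suc : ∀ {n} {c : PR n} {xs v} → v ≢ 0 → Eval c xs v → Σ ℕ λ k → Eval c xs (suc k)
  nonzero-suc {v = zero} h e  = ⊥-elim (h refl)
  nonzero-suc {v = suc v} h e = v , e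

  evalMu : ∀ {n} {g : Fn (suc n)} (c : Comp (suc n) g) (xs : Vec ℕ n) k → g $$ (k ∷ xs) ≡ 0 →
           Σ ℕ λ s → (g $$ (s ∷ xs) ≡ 0) × Eval (mu (proj₁ c)) xs s
  evalMu {g = g} (c , ev) xs k p with least (λ z → g $$ (z ∷ xs)) k p
  ... | s , q , h = s , q , ev-mu (subst (Eval c (s ∷ xs)) q (ev (s ∷ xs)))
                                 (λ z lt → nonzero-suc (h z lt) (ev (z ∷ xs)))

  abstract
    -- The witnesses may come from excluded middle: only their existence matters, since the program
    -- finds the least zero by itself.
    search : (g : Fn 2) → Comp 2 g → (∀ x → Σ ℕ λ s → g s x ≡ 0) →
             Σ (ℕ → ℕ) λ μ → Computable μ × (∀ x → g (μ x) x ≡ 0)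
    search g c ex = (λ x → proj₁ (h x)) , (mu (proj₁ c) , λ x → proj₂ (proj₂ (h x))) , λ x → proj₁ (proj₂ (h x))
      where
      h : ∀ x → Σ ℕ λ s → (g s x ≡ 0) × Eval (mu (proj₁ c)) (x ∷ []) s
      h x = evalMu {g = g} c (x ∷ []) (proj₁ (ex x)) (proj₂ (ex x))


  abstract
    tri : ℕ → ℕ
    tri zero    = 0
    tri (suc k) = suc k + tri k

    private
      triC : Comp 1 tri
      triC = computedBy tri (rec (lit 0) (sucE v0 +E v1) v0) λ { (a ∷ []) → go a }
        where
        go : ∀ a → natrec 0 (λ k w → suc k + w) a ≡ tri a
        go zero    = refl
        go (suc a) = cong (suc a +_) (go a)

      triE : ∀ {n} → Exp n → Exp n
      triE a = call tri triC (a ∷ [])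

      tri-mono : ∀ {a b} → a ≤ b → tri a ≤ tri b
      tri-mono z≤n     = z≤n
      tri-mono (s≤s p) = +-mono-≤ (s≤s p) (tri-mono p)

      -- The index of the Cantor diagonal through n; it grows by one exactly when n reaches the next
      -- triangular number.
      diag : ℕ → ℕ
      diag zero    = 0
      diag (suc n) = ifz (neq (suc n) (tri (suc (diag n)))) (suc (diag n)) (diag n)

      diagC : Comp 1 diag
      diagC = computedBy diag (rec (lit 0) (ifzE (neqE (sucE v0) (triE (sucE v1))) (sucE v1) v1) v0) λ { (a ∷ []) → go a }
        where
        go : ∀ a → natrec 0 (λ n w → ifz (neq (suc n) (tri (suc w))) (suc w) w) a ≡ diag a
        go zero    = refl
        go (suc a) rewrite go a = refl

      diag-spec : ∀ n → (tri (diag n) ≤ n) × (n ≤ tri (diag n) + diag n)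
      diag-spec zero = z≤n , z≤n
      diag-spec (suc n) with neq (suc n) (tri (suc (diag n))) in eq
      ... | zero = ≤-reflexive (sym (neq⇒≡ {suc n} {tri (suc (diag n))} eq)) ,
                   ≤-trans (≤-reflexive (neq⇒≡ {suc n} {tri (suc (diag n))} eq)) (m≤m+n (tri (suc (diag n))) (suc (diag n)))
      ... | suc _ with diag-spec n
      ... | lo , hi = m≤n⇒m≤1+n lo ,
                      ≤∧≢⇒< hi λ e → 0≢1+n (trans (sym (≡⇒neq {suc n} {tri (suc (diag n))} (cong suc (trans e (+-comm (tri (diag n)) _))))) eq)

      diag-unique : ∀ j k n → tri j ≤ n → n ≤ tri j + j → tri k ≤ n → n ≤ tri k + k → j ≤ k
      diag-unique j k n a b c d with j ≤? k
      ... | yes p = p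
      ... | no p = ⊥-elim (<-irrefl refl (≤-trans (s≤s (≤-trans a (≤-trans d (≤-reflexive (+-comm (tri k) k))))) (tri-mono (≰⇒> p))))

    pair : ℕ → ℕ → ℕ
    pair a b = tri (a + b) + a

    π1 : ℕ → ℕ
    π1 n = n ∸ tri (diag n)

    π2 : ℕ → ℕ
    π2 n = diag n ∸ π1 n

    pairC : Comp 2 pair
    pairC = computedBy pair (triE (v0 +E v1) +E v0) λ { (a ∷ b ∷ []) → refl }

    π1C : Comp 1 π1
    π1C = computedBy π1 (v0 ∸E triE (call diag diagC (v0 ∷ []))) λ { (a ∷ []) → refl }

    π2C : Comp 1 π2
    π2C = computedBy π2 (call diag diagC (v0 ∷ []) ∸E call π1 π1C (v0 ∷ [])) λ { (a ∷ []) → refl }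

    private
      diag-pair : ∀ a b → diag (pair a b) ≡ a + b
      diag-pair a b with diag-spec (pair a b)
      ... | lo , hi = ≤-antisym (diag-unique _ _ _ lo hi (m≤m+n _ _) (+-monoʳ-≤ (tri (a + b)) (m≤m+n a b)))
                                (diag-unique _ _ _ (m≤m+n _ _) (+-monoʳ-≤ (tri (a + b)) (m≤m+n a b)) lo hi)

    π1-pair : ∀ a b → π1 (pair a b) ≡ a
    π1-pair a b rewrite diag-pair a b = m+n∸m≡n (tri (a + b)) a

    π2-pair : ∀ a b → π2 (pair a b) ≡ b
    π2-pair a b rewrite diag-pair a b | m+n∸m≡n (tri (a + b)) a = m+n∸m≡n a b

    pair-π : ∀ n → pair (π1 n) (π2 n) ≡ n
    pair-π n with diag-spec n
    ... | lo , hi = trans (cong (λ z → tri z + π1 n) (m+[n∸m]≡n le)) (m+[n∸m]≡n lo)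
      where
      le : π1 n ≤ diag n
      le = ≤-trans (∸-monoˡ-≤ (tri (diag n)) hi) (≤-reflexive (m+n∸m≡n (tri (diag n)) (diag n)))

    pair-mono : ∀ {a a′ b b′} → a ≤ a′ → b ≤ b′ → pair a b ≤ pair a′ b′
    pair-mono p q = +-mono-≤ (tri-mono (+-mono-≤ p q)) p

    -- With this a second component can serve as padding: the stage `pair q u` comes no earlier than
    -- u.
    right≤pair : ∀ a b → b ≤ pair a b
    right≤pair a b = ≤-trans (m≤n+m b a) (≤-trans (le (a + b)) (m≤m+n _ _))
      where
      le : ∀ n → n ≤ tri n
      le zero    = z≤n
      le (suc n) = m≤m+n (suc n) (tri n)

  pairE : ∀ {n} → Exp n → Exp n → Exp n
  pairE a b = call pair pairC (a ∷ b ∷ [])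
  π1E : ∀ {n} → Exp n → Exp n
  π1E a = call π1 π1C (a ∷ [])
  π2E : ∀ {n} → Exp n → Exp n
  π2E a = call π2 π2C (a ∷ [])

-- A universal function: a stack machine that runs coded programs.

module UniversalMachine where

  open PrimitiveRecursion

  iter : (ℕ → ℕ) → ℕ → ℕ → ℕ
  iter f zero x    = x
  iter f (suc t) x = f (iter f t x)

  iter-+ : ∀ f s t x → iter f (s + t) x ≡ iter f s (iter f t x)
  iter-+ f zero t x    = refl
  iter-+ f (suc s) t x = cong f (iter-+ f s t x)

  iterE : ∀ {n f} → Comp 1 f → Exp n → Exp n → Exp n
  iterE {f = f} c t x = rec x (call f c (v1 ∷ [])) t

  iter-natrec : ∀ f t x → natrec x (λ _ w → f w) t ≡ iter f t x
  iter-natrec f zero x    = refl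
  iter-natrec f (suc t) x = cong f (iter-natrec f t x)

  case8 : Fn 9
  case8 0 a b c d e f g h = a
  case8 1 a b c d e f g h = b
  case8 2 a b c d e f g h = c
  case8 3 a b c d e f g h = d
  case8 4 a b c d e f g h = e
  case8 5 a b c d e f g h = f
  case8 6 a b c d e f g h = g
  case8 (suc (suc (suc (suc (suc (suc (suc _))))))) a b c d e f g h = h

  private
    v5 : ∀ {n} → Exp (6 + n)
    v5 = var (suc (suc (suc (suc (suc zero)))))
    v6 : ∀ {n} → Exp (7 + n)
    v6 = var (suc (suc (suc (suc (suc (suc zero))))))
    v7 : ∀ {n} → Exp (8 + n)
    v7 = var (suc (suc (suc (suc (suc (suc (suc zero)))))))
    v8 : ∀ {n} → Exp (9 + n)
    v8 = var (suc (suc (suc (suc (suc (suc (suc (suc zero))))))))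

  case8C : Comp 9 case8
  case8C = computedBy case8
    (ifzE v0 v1 (ifzE (p v0) v2 (ifzE (p (p v0)) v3 (ifzE (p (p (p v0))) v4
      (ifzE (p (p (p (p v0)))) v5 (ifzE (p (p (p (p (p v0))))) v6 (ifzE (p (p (p (p (p (p v0)))))) v7 v8)))))))
    λ { (0 ∷ a ∷ b ∷ c ∷ d ∷ e ∷ f ∷ g ∷ h ∷ []) → refl
      ; (1 ∷ a ∷ b ∷ c ∷ d ∷ e ∷ f ∷ g ∷ h ∷ []) → refl
      ; (2 ∷ a ∷ b ∷ c ∷ d ∷ e ∷ f ∷ g ∷ h ∷ []) → refl
      ; (3 ∷ a ∷ b ∷ c ∷ d ∷ e ∷ f ∷ g ∷ h ∷ []) → refl
      ; (4 ∷ a ∷ b ∷ c ∷ d ∷ e ∷ f ∷ g ∷ h ∷ []) → refl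
      ; (5 ∷ a ∷ b ∷ c ∷ d ∷ e ∷ f ∷ g ∷ h ∷ []) → refl
      ; (6 ∷ a ∷ b ∷ c ∷ d ∷ e ∷ f ∷ g ∷ h ∷ []) → refl
      ; (suc (suc (suc (suc (suc (suc (suc _)))))) ∷ a ∷ b ∷ c ∷ d ∷ e ∷ f ∷ g ∷ h ∷ []) → refl }
    where
    p : ∀ {n} → Exp n → Exp n
    p = predE

  nth : ℕ → ℕ → ℕ
  nth k xs = π1 (iter π2 k xs)

  nthC : Comp 2 nth
  nthC = computedBy nth (π1E (iterE π2C v0 v1)) λ { (k ∷ xs ∷ []) → cong π1 (iter-natrec π2 k xs) }

  nthE : ∀ {n} → Exp n → Exp n → Exp n
  nthE k xs = call nth nthC (k ∷ xs ∷ [])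

  ⌜_⌝ᵛ : ∀ {n} → Vec ℕ n → ℕ
  ⌜ [] ⌝ᵛ     = 0
  ⌜ x ∷ xs ⌝ᵛ = pair x ⌜ xs ⌝ᵛ

  ⌜_⌝ᶠ : ∀ {n} → Fin n → ℕ
  ⌜ zero ⌝ᶠ  = 0
  ⌜ suc i ⌝ᶠ = suc ⌜ i ⌝ᶠ

  iter-shift : ∀ f k x → iter f (suc k) x ≡ iter f k (f x)
  iter-shift f zero x    = refl
  iter-shift f (suc k) x = cong f (iter-shift f k x)

  nth-lookup : ∀ {n} (i : Fin n) (xs : Vec ℕ n) → nth ⌜ i ⌝ᶠ ⌜ xs ⌝ᵛ ≡ lookup xs i
  nth-lookup zero (x ∷ xs)    = π1-pair x _
  nth-lookup (suc i) (x ∷ xs) = trans (cong π1 (trans (iter-shift π2 ⌜ i ⌝ᶠ _) (cong (iter π2 ⌜ i ⌝ᶠ) (π2-pair x _))))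
                                      (nth-lookup i xs)

  mutual
    -- Lists of programs share the tags with programs (6 and 7), so the machine evaluates a list
    -- like a program whose value is the coded list of results.
    ⌜_⌝ : ∀ {n} → PR n → ℕ
    ⌜ zer ⌝       = pair 0 0
    ⌜ succ ⌝      = pair 1 0
    ⌜ proj i ⌝    = pair 2 ⌜ i ⌝ᶠ
    ⌜ comp f gs ⌝ = pair 3 (pair ⌜ f ⌝ ⌜ gs ⌝*)
    ⌜ prec f g ⌝  = pair 4 (pair ⌜ f ⌝ ⌜ g ⌝)
    ⌜ mu f ⌝      = pair 5 ⌜ f ⌝

    ⌜_⌝* : ∀ {n k} → Vec (PR n) k → ℕ
    ⌜ [] ⌝*     = pair 6 0
    ⌜ g ∷ gs ⌝* = pair 7 (pair ⌜ g ⌝ ⌜ gs ⌝*)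

  -- A configuration either evaluates a code c on arguments xs or returns a value v, to a stack K of frames.
  ev : ℕ → ℕ → ℕ → ℕ
  ev c xs K = pair 0 (pair c (pair xs K))

  ret : ℕ → ℕ → ℕ
  ret v K = pair 1 (pair v K)

  -- Frame 1 waits for the arguments of a composition, 2 for the previous value of a recursion, 3
  -- for the tested value of a search, 4 for the head and 5 for the tail of an argument list.
  frame : ℕ → ℕ → ℕ → ℕ
  frame tag d K = pair (pair tag d) K

  evE : ∀ {n} → Exp n → Exp n → Exp n → Exp n
  evE c xs K = pairE (lit 0) (pairE c (pairE xs K))

  retE : ∀ {n} → Exp n → Exp n → Exp n
  retE v K = pairE (lit 1) (pairE v K)

  frameE : ∀ {n} → ℕ → Exp n → Exp n → Exp n
  frameE tag d K = pairE (pairE (lit tag) d) K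

  evStep : Fn 4
  evStep tag d xs K = case8 tag
    (ret 0 K)
    (ret (suc (π1 xs)) K)
    (ret (nth d xs) K)
    (ev (π2 d) xs (frame 1 (π1 d) K))
    (ifz (π1 xs) (ev (π1 d) (π2 xs) K)
      (ev (pair 4 d) (pair (pred (π1 xs)) (π2 xs)) (frame 2 (pair (π2 d) (pair (pred (π1 xs)) (π2 xs))) K)))
    (ev d (pair 0 xs) (frame 3 (pair d (pair 0 xs)) K))
    (ret 0 K)
    (ev (π1 d) xs (frame 4 (pair (π2 d) xs) K))

  evStepC : Comp 4 evStep
  evStepC = computedBy evStep
    (call case8 case8C (v0 ∷
      retE (lit 0) v3 ∷
      retE (sucE (π1E v2)) v3 ∷
      retE (nthE v1 v2) v3 ∷
      evE (π2E v1) v2 (frameE 1 (π1E v1) v3) ∷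
      ifzE (π1E v2) (evE (π1E v1) (π2E v2) v3)
        (evE (pairE (lit 4) v1) (pairE (predE (π1E v2)) (π2E v2)) (frameE 2 (pairE (π2E v1) (pairE (predE (π1E v2)) (π2E v2))) v3)) ∷
      evE v1 (pairE (lit 0) v2) (frameE 3 (pairE v1 (pairE (lit 0) v2)) v3) ∷
      retE (lit 0) v3 ∷
      evE (π1E v1) v2 (frameE 4 (pairE (π2E v1) v2) v3) ∷ []))
    λ { (tag ∷ d ∷ xs ∷ K ∷ []) → refl }

  -- A return to frame 0 halts.
  retStep : Fn 5
  retStep cfg v tag d K = case8 tag
    cfg
    (ev d v K)
    (ev (π1 d) (pair (π1 (π2 d)) (pair v (π2 (π2 d)))) K)
    (ifz v (ret (π1 (π2 d)) K)
      (ev (π1 d) (pair (suc (π1 (π2 d))) (π2 (π2 d))) (frame 3 (pair (π1 d) (pair (suc (π1 (π2 d))) (π2 (π2 d)))) K)))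
    (ev (π1 d) (π2 d) (frame 5 v K))
    (ret (pair d v) K)
    0
    0

  retStepC : Comp 5 retStep
  retStepC = computedBy retStep
    (call case8 case8C (v2 ∷
      v0 ∷
      evE v3 v1 v4 ∷
      evE (π1E v3) (pairE (π1E (π2E v3)) (pairE v1 (π2E (π2E v3)))) v4 ∷
      ifzE v1 (retE (π1E (π2E v3)) v4)
        (evE (π1E v3) (pairE (sucE (π1E (π2E v3))) (π2E (π2E v3))) (frameE 3 (pairE (π1E v3) (pairE (sucE (π1E (π2E v3))) (π2E (π2E v3)))) v4)) ∷
      evE (π1E v3) (π2E v3) (frameE 5 v1 v4) ∷
      retE (pairE v3 v1) v4 ∷
      lit 0 ∷
      lit 0 ∷ []))
    λ { (cfg ∷ v ∷ tag ∷ d ∷ K ∷ []) → refl }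

  step : ℕ → ℕ
  step cfg = ifz (π1 cfg)
    (evStep (π1 (π1 (π2 cfg))) (π2 (π1 (π2 cfg))) (π1 (π2 (π2 cfg))) (π2 (π2 (π2 cfg))))
    (retStep cfg (π1 (π2 cfg)) (π1 (π1 (π2 (π2 cfg)))) (π2 (π1 (π2 (π2 cfg)))) (π2 (π2 (π2 cfg))))

  stepC : Comp 1 step
  stepC = computedBy step
    (ifzE (π1E v0)
      (call evStep evStepC (π1E (π1E (π2E v0)) ∷ π2E (π1E (π2E v0)) ∷ π1E (π2E (π2E v0)) ∷ π2E (π2E (π2E v0)) ∷ []))
      (call retStep retStepC (v0 ∷ π1E (π2E v0) ∷ π1E (π1E (π2E (π2E v0))) ∷ π2E (π1E (π2E (π2E v0))) ∷ π2E (π2E (π2E v0)) ∷ [])))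
    λ { (cfg ∷ []) → refl }

  step-ev : ∀ tag d xs K → step (ev (pair tag d) xs K) ≡ evStep tag d xs K
  step-ev tag d xs K
    rewrite π1-pair 0 (pair (pair tag d) (pair xs K)) | π2-pair 0 (pair (pair tag d) (pair xs K))
          | π1-pair (pair tag d) (pair xs K) | π2-pair (pair tag d) (pair xs K)
          | π1-pair tag d | π2-pair tag d | π1-pair xs K | π2-pair xs K = refl

  step-ret : ∀ v tag d K → step (ret v (frame tag d K)) ≡ retStep (ret v (frame tag d K)) v tag d K
  step-ret v tag d K
    rewrite π1-pair 1 (pair v (pair (pair tag d) K)) | π2-pair 1 (pair v (pair (pair tag d) K))
          | π1-pair v (pair (pair tag d) K) | π2-pair v (pair (pair tag d) K)
          | π1-pair (pair tag d) K | π2-pair (pair tag d) K | π1-pair tag d | π2-pair tag d = refl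

  infix 4 _⟶_
  _⟶_ : ℕ → ℕ → Set
  x ⟶ y = Σ ℕ λ t → iter step t x ≡ y

  infixr 5 _⟫_
  _⟫_ : ∀ {x y z} → x ⟶ y → y ⟶ z → x ⟶ z
  _⟫_ {x} (s , p) (t , q) = t + s , trans (iter-+ step t s x) (trans (cong (iter step t) p) q)

  one : ∀ {x y} → step x ≡ y → x ⟶ y
  one p = 1 , p

  ev≡ : ∀ {c c′ xs xs′ K K′} → c ≡ c′ → xs ≡ xs′ → K ≡ K′ → ev c xs K ≡ ev c′ xs′ K′
  ev≡ refl refl refl = refl

  private
    prec-unfold : ∀ f g y xs K →
      ev (pair 4 (pair f g)) (pair (suc y) xs) K ⟶ ev (pair 4 (pair f g)) (pair y xs) (frame 2 (pair g (pair y xs)) K)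
    prec-unfold f g y xs K = one (trans (step-ev 4 (pair f g) (pair (suc y) xs) K) eq)
      where
      eq : evStep 4 (pair f g) (pair (suc y) xs) K ≡ ev (pair 4 (pair f g)) (pair y xs) (frame 2 (pair g (pair y xs)) K)
      eq rewrite π1-pair (suc y) xs | π2-pair (suc y) xs | π2-pair f g = refl

    prec-return : ∀ w g y xs K → ret w (frame 2 (pair g (pair y xs)) K) ⟶ ev g (pair y (pair w xs)) K
    prec-return w g y xs K = one (trans (step-ret w 2 (pair g (pair y xs)) K) eq)
      where
      eq : retStep (ret w (frame 2 (pair g (pair y xs)) K)) w 2 (pair g (pair y xs)) K ≡ ev g (pair y (pair w xs)) K
      eq rewrite π1-pair g (pair y xs) | π2-pair g (pair y xs) | π1-pair y xs | π2-pair y xs = refl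

    mu-found : ∀ f y xs K → ret 0 (frame 3 (pair f (pair y xs)) K) ⟶ ret y K
    mu-found f y xs K = one (trans (step-ret 0 3 (pair f (pair y xs)) K) eq)
      where
      eq : retStep (ret 0 (frame 3 (pair f (pair y xs)) K)) 0 3 (pair f (pair y xs)) K ≡ ret y K
      eq rewrite π2-pair f (pair y xs) | π1-pair y xs = refl

    mu-next : ∀ f k y xs K → ret (suc k) (frame 3 (pair f (pair y xs)) K) ⟶
              ev f (pair (suc y) xs) (frame 3 (pair f (pair (suc y) xs)) K)
    mu-next f k y xs K = one (trans (step-ret (suc k) 3 (pair f (pair y xs)) K) eq)
      where
      eq : retStep (ret (suc k) (frame 3 (pair f (pair y xs)) K)) (suc k) 3 (pair f (pair y xs)) K ≡
           ev f (pair (suc y) xs) (frame 3 (pair f (pair (suc y) xs)) K)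
      eq rewrite π1-pair f (pair y xs) | π2-pair f (pair y xs) | π1-pair y xs | π2-pair y xs = refl

    mu-loop : ∀ f xs K y → (∀ z → z < y → Σ _ λ k → ∀ K → ev f (pair z xs) K ⟶ ret (suc k) K) →
              ev f (pair 0 xs) (frame 3 (pair f (pair 0 xs)) K) ⟶ ev f (pair y xs) (frame 3 (pair f (pair y xs)) K)
    mu-loop f xs K zero h    = 0 , refl
    mu-loop f xs K (suc y) h with h y ≤-refl
    ... | k , r = mu-loop f xs K y (λ z lt → h z (m≤n⇒m≤1+n lt)) ⟫ r _ ⟫ mu-next f k y xs K

  mutual
    -- The stack K is arbitrary, so that the runs of subprograms can be chained inside the run of
    -- the whole program.
    simulate : ∀ {n} {c : PR n} {xs v} → Eval c xs v → ∀ K → ev ⌜ c ⌝ ⌜ xs ⌝ᵛ K ⟶ ret v K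
    simulate ev-zer K = one (step-ev 0 0 _ K)
    simulate (ev-succ {x}) K = one (trans (step-ev 1 0 _ K) (cong (λ z → ret (suc z) K) (π1-pair x 0)))
    simulate (ev-proj {i = i} {xs = xs}) K = one (trans (step-ev 2 _ _ K) (cong (λ z → ret z K) (nth-lookup i xs)))
    simulate (ev-comp {f = f} {gs} {xs} {ys} es e) K =
      one (trans (step-ev 3 (pair ⌜ f ⌝ ⌜ gs ⌝*) _ K)
                 (ev≡ (π2-pair ⌜ f ⌝ _) refl (cong (λ z → frame 1 z K) (π1-pair ⌜ f ⌝ ⌜ gs ⌝*))))
      ⟫ simulate* es (frame 1 ⌜ f ⌝ K)
      ⟫ one (step-ret ⌜ ys ⌝ᵛ 1 ⌜ f ⌝ K)
      ⟫ simulate e K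
    simulate (ev-prec0 {f = f} {g} {xs} e) K = one (trans (step-ev 4 _ _ K) eq) ⟫ simulate e K
      where
      eq : evStep 4 (pair ⌜ f ⌝ ⌜ g ⌝) (pair 0 ⌜ xs ⌝ᵛ) K ≡ ev ⌜ f ⌝ ⌜ xs ⌝ᵛ K
      eq rewrite π1-pair 0 ⌜ xs ⌝ᵛ | π2-pair 0 ⌜ xs ⌝ᵛ | π1-pair ⌜ f ⌝ ⌜ g ⌝ = refl
    simulate (ev-precS {f = f} {g} {y} {xs} {w} e e′) K =
      prec-unfold ⌜ f ⌝ ⌜ g ⌝ y ⌜ xs ⌝ᵛ K ⟫ simulate e _ ⟫ prec-return w ⌜ g ⌝ y ⌜ xs ⌝ᵛ K ⟫ simulate e′ K
    simulate (ev-mu {f = f} {xs} {y} e h) K =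
      one (step-ev 5 ⌜ f ⌝ _ K)
      ⟫ mu-loop ⌜ f ⌝ ⌜ xs ⌝ᵛ K y (λ z lt → proj₁ (h z lt) , simulate (proj₂ (h z lt)))
      ⟫ simulate e _ ⟫ mu-found ⌜ f ⌝ y ⌜ xs ⌝ᵛ K

    simulate* : ∀ {n k} {gs : Vec (PR n) k} {xs ys} → EvalVec gs xs ys → ∀ K → ev ⌜ gs ⌝* ⌜ xs ⌝ᵛ K ⟶ ret ⌜ ys ⌝ᵛ K
    simulate* [] K = one (step-ev 6 0 _ K)
    simulate* (_∷_ {g = g} {gs} {xs} {y} {ys} e es) K =
      one (trans (step-ev 7 (pair ⌜ g ⌝ ⌜ gs ⌝*) _ K)
                 (ev≡ (π1-pair ⌜ g ⌝ _) refl (cong (λ z → frame 4 (pair z ⌜ xs ⌝ᵛ) K) (π2-pair ⌜ g ⌝ ⌜ gs ⌝*))))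
      ⟫ simulate e _
      ⟫ one (trans (step-ret y 4 (pair ⌜ gs ⌝* ⌜ xs ⌝ᵛ) K)
                   (ev≡ (π1-pair ⌜ gs ⌝* _) (π2-pair ⌜ gs ⌝* _) refl))
      ⟫ simulate* es _
      ⟫ one (step-ret ⌜ ys ⌝ᵛ 5 y K)

  halted : ℕ → ℕ
  halted cfg = neq (π1 cfg) 1 + π1 (π1 (π2 (π2 cfg)))

  haltedC : Comp 1 halted
  haltedC = computedBy halted (neqE (π1E v0) (lit 1) +E π1E (π1E (π2E (π2E v0)))) λ { (c ∷ []) → refl }

  start : ℕ → ℕ → ℕ
  start e n = ev e (pair n 0) (frame 0 0 0)

  abstract
    -- Here t codes an input and a number of steps, and an unfinished run yields 0. Thus one total
    -- computable function lists, for the code of any total f, all values of f other than 0; these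
    -- serve as candidates of the requirements.
    V : ℕ → ℕ → ℕ
    V e t = ifz (halted (iter step (π2 t) (start e (π1 t)))) (π1 (π2 (iter step (π2 t) (start e (π1 t))))) 0

    VC : Comp 2 V
    VC = computedBy V (ifzE (call halted haltedC (run ∷ [])) (π1E (π2E run)) (lit 0))
      λ { (e ∷ t ∷ []) → cong (λ z → ifz (halted z) (π1 (π2 z)) 0) (iter-natrec step (π2 t) (start e (π1 t))) }
      where
      run : Exp 2
      run = iterE stepC (π2E v1) (evE v0 (pairE (π1E v1) (lit 0)) (frameE 0 (lit 0) (lit 0)))

    private
      halted-step : ∀ cfg → halted cfg ≡ 0 → step cfg ≡ cfg
      halted-step cfg h = subst₂ (λ a b → ifz a (evStep (π1 (π1 (π2 cfg))) (π2 (π1 (π2 cfg))) (π1 (π2 (π2 cfg))) (π2 (π2 (π2 cfg))))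
          (retStep cfg (π1 (π2 cfg)) b (π2 (π1 (π2 (π2 cfg)))) (π2 (π2 (π2 cfg)))) ≡ cfg)
        (sym (neq⇒≡ {π1 cfg} {1} (m+n≡0⇒m≡0 (neq (π1 cfg) 1) h))) (sym (m+n≡0⇒n≡0 (neq (π1 cfg) 1) h)) refl

      halted-iter : ∀ t cfg → halted cfg ≡ 0 → iter step t cfg ≡ cfg
      halted-iter zero cfg h    = refl
      halted-iter (suc t) cfg h = trans (cong step (halted-iter t cfg h)) (halted-step cfg h)

      halted-ret : ∀ v → halted (ret v (frame 0 0 0)) ≡ 0
      halted-ret v rewrite π1-pair 1 (pair v (frame 0 0 0)) | π2-pair 1 (pair v (frame 0 0 0))
                         | π2-pair v (frame 0 0 0) | π1-pair (pair 0 0) 0 | π1-pair 0 0 = refl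

      value-ret : ∀ v K → π1 (π2 (ret v K)) ≡ v
      value-ret v K = trans (cong π1 (π2-pair 1 _)) (π1-pair v K)

      halted-unique : ∀ cfg s t → halted (iter step s cfg) ≡ 0 → halted (iter step t cfg) ≡ 0 →
                      iter step s cfg ≡ iter step t cfg
      halted-unique cfg s t hs ht with ≤-total s t
      ... | inj₁ le = trans (sym (halted-iter (t ∸ s) _ hs)) (trans (sym (iter-+ step (t ∸ s) s cfg)) (cong (λ z → iter step z cfg) (m∸n+n≡m le)))
      ... | inj₂ le = trans (cong (λ z → iter step z cfg) (sym (m∸n+n≡m le))) (trans (iter-+ step (s ∸ t) t cfg) (halted-iter (s ∸ t) _ ht))

    V-complete : ∀ {f} (c : Computable f) n → Σ ℕ λ t → V ⌜ proj₁ c ⌝ t ≡ f n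
    V-complete {f} (c , e) n with simulate (e n) (frame 0 0 0)
    ... | t , p = pair n t , eq
      where
      eq : V ⌜ c ⌝ (pair n t) ≡ f n
      eq rewrite π1-pair n t | π2-pair n t | p | halted-ret (f n) = value-ret (f n) _

    -- A halted configuration is a fixed point of `step`, so any two halted runs from the same start
    -- agree, and one of them is the run found by `simulate`.
    V-sound : ∀ {f} (c : Computable f) t → (V ⌜ proj₁ c ⌝ t ≡ 0) ⊎ (V ⌜ proj₁ c ⌝ t ≡ f (π1 t))
    V-sound {f} (c , e) t with simulate (e (π1 t)) (frame 0 0 0)
    ... | s , p with halted (iter step (π2 t) (start ⌜ c ⌝ (π1 t))) in eq
    ... | suc _ = inj₁ refl
    ... | zero  = inj₂ (trans (cong (λ z → π1 (π2 z)) (trans (halted-unique (start ⌜ c ⌝ (π1 t)) (π2 t) s eq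
                           (trans (cong halted p) (halted-ret _))) p)) (value-ret _ _))

-- The stagewise enumeration of the equivalence relation.

module Collapsing where

  open PrimitiveRecursion
  open UniversalMachine

  -- A number n = ⟨c , ⟨l , x⟩⟩ is read as the x-th point of level l of chain c, except that
  -- ⟨0 , k⟩ is the k-th external point.
  ch : ℕ → ℕ
  ch n = π1 n

  lv : ℕ → ℕ
  lv n = π1 (π2 n)

  ext : ℕ → ℕ
  ext k = pair 0 k

  -- Requirement p leaves the points below guard p alone; guard grows fast enough for fixed-points.
  guard : ℕ → ℕ
  guard p = suc (pair p (pair p (3 * p)))

  guardE : ∀ {n} → Exp n → Exp n
  guardE p = sucE (pairE p (pairE p (lit 3 *E p)))

  -- The condition `b < a` makes the representatives of a class decrease as numbers, which forces
  -- convergence. It is not imposed on external targets, since an external representative never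
  -- changes again.
  Collapsible : ℕ → ℕ → ℕ → Set
  Collapsible p a b = ch a ≢ 0 × guard p ≤ a × (ch b ≡ 0 ⊎ (ch b ≡ ch a × lv b ≤ lv a × b < a))

  private
    collapsible : Fn 3
    collapsible p a b = neg (ch a) + (guard p ∸ a) + ch b * (neq (ch b) (ch a) + (lv b ∸ lv a) + (suc b ∸ a))

    collapsibleC : Comp 3 collapsible
    collapsibleC = computedBy collapsible
      (negE (π1E v1) +E (guardE v0 ∸E v1) +E
        π1E v2 *E (neqE (π1E v2) (π1E v1) +E (π1E (π2E v2) ∸E π1E (π2E v1)) +E (sucE v2 ∸E v1)))
      λ { (p ∷ a ∷ b ∷ []) → refl }

    collapsible-sound : ∀ p a b → collapsible p a b ≡ 0 → Collapsible p a b
    collapsible-sound p a b h = neg⇒≢0 (m+n≡0⇒m≡0 (neg (ch a)) h₁) , m∸n≡0⇒m≤n (m+n≡0⇒n≡0 (neg (ch a)) h₁) , target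
      where
      h₁ = m+n≡0⇒m≡0 (neg (ch a) + (guard p ∸ a)) h
      target : ch b ≡ 0 ⊎ (ch b ≡ ch a × lv b ≤ lv a × b < a)
      target with m*n≡0⇒m≡0∨n≡0 (ch b) (m+n≡0⇒n≡0 (neg (ch a) + (guard p ∸ a)) h)
      ... | inj₁ q = inj₁ q
      ... | inj₂ q = inj₂ (neq⇒≡ (m+n≡0⇒m≡0 (neq (ch b) (ch a)) q₁) , m∸n≡0⇒m≤n (m+n≡0⇒n≡0 (neq (ch b) (ch a)) q₁) ,
                           m∸n≡0⇒m≤n (m+n≡0⇒n≡0 (neq (ch b) (ch a) + (lv b ∸ lv a)) q))
        where q₁ = m+n≡0⇒m≡0 (neq (ch b) (ch a) + (lv b ∸ lv a)) q

    +≡0 : ∀ {a b} → a ≡ 0 → b ≡ 0 → a + b ≡ 0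
    +≡0 refl refl = refl

    collapsible-complete : ∀ p a b → Collapsible p a b → collapsible p a b ≡ 0
    collapsible-complete p a b (x , y , z) = +≡0 (+≡0 (≢0⇒neg x) (m≤n⇒m∸n≡0 y)) (target z)
      where
      target : ch b ≡ 0 ⊎ (ch b ≡ ch a × lv b ≤ lv a × b < a) → ch b * (neq (ch b) (ch a) + (lv b ∸ lv a) + (suc b ∸ a)) ≡ 0
      target (inj₁ q) rewrite q = refl
      target (inj₂ (q₁ , q₂ , q₃)) =
        trans (cong (ch b *_) (+≡0 (+≡0 (≡⇒neq q₁) (m≤n⇒m∸n≡0 q₂)) (m≤n⇒m∸n≡0 q₃))) (*-zeroʳ (ch b))

  opaque
    -- Both collapses of an action happen at once. A linking action has equal sources and equal
    -- targets, so that it performs a single collapse.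
    move : Fn 5
    move a b c d z = ifz (neq z a) b (ifz (neq z c) d z)

    moveC : Comp 5 move
    moveC = computedBy move (ifzE (neqE v4 v0) v1 (ifzE (neqE v4 v2) v3 v4)) λ { (a ∷ b ∷ c ∷ d ∷ z ∷ []) → refl }

    move-first : ∀ {a b c d z} → z ≡ a → move a b c d z ≡ b
    move-first e = ifz-zero (≡⇒neq e)

    move-second : ∀ {a b c d z} → z ≢ a → z ≡ c → move a b c d z ≡ d
    move-second n e = trans (ifz-nonzero (λ h → n (neq⇒≡ h))) (ifz-zero (≡⇒neq e))

    move-other : ∀ {a b c d z} → z ≢ a → z ≢ c → move a b c d z ≡ z
    move-other n m = trans (ifz-nonzero (λ h → n (neq⇒≡ h))) (ifz-nonzero (λ h → m (neq⇒≡ h)))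

  -- An entry of the history is 0, or 1 + ⟨p , ⟨⟨a , b⟩ , ⟨c , d⟩⟩⟩ if requirement p collapsed a to b and c to d.
  apply : ℕ → ℕ → ℕ
  apply e z = ifz e z (move (π1 (π1 (π2 (pred e)))) (π2 (π1 (π2 (pred e)))) (π1 (π2 (π2 (pred e)))) (π2 (π2 (π2 (pred e)))) z)

  private
    applyC : Comp 2 apply
    applyC = computedBy apply
      (ifzE v0 v1 (call move moveC (π1E (π1E (π2E (predE v0))) ∷ π2E (π1E (π2E (predE v0))) ∷
                                    π1E (π2E (π2E (predE v0))) ∷ π2E (π2E (π2E (predE v0))) ∷ v1 ∷ [])))
      λ { (e ∷ z ∷ []) → refl }

    -- A history lists its latest entry first, so the entry of stage k stands at place `s ∸ suc k`,
    -- and the entries are applied in the order of their stages.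
    rootIn : Fn 3
    rootIn s H y = natrec y (λ k w → apply (nth (s ∸ suc k) H) w) s

    rootInC : Comp 3 rootIn
    rootInC = computedBy rootIn (rec v2 (call apply applyC (nthE (v2 ∸E sucE v0) v3 ∷ v1 ∷ [])) v0)
      λ { (s ∷ H ∷ y ∷ []) → refl }

    rootInE : ∀ {n} → Exp n → Exp n → Exp n → Exp n
    rootInE s H y = call rootIn rootInC (s ∷ H ∷ y ∷ [])

    isActionOf : ℕ → ℕ → ℕ
    isActionOf p e = ifz e 1 (neq (π1 (pred e)) p)

    acted : Fn 3
    acted s H p = natrec 1 (λ k w → w * isActionOf p (nth (s ∸ suc k) H)) s

    actedC : Comp 3 acted
    actedC = computedBy acted
      (rec (lit 1) (v1 *E ifzE (nthE (v2 ∸E sucE v0) v3) (lit 1) (neqE (π1E (predE (nthE (v2 ∸E sucE v0) v3))) v4)) v0)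
      λ { (s ∷ H ∷ p ∷ []) → refl }

  -- Stage s = ⟨⟨p , t⟩ , u⟩ attends to requirement p = ⟨e , ⟨k , m⟩⟩ with candidate V e t.
  req cand kind param value : ℕ → ℕ
  req s   = π1 (π1 s)
  cand s  = V (π1 (req s)) (π2 (π1 s))
  kind s  = π1 (π2 (req s))
  param s = π2 (π2 (req s))
  value s = pred (cand s)

  private
    reqC : Comp 1 req
    reqC = computedBy req (π1E (π1E v0)) λ { (s ∷ []) → refl }
    candC : Comp 1 cand
    candC = computedBy cand (call V VC (π1E (call req reqC (v0 ∷ [])) ∷ π2E (π1E v0) ∷ [])) λ { (s ∷ []) → refl }
    kindC : Comp 1 kind
    kindC = computedBy kind (π1E (π2E (call req reqC (v0 ∷ [])))) λ { (s ∷ []) → refl }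
    paramC : Comp 1 param
    paramC = computedBy param (π2E (π2E (call req reqC (v0 ∷ [])))) λ { (s ∷ []) → refl }
    valueC : Comp 1 value
    valueC = computedBy value (predE (call cand candC (v0 ∷ []))) λ { (s ∷ []) → refl }

    reqE candE kindE paramE valueE : ∀ {n} → Exp n → Exp n
    reqE s   = call req reqC (s ∷ [])
    candE s  = call cand candC (s ∷ [])
    kindE s  = call kind kindC (s ∷ [])
    paramE s = call param paramC (s ∷ [])
    valueE s = call value valueC (s ∷ [])

    -- Kind 0 links the value to the parameter. Every other kind separates the two components of the
    -- value: the first is collapsed into the external point for TRUE, the second into the one for
    -- FALSE, provided that their roots differ.
    srcA tgtA srcC tgtC condition entry : Fn 2
    srcA s H = ifz (kind s) (rootIn s H (value s)) (rootIn s H (π1 (value s)))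
    tgtA s H = ifz (kind s) (rootIn s H (param s)) (ext 1)
    srcC s H = ifz (kind s) (rootIn s H (value s)) (rootIn s H (π2 (value s)))
    tgtC s H = ifz (kind s) (rootIn s H (param s)) (ext 0)
    condition s H = neg (cand s) + collapsible (req s) (srcA s H) (tgtA s H) + collapsible (req s) (srcC s H) (tgtC s H)
                  + kind s * neg (neq (srcA s H) (srcC s H)) + neg (acted s H (req s))
    entry s H = ifz (condition s H)
      (suc (pair (req s) (pair (pair (srcA s H) (tgtA s H)) (pair (srcC s H) (tgtC s H))))) 0

    srcAC : Comp 2 srcA
    srcAC = computedBy srcA (ifzE (kindE v0) (rootInE v0 v1 (valueE v0)) (rootInE v0 v1 (π1E (valueE v0)))) λ { (s ∷ H ∷ []) → refl }
    tgtAC : Comp 2 tgtA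
    tgtAC = computedBy tgtA (ifzE (kindE v0) (rootInE v0 v1 (paramE v0)) (pairE (lit 0) (lit 1))) λ { (s ∷ H ∷ []) → refl }
    srcCC : Comp 2 srcC
    srcCC = computedBy srcC (ifzE (kindE v0) (rootInE v0 v1 (valueE v0)) (rootInE v0 v1 (π2E (valueE v0)))) λ { (s ∷ H ∷ []) → refl }
    tgtCC : Comp 2 tgtC
    tgtCC = computedBy tgtC (ifzE (kindE v0) (rootInE v0 v1 (paramE v0)) (pairE (lit 0) (lit 0))) λ { (s ∷ H ∷ []) → refl }

    atHistory : (f : Fn 2) → Comp 2 f → Exp 2
    atHistory f c = call f c (v0 ∷ v1 ∷ [])

    conditionC : Comp 2 condition
    conditionC = computedBy condition
      (negE (candE v0) +E call collapsible collapsibleC (reqE v0 ∷ atHistory srcA srcAC ∷ atHistory tgtA tgtAC ∷ [])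
        +E call collapsible collapsibleC (reqE v0 ∷ atHistory srcC srcCC ∷ atHistory tgtC tgtCC ∷ [])
        +E kindE v0 *E negE (neqE (atHistory srcA srcAC) (atHistory srcC srcCC)) +E negE (call acted actedC (v0 ∷ v1 ∷ reqE v0 ∷ [])))
      λ { (s ∷ H ∷ []) → refl }

    entryC : Comp 2 entry
    entryC = computedBy entry
      (ifzE (atHistory condition conditionC)
        (sucE (pairE (reqE v0) (pairE (pairE (atHistory srcA srcAC) (atHistory tgtA tgtAC)) (pairE (atHistory srcC srcCC) (atHistory tgtC tgtCC)))))
        (lit 0))
      λ { (s ∷ H ∷ []) → refl }

    history : ℕ → ℕ
    history = natrec 0 (λ s H → pair (entry s H) H)

    historyC : Comp 1 history
    historyC = computedBy history (rec (lit 0) (pairE (call entry entryC (v0 ∷ v1 ∷ [])) v1) v0) λ { (s ∷ []) → refl }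

    nth-history : ∀ j k → nth j (history (suc (j + k))) ≡ entry k (history k)
    nth-history j k = trans (cong π1 (lem j k)) (π1-pair (entry k (history k)) (history k))
      where
      lem : ∀ j k → iter π2 j (history (suc (j + k))) ≡ history (suc k)
      lem zero k    = refl
      lem (suc j) k = trans (iter-shift π2 j (history (suc (suc (j + k)))))
        (trans (cong (iter π2 j) (π2-pair (entry (suc (j + k)) (history (suc (j + k)))) (history (suc (j + k))))) (lem j k))

    nth-history′ : ∀ s k → k < s → nth (s ∸ suc k) (history s) ≡ entry k (history k)
    nth-history′ s k lt = trans (cong (λ z → nth (s ∸ suc k) (history z)) (sym (trans (sym (+-suc (s ∸ suc k) k)) (m∸n+n≡m lt))))
                                (nth-history (s ∸ suc k) k)

    natrec-cong : ∀ b f g k → (∀ j w → j < k → f j w ≡ g j w) → natrec b f k ≡ natrec b g k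
    natrec-cong b f g zero h    = refl
    natrec-cong b f g (suc k) h = trans (h k _ ≤-refl) (cong (g k) (natrec-cong b f g k (λ j w lt → h j w (m≤n⇒m≤1+n lt))))

  opaque
    root : ℕ → ℕ → ℕ
    root s y = rootIn s (history s) y

    rootC : Comp 2 root
    rootC = computedBy root (rootInE v0 (call history historyC (v0 ∷ [])) v1) λ { (s ∷ y ∷ []) → refl }

    root-zero : ∀ y → root 0 y ≡ y
    root-zero y = refl

    private
      action : ℕ → ℕ
      action s = entry s (history s)

      actedBefore : ℕ → ℕ → ℕ
      actedBefore s p = acted s (history s) p

      root-suc : ∀ s y → root (suc s) y ≡ apply (action s) (root s y)
      root-suc s y = trans (root-natrec (suc s)) (cong (apply (action s)) (sym (root-natrec s)))
        where
        root-natrec : ∀ s → root s y ≡ natrec y (λ k w → apply (action k) w) s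
        root-natrec s = natrec-cong y (λ k w → apply (nth (s ∸ suc k) (history s)) w) (λ k w → apply (action k) w) s
                                    (λ j w lt → cong (λ e → apply e w) (nth-history′ s j lt))

      acted-natrec : ∀ s p → actedBefore s p ≡ natrec 1 (λ k w → w * isActionOf p (action k)) s
      acted-natrec s p = natrec-cong 1 (λ k w → w * isActionOf p (nth (s ∸ suc k) (history s))) (λ k w → w * isActionOf p (action k)) s
                                     (λ j w lt → cong (λ e → w * isActionOf p e) (nth-history′ s j lt))

  srcA′ tgtA′ srcC′ tgtC′ : ℕ → ℕ
  srcA′ s = ifz (kind s) (root s (value s)) (root s (π1 (value s)))
  tgtA′ s = ifz (kind s) (root s (param s)) (ext 1)
  srcC′ s = ifz (kind s) (root s (value s)) (root s (π2 (value s)))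
  tgtC′ s = ifz (kind s) (root s (param s)) (ext 0)

  private
    code : ℕ → ℕ
    code s = pair (req s) (pair (pair (srcA′ s) (tgtA′ s)) (pair (srcC′ s) (tgtC′ s)))

    conditionAt : ℕ → ℕ
    conditionAt s = neg (cand s) + collapsible (req s) (srcA′ s) (tgtA′ s) + collapsible (req s) (srcC′ s) (tgtC′ s)
                  + kind s * neg (neq (srcA′ s) (srcC′ s)) + neg (actedBefore s (req s))

    opaque
      unfolding root
      action-def : ∀ s → action s ≡ ifz (conditionAt s) (suc (code s)) 0
      action-def s = refl

    product-sound : ∀ (act : ℕ → ℕ) p s → natrec 1 (λ k w → w * isActionOf p (act k)) s ≡ 0 → Σ ℕ λ k → isActionOf p (act k) ≡ 0
    product-sound act p (suc s) h with m*n≡0⇒m≡0∨n≡0 (natrec 1 (λ k w → w * isActionOf p (act k)) s) h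
    ... | inj₁ q = product-sound act p s q
    ... | inj₂ q = s , q

    product-complete : ∀ (act : ℕ → ℕ) p s k → k < s → isActionOf p (act k) ≡ 0 → natrec 1 (λ k w → w * isActionOf p (act k)) s ≡ 0
    product-complete act p (suc s) k lt a with k ≟ s
    ... | yes refl = trans (cong (natrec 1 (λ k w → w * isActionOf p (act k)) s *_) a) (*-zeroʳ (natrec 1 (λ k w → w * isActionOf p (act k)) s))
    ... | no ne = cong (_* isActionOf p (act s)) (product-complete act p s k (≤∧≢⇒< (≤-pred lt) ne) a)

    isActionOf-sound : ∀ p e → isActionOf p e ≡ 0 → Σ ℕ λ q → (e ≡ suc q) × (π1 q ≡ p)
    isActionOf-sound p (suc q) h = q , refl , neq⇒≡ h

    isActionOf-complete : ∀ p e q → e ≡ suc q → π1 q ≡ p → isActionOf p e ≡ 0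
    isActionOf-complete p e q refl r = ≡⇒neq r

    condition-sound : ∀ s → conditionAt s ≡ 0 →
      cand s ≢ 0 × Collapsible (req s) (srcA′ s) (tgtA′ s) × Collapsible (req s) (srcC′ s) (tgtC′ s)
      × (kind s ≡ 0 ⊎ srcA′ s ≢ srcC′ s) × actedBefore s (req s) ≢ 0
    condition-sound s h = neg⇒≢0 (m+n≡0⇒m≡0 A h₃) , collapsible-sound _ _ _ (m+n≡0⇒n≡0 A h₃) ,
      collapsible-sound _ _ _ (m+n≡0⇒n≡0 (A + B) h₂) , dis (m*n≡0⇒m≡0∨n≡0 (kind s) (m+n≡0⇒n≡0 (A + B + C) h₁)) , neg⇒≢0 (m+n≡0⇒n≡0 (A + B + C + D) h)
      where
      A = neg (cand s)
      B = collapsible (req s) (srcA′ s) (tgtA′ s)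
      C = collapsible (req s) (srcC′ s) (tgtC′ s)
      D = kind s * neg (neq (srcA′ s) (srcC′ s))
      h₁ = m+n≡0⇒m≡0 (A + B + C + D) h
      h₂ = m+n≡0⇒m≡0 (A + B + C) h₁
      h₃ = m+n≡0⇒m≡0 (A + B) h₂
      dis : kind s ≡ 0 ⊎ neg (neq (srcA′ s) (srcC′ s)) ≡ 0 → kind s ≡ 0 ⊎ srcA′ s ≢ srcC′ s
      dis (inj₁ q) = inj₁ q
      dis (inj₂ q) = inj₂ (λ e → neg⇒≢0 q (≡⇒neq e))

    condition-complete : ∀ s →
      cand s ≢ 0 → Collapsible (req s) (srcA′ s) (tgtA′ s) → Collapsible (req s) (srcC′ s) (tgtC′ s) →
      (kind s ≡ 0 ⊎ srcA′ s ≢ srcC′ s) → actedBefore s (req s) ≢ 0 → conditionAt s ≡ 0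
    condition-complete s a b c d e =
      +≡0 (+≡0 (+≡0 (+≡0 (≢0⇒neg a) (collapsible-complete _ _ _ b)) (collapsible-complete _ _ _ c)) (dis d)) (≢0⇒neg e)
      where
      dis : (kind s ≡ 0 ⊎ srcA′ s ≢ srcC′ s) → kind s * neg (neq (srcA′ s) (srcC′ s)) ≡ 0
      dis (inj₁ q) = cong (_* neg (neq (srcA′ s) (srcC′ s))) q
      dis (inj₂ q) = trans (cong (kind s *_) (≢0⇒neg (λ e → q (neq⇒≡ e)))) (*-zeroʳ (kind s))

    apply-code : ∀ s z → apply (suc (code s)) z ≡ move (srcA′ s) (tgtA′ s) (srcC′ s) (tgtC′ s) z
    apply-code s z = lem (req s) (srcA′ s) (tgtA′ s) (srcC′ s) (tgtC′ s)
      where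
      lem : ∀ p a b c d → apply (suc (pair p (pair (pair a b) (pair c d)))) z ≡ move a b c d z
      lem p a b c d
        rewrite π2-pair p (pair (pair a b) (pair c d)) | π1-pair (pair a b) (pair c d) | π2-pair (pair a b) (pair c d)
              | π1-pair a b | π2-pair a b | π1-pair c d | π2-pair c d = refl

    action-zero : ∀ s → conditionAt s ≢ 0 → action s ≡ 0
    action-zero s h = trans (action-def s) (ifz-nonzero h)

    action-suc : ∀ s → conditionAt s ≡ 0 → action s ≡ suc (code s)
    action-suc s h = trans (action-def s) (ifz-zero h)

  opaque
    Acts : ℕ → ℕ → Set
    Acts s p = Σ ℕ λ q → (action s ≡ suc q) × (π1 q ≡ p)

    private
      acts-condition : ∀ s p → Acts s p → conditionAt s ≡ 0
      acts-condition s p (q , e , _) with conditionAt s ≟ 0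
      ... | yes h = h
      ... | no h = ⊥-elim (0≢1+n (trans (sym (action-zero s h)) e))

    acts-req : ∀ {s p} → Acts s p → p ≡ req s
    acts-req {s} {p} a@(q , e , r) = trans (sym r) (trans (cong π1 (suc-injective (trans (sym e) (action-suc s (acts-condition s p a))))) (π1-pair _ _))

    acts-facts : ∀ {s p} → Acts s p →
      cand s ≢ 0 × Collapsible (req s) (srcA′ s) (tgtA′ s) × Collapsible (req s) (srcC′ s) (tgtC′ s)
      × (kind s ≡ 0 ⊎ srcA′ s ≢ srcC′ s)
    acts-facts {s} {p} a with condition-sound s (acts-condition s p a)
    ... | x , y , z , w , _ = x , y , z , w

    acts-move : ∀ {s p} → Acts s p → ∀ y → root (suc s) y ≡ move (srcA′ s) (tgtA′ s) (srcC′ s) (tgtC′ s) (root s y)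
    acts-move {s} {p} a y = trans (root-suc s y) (trans (cong (λ e → apply e (root s y)) (action-suc s (acts-condition s p a))) (apply-code s (root s y)))

    acts-or-idle : ∀ s → (Σ ℕ λ p → Acts s p) ⊎ (∀ y → root (suc s) y ≡ root s y)
    acts-or-idle s with conditionAt s ≟ 0
    ... | yes h = inj₁ (_ , code s , action-suc s h , refl)
    ... | no h  = inj₂ λ y → trans (root-suc s y) (cong (λ e → apply e (root s y)) (action-zero s h))

    private
      acts-once : ∀ {s t p} → Acts s p → Acts t p → ¬ s < t
      acts-once {s} {t} {p} a@(q , e , r) b lt with acts-req b
      ... | refl = proj₂ (proj₂ (proj₂ (proj₂ (condition-sound t (acts-condition t p b)))))
                     (trans (acted-natrec t p) (product-complete action p t s lt (isActionOf-complete p _ q e r)))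

    acts-unique : ∀ {s t p} → Acts s p → Acts t p → s ≡ t
    acts-unique a b = ≤-antisym (≮⇒≥ (acts-once b a)) (≮⇒≥ (acts-once a b))

    -- If nothing but an earlier action prevents the requirement from acting at s, then it has acted
    -- earlier or acts now. The stage obtained may thus precede s and concern a different candidate.
    attempt : ∀ s → cand s ≢ 0 → Collapsible (req s) (srcA′ s) (tgtA′ s) → Collapsible (req s) (srcC′ s) (tgtC′ s) →
              (kind s ≡ 0 ⊎ srcA′ s ≢ srcC′ s) → Σ ℕ λ k → Acts k (req s)
    attempt s a b c d with actedBefore s (req s) ≟ 0
    ... | yes h with product-sound action (req s) s (trans (sym (acted-natrec s (req s))) h)
    ... | k , q = k , isActionOf-sound (req s) (action k) q
    attempt s a b c d | no h = s , code s , action-suc s (condition-complete s a b c d h) , π1-pair _ _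

-- Roots of classes, their limits, and the effect of the requirements.

module Roots where

  open PrimitiveRecursion
  open UniversalMachine
  open Collapsing

  ch-ext : ∀ k → ch (ext k) ≡ 0
  ch-ext k = π1-pair 0 k

  -- x may serve as the root of y
  Below : ℕ → ℕ → Set
  Below x y = ch x ≡ 0 ⊎ (ch x ≡ ch y × lv x ≤ lv y)

  private
    IsRoot : ℕ → ℕ → Set
    IsRoot s z = root s z ≡ z

    ext-root : ∀ s y → ch y ≡ 0 → root s y ≡ y
    ext-root zero y h    = root-zero y
    ext-root (suc s) y h with acts-or-idle s
    ... | inj₂ idle = trans (idle y) (ext-root s y h)
    ... | inj₁ (p , act) with acts-facts act
    ... | _ , (ca , _) , (cc , _) , _ = trans (acts-move act y) (trans (cong (move _ _ _ _) (ext-root s y h))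
          (move-other (λ e → ca (trans (cong ch (sym e)) h)) (λ e → cc (trans (cong ch (sym e)) h))))

    collapse-distinct : ∀ {p a b} → Collapsible p a b → b ≢ a
    collapse-distinct (ca , _ , inj₁ h) refl = ca h
    collapse-distinct (ca , _ , inj₂ (_ , _ , lt)) refl = <-irrefl refl lt

    -- No target is a source, so an action does not move its own results; this is what keeps `root`
    -- idempotent. For a separation it holds because targets are external and sources are not.
    tgtA-fixed : ∀ {s p} → Acts s p → tgtA′ s ≢ srcA′ s × tgtA′ s ≢ srcC′ s × tgtC′ s ≢ srcA′ s × tgtC′ s ≢ srcC′ s
    tgtA-fixed {s} act with acts-facts act
    ... | _ , ka , kc , _ with kind s
    ... | zero = collapse-distinct ka , collapse-distinct ka , collapse-distinct ka , collapse-distinct ka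
    ... | suc _ = collapse-distinct ka , (λ e → proj₁ kc (trans (cong ch (sym e)) (ch-ext 1))) ,
                  (λ e → proj₁ ka (trans (cong ch (sym e)) (ch-ext 0))) , collapse-distinct kc

    tgt-root : ∀ s → (∀ y → IsRoot s (root s y)) → IsRoot s (tgtA′ s) × IsRoot s (tgtC′ s)
    tgt-root s ih with kind s
    ... | zero = ih _ , ih _
    ... | suc _ = ext-root s _ (ch-ext 1) , ext-root s _ (ch-ext 0)

    move-idem : ∀ s a b c d (z : ℕ) → IsRoot s z → IsRoot s b → IsRoot s d → b ≢ a × b ≢ c × d ≢ a × d ≢ c →
                move a b c d (root s (move a b c d z)) ≡ move a b c d z
    move-idem s a b c d z rz rb rd (n₁ , n₂ , n₃ , n₄) with z ≟ a
    ... | yes e rewrite move-first {a} {b} {c} {d} e | rb = move-other n₁ n₂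
    ... | no ne with z ≟ c
    ... | yes e rewrite move-second {a} {b} {c} {d} ne e | rd = move-other n₃ n₄
    ... | no ne′ rewrite move-other {a} {b} {c} {d} ne ne′ | rz = move-other ne ne′

  root-idem : ∀ s y → root s (root s y) ≡ root s y
  root-idem zero y = trans (root-zero _) refl
  root-idem (suc s) y with acts-or-idle s
  ... | inj₂ idle = trans (cong (root (suc s)) (idle y)) (trans (idle _) (trans (root-idem s y) (sym (idle y))))
  ... | inj₁ (p , act) =
    trans (cong (root (suc s)) (acts-move act y)) (trans (acts-move act _)
      (trans (move-idem s _ _ _ _ (root s y) (root-idem s y) (proj₁ tr) (proj₂ tr) (tgtA-fixed act)) (sym (acts-move act y))))
    where tr = tgt-root s (root-idem s)

  private
    move-source : ∀ a b c d z → move a b c d z ≡ z ⊎ ((z ≡ a × move a b c d z ≡ b) ⊎ (z ≡ c × move a b c d z ≡ d))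
    move-source a b c d z with z ≟ a
    ... | yes e = inj₂ (inj₁ (e , move-first e))
    ... | no ne with z ≟ c
    ... | yes e = inj₂ (inj₂ (e , move-second ne e))
    ... | no ne′ = inj₁ (move-other ne ne′)

  Descends : ℕ → ℕ → Set
  Descends x z = ch x ≡ 0 ⊎ (ch x ≡ ch z × lv x ≤ lv z × x < z)

  root-step : ∀ s y → root (suc s) y ≡ root s y ⊎
    Σ ℕ λ p → Acts s p × guard p ≤ root s y × Descends (root (suc s) y) (root s y)
            × (root s y ≡ srcA′ s ⊎ root s y ≡ srcC′ s)
  root-step s y with acts-or-idle s
  ... | inj₂ idle = inj₁ (idle y)
  ... | inj₁ (p , act) with acts-facts act | acts-req act
  ... | _ , ka , kc , _ | refl with move-source (srcA′ s) (tgtA′ s) (srcC′ s) (tgtC′ s) (root s y)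
  ... | inj₁ e = inj₁ (trans (acts-move act y) e)
  ... | inj₂ (inj₁ (e , q)) = inj₂ (p , act , subst (guard p ≤_) (sym e) (proj₁ (proj₂ ka)) ,
         subst₂ Descends (sym (trans (acts-move act y) q)) (sym e) (proj₂ (proj₂ ka)) , inj₁ e)
  ... | inj₂ (inj₂ (e , q)) = inj₂ (p , act , subst (guard p ≤_) (sym e) (proj₁ (proj₂ kc)) ,
         subst₂ Descends (sym (trans (acts-move act y) q)) (sym e) (proj₂ (proj₂ kc)) , inj₂ e)

  root-mono : ∀ s k y → root (k + s) y ≡ root s y ⊎ Descends (root (k + s) y) (root s y)
  root-mono s zero y = inj₁ refl
  root-mono s (suc k) y with root-step (k + s) y | root-mono s k y
  ... | inj₁ e | inj₁ e′ = inj₁ (trans e e′)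
  ... | inj₁ e | inj₂ d = inj₂ (subst (λ z → Descends z (root s y)) (sym e) d)
  ... | inj₂ (_ , _ , _ , d , _) | inj₁ e = inj₂ (subst (Descends _) e d)
  ... | inj₂ (_ , _ , _ , inj₁ h , _) | inj₂ _ = inj₂ (inj₁ h)
  ... | inj₂ (_ , _ , _ , inj₂ (c , l , lt) , _) | inj₂ (inj₂ (c′ , l′ , lt′)) =
          inj₂ (inj₂ (trans c c′ , ≤-trans l l′ , <-trans lt lt′))
  ... | inj₂ (_ , _ , _ , inj₂ (c , l , lt) , _) | inj₂ (inj₁ h) = inj₂ (inj₁ (trans c h))

  root-ext-stable : ∀ s k y → ch (root s y) ≡ 0 → root (k + s) y ≡ root s y
  root-ext-stable s zero y h = refl
  root-ext-stable s (suc k) y h with acts-or-idle (k + s)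
  ... | inj₂ idle = trans (idle y) (root-ext-stable s k y h)
  ... | inj₁ (p , act) with acts-facts act
  ... | _ , (ca , _) , (cc , _) , _ = trans (acts-move act y) (trans (cong (move _ _ _ _) (root-ext-stable s k y h))
          (move-other (λ e → ca (trans (cong ch (sym e)) h)) (λ e → cc (trans (cong ch (sym e)) h))))

  root-merge : ∀ s k x y → root s x ≡ root s y → root (k + s) x ≡ root (k + s) y
  root-merge s zero x y h = h
  root-merge s (suc k) x y h with acts-or-idle (k + s)
  ... | inj₂ idle = trans (idle x) (trans (root-merge s k x y h) (sym (idle y)))
  ... | inj₁ (p , act) = trans (acts-move act x) (trans (cong (move _ _ _ _) (root-merge s k x y h)) (sym (acts-move act y)))

  module Limit (em : ExcludedMiddle 0ℓ) where

    private
      -- Each change lowers the root as a number until the root becomes external, and an external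
      -- root is final. So N bounds the number of changes still to be considered.
      converge : ∀ N y s → root s y < N → Σ ℕ λ t → ∀ k → root (k + t) y ≡ root t y
      converge (suc N) y s lt with em {Σ ℕ λ k → root (k + s) y ≢ root s y}
      ... | no h = s , λ k → stable k
        where
        stable : ∀ k → root (k + s) y ≡ root s y
        stable k with root (k + s) y ≟ root s y
        ... | yes e = e
        ... | no ne = ⊥-elim (h (k , ne))
      ... | yes (k , ne) with root-mono s k y
      ... | inj₁ e = ⊥-elim (ne e)
      ... | inj₂ (inj₁ h) = k + s , λ j → root-ext-stable (k + s) j y h
      ... | inj₂ (inj₂ (_ , _ , lt′)) = converge N y (k + s) (≤-trans lt′ (≤-pred lt))

    modulus : ℕ → ℕ
    modulus y = proj₁ (converge (suc (root 0 y)) y 0 ≤-refl)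

    lim : ℕ → ℕ
    lim y = root (modulus y) y

    lim-root : ∀ {s} y → modulus y ≤ s → root s y ≡ lim y
    lim-root {s} y h = trans (cong (λ z → root z y) (sym (m∸n+n≡m h))) (proj₂ (converge (suc (root 0 y)) y 0 ≤-refl) (s ∸ modulus y))

    lim-merge : ∀ s x y → root s x ≡ root s y → lim x ≡ lim y
    lim-merge s x y h = trans (sym (lim-root x hx)) (trans (root-merge s (modulus x + modulus y) x y h) (lim-root y hy))
      where
      hx : modulus x ≤ modulus x + modulus y + s
      hx = ≤-trans (m≤m+n _ _) (m≤m+n _ s)
      hy : modulus y ≤ modulus x + modulus y + s
      hy = ≤-trans (m≤n+m _ (modulus x)) (m≤m+n _ s)

    lim-of-root : ∀ s y → lim (root s y) ≡ lim y
    lim-of-root s y = lim-merge s (root s y) y (root-idem s y)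

    lim-idem : ∀ y → lim (lim y) ≡ lim y
    lim-idem y = lim-of-root (modulus y) y

    lim-ext : ∀ s y → ch (root s y) ≡ 0 → lim y ≡ root s y
    lim-ext s y h = trans (sym (lim-root y (m≤m+n (modulus y) s))) (root-ext-stable s (modulus y) y h)

    lim-external : ∀ y → ch y ≡ 0 → lim y ≡ y
    lim-external y h = trans (lim-ext 0 y (trans (cong ch (root-zero y)) h)) (root-zero y)

    root-below : ∀ s y → Below (root s y) y
    root-below s y with root-mono 0 s y
    ... | inj₁ e rewrite +-identityʳ s | e | root-zero y = inj₂ (refl , ≤-refl)
    ... | inj₂ d rewrite +-identityʳ s | root-zero y with d
    ... | inj₁ h = inj₁ h
    ... | inj₂ (c , l , _) = inj₂ (c , l)

    lim-below : ∀ y → Below (lim y) y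
    lim-below y = root-below (modulus y) y

    private
      first-change : ∀ s n → root s n ≢ n → Σ ℕ λ k → root k n ≡ n × root (suc k) n ≢ n
      first-change zero n h = ⊥-elim (h (root-zero n))
      first-change (suc s) n h with root s n ≟ n
      ... | yes e = s , e , h
      ... | no ne = first-change s n ne

      -- The index tells which of the two sources n was. Since p acts only once, p and the index
      -- determine n, and `fixed-points` counts such pairs.
      Collapsed : ℕ → ℕ → ℕ → Set
      Collapsed n p 0 = Σ ℕ λ s → Acts s p × n ≡ srcA′ s
      Collapsed n p _ = Σ ℕ λ s → Acts s p × n ≡ srcC′ s

      collapsed : ∀ n → lim n ≢ n → Σ ℕ λ p → Σ ℕ λ i → i < 2 × guard p ≤ n × Collapsed n p i
      collapsed n h with first-change (modulus n) n h
      ... | k , e , ne with root-step k n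
      ... | inj₁ q = ⊥-elim (ne (trans q e))
      ... | inj₂ (p , act , g , _ , inj₁ q) = p , 0 , s≤s z≤n , subst (guard p ≤_) e g , k , act , trans (sym e) q
      ... | inj₂ (p , act , g , _ , inj₂ q) = p , 1 , ≤-refl , subst (guard p ≤_) e g , k , act , trans (sym e) q

      collapsed-unique : ∀ {m n p i j} → i < 2 → j < 2 → i ≡ j → Collapsed m p i → Collapsed n p j → m ≡ n
      collapsed-unique {i = zero} _ _ refl (s , a , e) (t , b , f) with acts-unique a b
      ... | refl = trans e (sym f)
      collapsed-unique {i = suc zero} _ _ refl (s , a , e) (t , b , f) with acts-unique a b
      ... | refl = trans e (sym f)
      collapsed-unique {i = suc (suc i)} (s≤s (s≤s ())) _ refl _ _

      guard-mono : ∀ {p q} → p ≤ q → guard p ≤ guard q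
      guard-mono h = s≤s (pair-mono h (pair-mono h (*-monoʳ-≤ 3 h)))

      index-inj : ∀ p i q j → i < 2 → j < 2 → p * 2 + i ≡ q * 2 + j → p ≡ q × i ≡ j
      index-inj zero i zero j _ _ e = refl , e
      index-inj zero zero (suc q) j _ _ ()
      index-inj zero (suc zero) (suc q) j _ _ ()
      index-inj zero (suc (suc i)) (suc q) j (s≤s (s≤s ())) _ _
      index-inj (suc p) i zero zero _ _ ()
      index-inj (suc p) i zero (suc zero) _ _ ()
      index-inj (suc p) i zero (suc (suc j)) _ (s≤s (s≤s ())) _
      index-inj (suc p) i (suc q) j a b e with index-inj p i q j a b (suc-injective (suc-injective e))
      ... | e₁ , e₂ = cong suc e₁ , e₂

    -- Of the 2N + 1 points from K on, at most two for each of the requirements below N can be collapsed.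
    fixed-points : ∀ c l K → Σ ℕ λ x → K ≤ x × lim (pair c (pair l x)) ≡ pair c (pair l x)
    fixed-points c l K with em {Σ ℕ λ x → K ≤ x × lim (pair c (pair l x)) ≡ pair c (pair l x)}
    ... | yes h = h
    ... | no h = ⊥-elim contradiction
      where
      -- The coordinates of the tested points are at most `N`, `N` and `3 * N`, because `K ≤ N` and
      -- `x ≤ 2 * N`. So these points lie below `guard N`, and a requirement that collapses one of
      -- them is below `N`; this is the origin of the factor 3 in `guard`.
      N = c + l + K
      point : ℕ → ℕ
      point x = pair c (pair l (K + x))
      data′ : ∀ x → Σ ℕ λ p → Σ ℕ λ i → i < 2 × guard p ≤ point x × Collapsed (point x) p i
      data′ x = collapsed (point x) (λ e → h (K + x , m≤m+n K x , e))
      K≤N : K ≤ N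
      K≤N = m≤n+m K (c + l)
      small : ∀ x → x < suc (2 * N) → proj₁ (data′ x) < N
      small x lt with data′ x
      ... | p , _ , _ , g , _ with p <? N
      ... | yes q = q
      ... | no q = ⊥-elim (<-irrefl refl (≤-trans (s≤s (≤-trans g (pair-mono (≤-trans (m≤m+n c l) (m≤m+n (c + l) K))
                (pair-mono (≤-trans (m≤n+m l c) (m≤m+n (c + l) K)) (+-mono-≤ K≤N (≤-pred lt))))))
                (guard-mono {N} (≮⇒≥ q))))
      index : ℕ → ℕ
      index x = proj₁ (data′ x) * 2 + proj₁ (proj₂ (data′ x))
      index< : ∀ x → x < suc (2 * N) → index x < N * 2
      index< x lt = ≤-trans (+-monoʳ-< (proj₁ (data′ x) * 2) (proj₁ (proj₂ (proj₂ (data′ x)))))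
        (≤-trans (≤-reflexive (+-comm (proj₁ (data′ x) * 2) 2)) (*-monoˡ-≤ 2 (small x lt)))
      f : Fin (suc (2 * N)) → Fin (N * 2)
      f i = fromℕ< (index< (toℕ i) (toℕ<n i))
      contradiction : ⊥
      contradiction with pigeonhole (s≤s (≤-reflexive (*-comm N 2))) f
      ... | i , j , lt , e with index-inj (proj₁ (data′ (toℕ i))) (proj₁ (proj₂ (data′ (toℕ i)))) (proj₁ (data′ (toℕ j))) (proj₁ (proj₂ (data′ (toℕ j))))
                                (proj₁ (proj₂ (proj₂ (data′ (toℕ i))))) (proj₁ (proj₂ (proj₂ (data′ (toℕ j)))))
                                (trans (sym (toℕ-fromℕ< (index< (toℕ i) (toℕ<n i)))) (trans (cong toℕ e) (toℕ-fromℕ< (index< (toℕ j) (toℕ<n j)))))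
      ... | e₁ , e₂ = <-irrefl (+-cancelˡ-≡ K _ _ (trans (sym (unpair (toℕ i))) (trans (cong (λ z → π2 (π2 z)) same) (unpair (toℕ j))))) lt
        where
        unpair : ∀ x → π2 (π2 (point x)) ≡ K + x
        unpair x = trans (cong π2 (π2-pair c _)) (π2-pair l _)
        di = data′ (toℕ i)
        dj = data′ (toℕ j)
        same : point (toℕ i) ≡ point (toℕ j)
        same = collapsed-unique {p = proj₁ di} (proj₁ (proj₂ (proj₂ di))) (proj₁ (proj₂ (proj₂ dj))) e₂
          (proj₂ (proj₂ (proj₂ (proj₂ di)))) (subst (λ z → Collapsed (point (toℕ j)) z (proj₁ (proj₂ dj))) (sym e₁) (proj₂ (proj₂ (proj₂ (proj₂ dj)))))

    private
      -- The padding u lets every requirement meet every candidate again at stages where the roots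
      -- involved have reached their limits.
      stage : ℕ → ℕ → ℕ → ℕ
      stage p t u = pair (pair p t) u

      req-stage : ∀ p t u → req (stage p t u) ≡ p
      req-stage p t u = trans (cong π1 (π1-pair _ u)) (π1-pair p t)

      cand-stage : ∀ e q t u → cand (stage (pair e q) t u) ≡ V e t
      cand-stage e q t u = cong₂ V (trans (cong π1 (req-stage _ t u)) (π1-pair e q)) (trans (cong π2 (π1-pair _ u)) (π2-pair _ t))

      kind-req : ∀ s e k m → req s ≡ pair e (pair k m) → kind s ≡ k
      kind-req s e k m h = trans (cong (λ z → π1 (π2 z)) h) (trans (cong π1 (π2-pair e _)) (π1-pair k m))

      param-req : ∀ s e k m → req s ≡ pair e (pair k m) → param s ≡ m
      param-req s e k m h = trans (cong (λ z → π2 (π2 z)) h) (trans (cong π2 (π2-pair e _)) (π2-pair k m))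

      cand-req : ∀ s e q → req s ≡ pair e q → cand s ≡ V e (π2 (π1 s))
      cand-req s e q h = cong (λ z → V z (π2 (π1 s))) (trans (cong π1 h) (π1-pair e q))

    -- The value 0 enumerates nothing.
    Enumerated : (ℕ → ℕ) → ℕ → Set
    Enumerated f v = Σ ℕ λ t → f t ≡ suc v

    Linkable : ℕ → ℕ → Set
    Linkable m v = ch (lim v) ≢ 0 × Below (lim m) (lim v)

    private
      acts-enumerated : ∀ {f} (c : Computable f) {s q} → Acts s (pair ⌜ proj₁ c ⌝ q) → Enumerated f (value s)
      acts-enumerated c {s} {q} act with V-sound c (π2 (π1 s)) | acts-facts act
      ... | inj₁ z | ne , _ = ⊥-elim (ne (trans (cand-req s _ q (sym (acts-req act))) z))
      ... | inj₂ z | ne , _ = _ , trans (sym (trans (cand-req s _ q (sym (acts-req act))) z)) (sym (suc-pred (cand s) ⦃ ≢-nonZero ne ⦄))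

    -- Choose an enumerated v whose final root exceeds both the guard and `lim m`. At a late stage
    -- it may be collapsed into the class of m, so the requirement acts then unless it has acted
    -- before; in either case some enumerated point, possibly not v, has been merged with m.
    link : ∀ {f} → Computable f → ∀ m → (∀ N → Σ ℕ λ v → Enumerated f v × N ≤ lim v × Linkable m v) →
           Σ ℕ λ v → Enumerated f v × Σ ℕ λ s → root s v ≡ root s m
    link {f} c m h = proceed (h (guard p + suc (lim m)))
      where
      e = ⌜ proj₁ c ⌝
      p = pair e (pair 0 m)
      linked : ∀ {s} → Acts s p → Σ ℕ λ v → Enumerated f v × Σ ℕ λ s → root s v ≡ root s m
      linked {s} act = value s , acts-enumerated c act , suc s ,
        trans (acts-move act (value s)) (trans (move-first (sym srcA≡)) (sym
          (trans (acts-move act m) (trans (cong (move _ _ _ _) (sym tgt≡))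
            (move-other (proj₁ (tgtA-fixed act)) (proj₁ (proj₂ (tgtA-fixed act))))))))
        where
        k≡ = kind-req s e 0 m (sym (acts-req act))
        srcA≡ : srcA′ s ≡ root s (value s)
        srcA≡ = ifz-zero k≡
        tgt≡ : tgtA′ s ≡ root s m
        tgt≡ = trans (ifz-zero k≡) (cong (root s) (param-req s e 0 m (sym (acts-req act))))
      proceed : (Σ ℕ λ v → Enumerated f v × guard p + suc (lim m) ≤ lim v × Linkable m v) → _
      proceed (v , (t , ft) , big , nz , below) with V-complete c t
      ... | t′ , vt = linked (subst (Acts _) (req-stage p t′ u) (proj₂ acts))
        where
        u = modulus v + modulus m
        s = stage p t′ u
        u≤s : u ≤ s
        u≤s = right≤pair _ u
        cand≡ : cand s ≡ suc v
        cand≡ = trans (cand-stage e _ t′ u) (trans vt ft)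
        k≡ : kind s ≡ 0
        k≡ = kind-req s e 0 m (req-stage p t′ u)
        rv : root s (value s) ≡ lim v
        rv = trans (cong (λ z → root s (pred z)) cand≡) (lim-root v (≤-trans (m≤m+n _ _) u≤s))
        rm : root s (param s) ≡ lim m
        rm = trans (cong (root s) (param-req s e 0 m (req-stage p t′ u))) (lim-root m (≤-trans (m≤n+m _ (modulus v)) u≤s))
        descends : Below (lim m) (lim v) → Descends (lim m) (lim v)
        descends (inj₁ z) = inj₁ z
        descends (inj₂ (a , b)) = inj₂ (a , b , ≤-trans (m≤n+m _ (guard p)) big)
        coll : Collapsible p (lim v) (lim m)
        coll = nz , ≤-trans (m≤m+n (guard p) _) big , descends below
        coll′ : ∀ {a b} → a ≡ lim v → b ≡ lim m → Collapsible (req s) a b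
        coll′ refl refl = subst (λ z → Collapsible z _ _) (sym (req-stage p t′ u)) coll
        acts : Σ ℕ λ k → Acts k (req s)
        acts = attempt s (λ z → 0≢1+n (trans (sym z) cand≡))
          (coll′ (trans (ifz-zero k≡) rv) (trans (ifz-zero k≡) rm)) (coll′ (trans (ifz-zero k≡) rv) (trans (ifz-zero k≡) rm)) (inj₁ k≡)

    -- The bound is the guard of a requirement that depends on f alone, so it is known before any v
    -- is considered. The separated pair w may differ from v; an application must therefore use a
    -- property shared by all enumerated pairs.
    separate : ∀ {f} → Computable f → Σ ℕ λ N → ∀ v → Enumerated f v →
               ch (lim (π1 v)) ≢ 0 → N ≤ lim (π1 v) → ch (lim (π2 v)) ≢ 0 → N ≤ lim (π2 v) → lim (π1 v) ≢ lim (π2 v) →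
               Σ ℕ λ w → Enumerated f w × Σ ℕ λ s → root s (π1 w) ≡ ext 1 × root s (π2 w) ≡ ext 0
    separate {f} c = guard p , λ v en → proceed v en
      where
      e = ⌜ proj₁ c ⌝
      p = pair e (pair 1 0)
      ifz-one : ∀ {k a b} → k ≡ 1 → ifz k a b ≡ b
      ifz-one refl = refl
      separated : ∀ {s} → Acts s p → Σ ℕ λ w → Enumerated f w × Σ ℕ λ s → root s (π1 w) ≡ ext 1 × root s (π2 w) ≡ ext 0
      separated {s} act = value s , acts-enumerated c act , suc s ,
        trans (acts-move act (π1 (value s))) (trans (move-first (sym (ifz-one k≡))) (ifz-one k≡)) ,
        trans (acts-move act (π2 (value s))) (trans (move-second ne (sym (ifz-one k≡))) (ifz-one k≡))
        where
        k≡ = kind-req s e 1 0 (sym (acts-req act))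
        distinct : srcA′ s ≢ srcC′ s
        distinct with proj₂ (proj₂ (proj₂ (acts-facts act)))
        ... | inj₁ z = ⊥-elim (0≢1+n (trans (sym z) k≡))
        ... | inj₂ z = z
        ne : root s (π2 (value s)) ≢ srcA′ s
        ne q = distinct (trans (sym q) (sym (ifz-one k≡)))
      proceed : ∀ v → Enumerated f v → _
      proceed v (t , ft) n₁ g₁ n₂ g₂ ne with V-complete c t
      ... | t′ , vt = separated (subst (Acts _) (req-stage p t′ u) (proj₂ acts))
        where
        u = modulus (π1 v) + modulus (π2 v)
        s = stage p t′ u
        u≤s : u ≤ s
        u≤s = right≤pair _ u
        cand≡ : cand s ≡ suc v
        cand≡ = trans (cand-stage e _ t′ u) (trans vt ft)
        k≡ : kind s ≡ 1
        k≡ = kind-req s e 1 0 (req-stage p t′ u)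
        r₁ : root s (π1 (value s)) ≡ lim (π1 v)
        r₁ = trans (cong (λ z → root s (π1 (pred z))) cand≡) (lim-root (π1 v) (≤-trans (m≤m+n _ _) u≤s))
        r₂ : root s (π2 (value s)) ≡ lim (π2 v)
        r₂ = trans (cong (λ z → root s (π2 (pred z))) cand≡) (lim-root (π2 v) (≤-trans (m≤n+m _ (modulus (π1 v))) u≤s))
        coll : ∀ {a b z} → a ≡ z → ch z ≢ 0 → guard p ≤ z → ch b ≡ 0 → Collapsible (req s) a b
        coll refl nz g b = subst (λ z → Collapsible z _ _) (sym (req-stage p t′ u)) (nz , g , inj₁ b)
        acts : Σ ℕ λ k → Acts k (req s)
        acts = attempt s (λ z → 0≢1+n (trans (sym z) cand≡))
          (coll (trans (ifz-one k≡) r₁) n₁ g₁ (trans (cong ch (ifz-one k≡)) (ch-ext 1)))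
          (coll (trans (ifz-one k≡) r₂) n₂ g₂ (trans (cong ch (ifz-one k≡)) (ch-ext 0)))
          (inj₂ λ q → ne (trans (sym r₁) (trans (sym (ifz-one k≡)) (trans q (trans (ifz-one k≡) r₂)))))

-- Computably enumerable sets and the distributive semilattice of degrees.

module Reductions where

  open PrimitiveRecursion

  fnE : ∀ {f n} → Computable f → Exp n → Exp n
  fnE {f} c x = call f (comp₁ c) (x ∷ [])

  Decider : Set
  Decider = Σ (ℕ → ℕ) Computable

  mutual
    eval-unique : ∀ {k} {d : PR k} {xs v w} → Eval d xs v → Eval d xs w → v ≡ w
    eval-unique ev-zer ev-zer = refl
    eval-unique ev-succ ev-succ = refl
    eval-unique ev-proj ev-proj = refl
    eval-unique (ev-comp a b) (ev-comp c d) with eval-unique* a c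
    ... | refl = eval-unique b d
    eval-unique (ev-prec0 a) (ev-prec0 b) = eval-unique a b
    eval-unique (ev-precS a b) (ev-precS c d) with eval-unique a c
    ... | refl = eval-unique b d
    eval-unique (ev-mu {y = y} a h) (ev-mu {y = z} b k) with <-cmp y z
    ... | tri≈ _ e _ = e
    ... | tri< lt _ _ with k y lt
    ... | _ , e with eval-unique a e
    ... | ()
    eval-unique (ev-mu {y = y} a h) (ev-mu {y = z} b k) | tri> _ _ gt with h z gt
    ... | _ , e with eval-unique e b
    ... | ()

    eval-unique* : ∀ {k m} {ds : Vec (PR k) m} {xs vs ws} → EvalVec ds xs vs → EvalVec ds xs ws → vs ≡ ws
    eval-unique* [] [] = refl
    eval-unique* (a ∷ as) (b ∷ bs) = cong₂ _∷_ (eval-unique a b) (eval-unique* as bs)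

  abstract
    bySearch : (g : Fn 2) → Comp 2 g → Σ CE λ e → ∀ n → W e n ⇔ Σ ℕ λ s → g s n ≡ 0
    bySearch g c = mu (proj₁ c) , λ n → mk⇔
      (λ { (s , ev-mu e _) → s , eval-unique (proj₂ c (s ∷ n ∷ [])) e })
      λ { (s , p) → _ , proj₂ (proj₂ (evalMu {g = g} c (n ∷ []) s p)) }

    both : (a b : CE) → Σ CE λ e → ∀ n → W e n ⇔ (W a n × W b n)
    both a b = comp (proj {2} zero) (a ∷ b ∷ []) , λ n → mk⇔
      (λ { (_ , ev-comp (x ∷ y ∷ []) _) → (_ , x) , (_ , y) })
      (λ { ((_ , x) , (_ , y)) → _ , ev-comp (x ∷ y ∷ []) ev-proj })

    -- prec serves as a lazy conditional here: at 0 the second branch is not run.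
    unless : (c h : Decider) (e : CE) → Σ CE λ d → ∀ n → W d n ⇔ (proj₁ c n ≡ 0 ⊎ W e (proj₁ h n))
    unless (c , cC) (h , hC) e = comp body (compile bit ∷ proj₁ hC ∷ []) , λ n → mk⇔ (fwd n) (bwd n)
      where
      bit : Exp 1
      bit = ifzE (fnE cC v0) (lit 0) (lit 1)
      body : PR 2
      body = prec zer (comp e (proj (suc (suc zero)) ∷ []))
      evBit : ∀ n → Eval (compile bit) (n ∷ []) (ifz (c n) 0 1)
      evBit n = evalCompile bit (n ∷ [])
      fwd : ∀ n → W (comp body (compile bit ∷ proj₁ hC ∷ [])) n → c n ≡ 0 ⊎ W e (h n)
      fwd n (v , ev-comp (x ∷ y ∷ []) z) with c n | eval-unique (evBit n) x | eval-unique (proj₂ hC n) y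
      ... | zero  | _    | _    = inj₁ refl
      ... | suc _ | refl | refl with z
      ... | ev-precS _ (ev-comp (ev-proj ∷ []) w) = inj₂ (_ , w)
      bwd : ∀ n → c n ≡ 0 ⊎ W e (h n) → W (comp body (compile bit ∷ proj₁ hC ∷ [])) n
      bwd n q with c n | evBit n
      ... | zero | x = _ , ev-comp (x ∷ proj₂ hC n ∷ []) (ev-prec0 ev-zer)
      bwd n (inj₂ (_ , w)) | suc _ | x =
        _ , ev-comp (x ∷ proj₂ hC n ∷ []) (ev-precS (ev-prec0 ev-zer) (ev-comp (ev-proj ∷ []) w))

    -- The search stops at its own least success rather than at the given s, so the converse has to
    -- ask for membership at every success.
    atFound : (g h : Fn 2) → Comp 2 g → Comp 2 h → (e : CE) → Σ CE λ d → ∀ n →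
      (W d n → Σ ℕ λ s → g s n ≡ 0 × W e (h s n)) ×
      (∀ s → g s n ≡ 0 → (∀ t → g t n ≡ 0 → W e (h t n)) → W d n)
    atFound g h gC hC e = d , λ n → fwd n , bwd n
      where
      d : CE
      d = comp e (comp (proj₁ hC) (mu (proj₁ gC) ∷ proj zero ∷ []) ∷ [])
      fwd : ∀ n → W d n → Σ ℕ λ s → g s n ≡ 0 × W e (h s n)
      fwd n (v , ev-comp (ev-comp (ev-mu {y = s} x _ ∷ ev-proj ∷ []) y ∷ []) z)
        with eval-unique (proj₂ hC (s ∷ n ∷ [])) y
      ... | refl = s , eval-unique (proj₂ gC (s ∷ n ∷ [])) x , _ , z
      bwd : ∀ n s → g s n ≡ 0 → (∀ t → g t n ≡ 0 → W e (h t n)) → W d n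
      bwd n s p q with evalMu {g = g} gC (n ∷ []) s p
      ... | t , r , x with q t r
      ... | v , y = v , ev-comp (ev-comp (x ∷ ev-proj ∷ []) (proj₂ hC (t ∷ n ∷ [])) ∷ []) y

  withTF : (e : CE) → Σ CE λ d → ∀ k → W d k ⇔ InTF (W e) k
  withTF e = proj₁ d , λ k → mk⇔ (fwd k) (bwd k)
    where
    nz : Σ CE λ d → ∀ n → W d n ⇔ Σ ℕ λ s → neg n ≡ 0
    nz = bySearch (λ s n → neg n) (computedBy (λ s n → neg n) (negE v1) λ { (_ ∷ _ ∷ []) → refl })
    c h : Decider
    -- `pred k` vanishes at both truth values; FALSE is then excluded by `nz`.
    c = pred , computable predC
    h = (λ k → k ∸ 2) , computable (computedBy (λ k → k ∸ 2) (v0 ∸E lit 2) λ { (_ ∷ []) → refl })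
    un = unless c h e
    d = both (proj₁ nz) (proj₁ un)
    fwd : ∀ k → W (proj₁ d) k → InTF (W e) k
    fwd k w with to (proj₂ d k) w
    fwd zero w | x , y with to (proj₂ nz 0) x
    ... | _ , ()
    fwd (suc zero) w | x , y = tt
    fwd (suc (suc k)) w | x , y with to (proj₂ un (suc (suc k))) y
    ... | inj₂ z = z
    bwd : ∀ k → InTF (W e) k → W (proj₁ d) k
    bwd (suc zero) _ = from (proj₂ d 1) (from (proj₂ nz 1) (0 , refl) , from (proj₂ un 1) (inj₁ refl))
    bwd (suc (suc k)) p = from (proj₂ d _) (from (proj₂ nz _) (0 , refl) , from (proj₂ un _) (inj₂ p))


  reduction : ∀ {a b} (e : Exp 1) → (∀ n → W a n ⇔ InTF (W b) (⟦ e ⟧ (n ∷ []))) → a ≤m b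
  reduction e h = _ , (compile e , λ n → evalCompile e (n ∷ [])) , h

  ≤m-refl : ∀ a → a ≤m a
  ≤m-refl a = reduction (sucE (sucE v0)) (λ n → mk⇔ (λ x → x) (λ x → x))

  bindTF : ∀ {P Q : ℕ → Set} {h : ℕ → ℕ} → (∀ n → P n ⇔ InTF Q (h n)) → ∀ k →
           InTF P k ⇔ InTF Q (ifz k 0 (ifz (pred k) 1 (h (k ∸ 2))))
  bindTF e zero = mk⇔ (λ ()) (λ ())
  bindTF e (suc zero) = mk⇔ (λ x → x) (λ x → x)
  bindTF e (suc (suc k)) = e k

  ⇔-trans : ∀ {A B C : Set} → A ⇔ B → B ⇔ C → A ⇔ C
  ⇔-trans f g = mk⇔ (λ x → to g (to f x)) (λ z → from f (from g z))

  ⇔-sym : ∀ {A B : Set} → A ⇔ B → B ⇔ A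
  ⇔-sym f = mk⇔ (from f) (to f)

  bindE : ∀ {h n} → Computable h → Exp n → Exp n
  bindE hC x = ifzE x (lit 0) (ifzE (predE x) (lit 1) (fnE hC (x ∸E lit 2)))

  ≤m-trans : ∀ {a b c} → a ≤m b → b ≤m c → a ≤m c
  ≤m-trans (f , fC , p) (g , gC , q) = reduction (bindE gC (fnE fC v0)) (λ n → ⇔-trans (p n) (bindTF {h = g} q (f n)))

  private
    emptyCE : Σ CE λ e → ∀ n → W e n ⇔ Σ ℕ λ s → 1 ≡ 0
    emptyCE = bySearch (λ _ _ → 1) (computedBy (λ _ _ → 1) (lit 1) λ { (_ ∷ _ ∷ []) → refl })

  𝟎 : CE
  𝟎 = proj₁ emptyCE

  W-𝟎 : ∀ n → ¬ W 𝟎 n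
  W-𝟎 n w with to (proj₂ emptyCE n) w
  ... | _ , ()

  𝟎-min : ∀ a → 𝟎 ≤m a
  𝟎-min a = reduction (lit 0) (λ n → mk⇔ (W-𝟎 n) (λ ()))

  restrict : (a : CE) (u : Decider) → Σ CE λ e → ∀ n → W e n ⇔ (W a n × proj₁ u n ≡ 0)
  restrict a (u , uC) = proj₁ d , λ n → ⇔-trans (proj₂ d n)
      (mk⇔ (λ { (x , y) → x , proj₂ (to (proj₂ s n) y) }) λ { (x , y) → x , from (proj₂ s n) (0 , y) })
    where
    s = bySearch (λ _ n → u n) (computedBy (λ _ n → u n) (fnE uC v1) λ { (_ ∷ _ ∷ []) → refl })
    d = both a (proj₁ s)

  joinCE : (a b : CE) → Σ CE λ e → ∀ n → W e n ⇔ ((π1 n ≡ 0 → W a (π2 n)) × (π1 n ≢ 0 → W b (π2 n)))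
  joinCE a b = proj₁ d , λ n → ⇔-trans (proj₂ d n) (mk⇔ (fwd n) (bwd n))
    where
    p2 : Decider
    p2 = π2 , computable π2C
    l = unless ((λ n → neg (π1 n)) , computable (computedBy (λ n → neg (π1 n)) (negE (π1E v0)) λ { (_ ∷ []) → refl })) p2 a
    r = unless (π1 , computable π1C) p2 b
    d = both (proj₁ l) (proj₁ r)
    fwd : ∀ n → W (proj₁ l) n × W (proj₁ r) n → (π1 n ≡ 0 → W a (π2 n)) × (π1 n ≢ 0 → W b (π2 n))
    fwd n (x , y) = left , right
      where
      left : π1 n ≡ 0 → W a (π2 n)
      left z with to (proj₂ l n) x
      ... | inj₁ q = ⊥-elim (neg⇒≢0 q z)
      ... | inj₂ q = q
      right : π1 n ≢ 0 → W b (π2 n)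
      right z with to (proj₂ r n) y
      ... | inj₁ q = ⊥-elim (z q)
      ... | inj₂ q = q
    bwd : ∀ n → (π1 n ≡ 0 → W a (π2 n)) × (π1 n ≢ 0 → W b (π2 n)) → W (proj₁ l) n × W (proj₁ r) n
    bwd n (x , y) with π1 n ≟ 0
    ... | yes z = from (proj₂ l n) (inj₂ (x z)) , from (proj₂ r n) (inj₁ z)
    ... | no z = from (proj₂ l n) (inj₁ (≢0⇒neg z)) , from (proj₂ r n) (inj₂ (y z))

  infixl 6 _∨m_
  _∨m_ : CE → CE → CE
  a ∨m b = proj₁ (joinCE a b)

  W-left : ∀ a b n → π1 n ≡ 0 → W (a ∨m b) n ⇔ W a (π2 n)
  W-left a b n z = mk⇔ (λ w → proj₁ (to (proj₂ (joinCE a b) n) w) z)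
    (λ w → from (proj₂ (joinCE a b) n) ((λ _ → w) , λ nz → ⊥-elim (nz z)))

  W-right : ∀ a b n → π1 n ≢ 0 → W (a ∨m b) n ⇔ W b (π2 n)
  W-right a b n z = mk⇔ (λ w → proj₂ (to (proj₂ (joinCE a b) n) w) z)
    (λ w → from (proj₂ (joinCE a b) n) ((λ nz → ⊥-elim (z nz)) , λ _ → w))

  ≡→⇔ : ∀ {P : ℕ → Set} {j k} → j ≡ k → P j ⇔ P k
  ≡→⇔ refl = mk⇔ (λ x → x) (λ x → x)

  ∨m-left : ∀ a b → a ≤m (a ∨m b)
  ∨m-left a b = reduction (sucE (sucE (pairE (lit 0) v0)))
    (λ n → ⇔-sym (⇔-trans (W-left a b _ (π1-pair 0 n)) (≡→⇔ {W a} (π2-pair 0 n))))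

  ∨m-right : ∀ a b → b ≤m (a ∨m b)
  ∨m-right a b = reduction (sucE (sucE (pairE (lit 1) v0)))
    (λ n → ⇔-sym (⇔-trans (W-right a b _ (λ z → 0≢1+n (trans (sym z) (π1-pair 1 n)))) (≡→⇔ {W b} (π2-pair 1 n))))

  ∨m-least : ∀ {a b c} → a ≤m c → b ≤m c → (a ∨m b) ≤m c
  ∨m-least {a} {b} {c} (f , fC , p) (g , gC , q) = reduction (ifzE (π1E v0) (fnE fC (π2E v0)) (fnE gC (π2E v0))) pf
    where
    pf : ∀ n → W (a ∨m b) n ⇔ InTF (W c) (ifz (π1 n) (f (π2 n)) (g (π2 n)))
    pf n with π1 n in eq
    ... | zero = ⇔-trans (W-left a b n eq) (p _)
    ... | suc _ = ⇔-trans (W-right a b n (λ z → 0≢1+n (trans (sym z) eq))) (q _)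

  -- The truth values 0 and 1 of a reduction count as left.
  side : ℕ → ℕ
  side k = ifz (pred k) 0 (π1 (k ∸ 2))

  unside : ℕ → ℕ
  unside k = ifz k 0 (ifz (pred k) 1 (suc (suc (π2 (k ∸ 2)))))

  sideE unsideE : ∀ {n} → Exp n → Exp n
  sideE k   = ifzE (predE k) (lit 0) (π1E (k ∸E lit 2))
  unsideE k = ifzE k (lit 0) (ifzE (predE k) (lit 1) (sucE (sucE (π2E (k ∸E lit 2)))))

  side-left : ∀ a b k → side k ≡ 0 → InTF (W (a ∨m b)) k ⇔ InTF (W a) (unside k)
  side-left a b zero h = mk⇔ (λ ()) (λ ())
  side-left a b (suc zero) h = mk⇔ (λ x → x) (λ x → x)
  side-left a b (suc (suc k)) h = W-left a b k h

  side-right : ∀ a b k → side k ≢ 0 → InTF (W (a ∨m b)) k ⇔ InTF (W b) (unside k)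
  side-right a b zero h = ⊥-elim (h refl)
  side-right a b (suc zero) h = ⊥-elim (h refl)
  side-right a b (suc (suc k)) h = W-right a b k h

  -- The given reduction decides for each argument which of a and b it consults. Restricting x to
  -- the arguments of either kind yields the two parts.
  ∨m-distrib : ∀ {x a b} → x ≤m (a ∨m b) → Σ CE λ a′ → Σ CE λ b′ → a′ ≤m a × b′ ≤m b × x ≡m (a′ ∨m b′)
  ∨m-distrib {x} {a} {b} (f , fC , p) = proj₁ l , proj₁ r ,
    reduction (ifzE (sideE (fnE fC v0)) (unsideE (fnE fC v0)) (lit 0)) leftPf ,
    reduction (ifzE (sideE (fnE fC v0)) (lit 0) (unsideE (fnE fC v0))) rightPf ,
    reduction (sucE (sucE (pairE (sideE (fnE fC v0)) v0))) splitPf ,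
    ∨m-least (reduction (ifzE (sideE (fnE fC v0)) (sucE (sucE v0)) (lit 0)) lx)
             (reduction (ifzE (sideE (fnE fC v0)) (lit 0) (sucE (sucE v0))) rx)
    where
    l = restrict x ((λ n → side (f n)) , computable (computedBy (λ n → side (f n)) (sideE (fnE fC v0)) λ { (_ ∷ []) → refl }))
    r = restrict x ((λ n → neg (side (f n))) , computable (computedBy (λ n → neg (side (f n))) (negE (sideE (fnE fC v0))) λ { (_ ∷ []) → refl }))
    leftPf : ∀ n → W (proj₁ l) n ⇔ InTF (W a) (ifz (side (f n)) (unside (f n)) 0)
    leftPf n with side (f n) in eq
    ... | zero = mk⇔ (λ w → to (side-left a b (f n) eq) (to (p n) (proj₁ (to (proj₂ l n) w))))
                     (λ w → from (proj₂ l n) (from (p n) (from (side-left a b (f n) eq) w) , eq))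
    ... | suc _ = mk⇔ (λ w → 0≢1+n (trans (sym (proj₂ (to (proj₂ l n) w))) eq)) (λ ())
    rightPf : ∀ n → W (proj₁ r) n ⇔ InTF (W b) (ifz (side (f n)) 0 (unside (f n)))
    rightPf n with side (f n) in eq
    ... | zero = mk⇔ (λ w → neg⇒≢0 (proj₂ (to (proj₂ r n) w)) eq) (λ ())
    ... | suc _ = mk⇔ (λ w → to (side-right a b (f n) nz) (to (p n) (proj₁ (to (proj₂ r n) w))))
                      (λ w → from (proj₂ r n) (from (p n) (from (side-right a b (f n) nz) w) , ≢0⇒neg nz))
      where nz : side (f n) ≢ 0
            nz z = 0≢1+n (trans (sym z) eq)
    splitPf : ∀ n → W x n ⇔ W (proj₁ l ∨m proj₁ r) (pair (side (f n)) n)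
    splitPf n with side (f n) ≟ 0
    ... | yes z = mk⇔ (λ w → from (W-left _ _ _ (trans (π1-pair _ n) z)) (from (proj₂ l _) (subst (W x) (sym (π2-pair _ n)) w , trans (cong (λ m → side (f m)) (π2-pair _ n)) z)))
                      (λ w → subst (W x) (π2-pair _ n) (proj₁ (to (proj₂ l _) (to (W-left _ _ _ (trans (π1-pair _ n) z)) w))))
    ... | no z = mk⇔ (λ w → from (W-right _ _ _ (λ e → z (trans (sym (π1-pair _ n)) e))) (from (proj₂ r _) (subst (W x) (sym (π2-pair _ n)) w , ≢0⇒neg (λ e → z (trans (cong (λ m → side (f m)) (sym (π2-pair _ n))) e)))))
                     (λ w → subst (W x) (π2-pair _ n) (proj₁ (to (proj₂ r _) (to (W-right _ _ _ (λ e → z (trans (sym (π1-pair _ n)) e))) w))))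
    lx : ∀ n → W (proj₁ l) n ⇔ InTF (W x) (ifz (side (f n)) (suc (suc n)) 0)
    lx n with side (f n) in eq
    ... | zero = mk⇔ (λ w → proj₁ (to (proj₂ l n) w)) (λ w → from (proj₂ l n) (w , eq))
    ... | suc _ = mk⇔ (λ w → 0≢1+n (trans (sym (proj₂ (to (proj₂ l n) w))) eq)) (λ ())
    rx : ∀ n → W (proj₁ r) n ⇔ InTF (W x) (ifz (side (f n)) 0 (suc (suc n)))
    rx n with side (f n) in eq
    ... | zero = mk⇔ (λ w → neg⇒≢0 (proj₂ (to (proj₂ r n) w)) eq) (λ ())
    ... | suc _ = mk⇔ (λ w → proj₁ (to (proj₂ r n) w)) (λ w → from (proj₂ r n) (w , ≢0⇒neg (λ z → 0≢1+n (trans (sym z) eq))))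

-- Saturations along a chain, and the degrees below them.

module Segments where

  open PrimitiveRecursion
  open Collapsing
  open Roots
  open Reductions

  rootE : ∀ {n} → Exp n → Exp n → Exp n
  rootE s y = call root rootC (s ∷ y ∷ [])

  decider : (f : ℕ → ℕ) (e : Exp 1) → (∀ n → ⟦ e ⟧ (n ∷ []) ≡ f n) → Decider
  decider f e h = f , computable {f} (computedBy f e λ { (n ∷ []) → h n })

  -- External points belong to every chain. Since `ch` marks them by 0, chain i is the one with
  -- `ch n` equal to `suc i`.
  inChain : ℕ → Decider
  inChain i = decider (λ n → ch n * neq (ch n) (suc i)) (π1E v0 *E neqE (π1E v0) (lit (suc i))) λ _ → refl

  inChainTo : ℕ → ℕ → Decider
  inChainTo i J = decider (λ n → ch n * (neq (ch n) (suc i) + (suc (lv n) ∸ J)))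
    (π1E v0 *E (neqE (π1E v0) (lit (suc i)) +E (sucE (π1E (π2E v0)) ∸E lit J))) λ _ → refl

  inChain⇒ : ∀ i n → proj₁ (inChain i) n ≡ 0 → ch n ≡ 0 ⊎ ch n ≡ suc i
  inChain⇒ i n h with m*n≡0⇒m≡0∨n≡0 (ch n) h
  ... | inj₁ z = inj₁ z
  ... | inj₂ z = inj₂ (neq⇒≡ z)

  ⇒inChain : ∀ i n → ch n ≡ 0 ⊎ ch n ≡ suc i → proj₁ (inChain i) n ≡ 0
  ⇒inChain i n (inj₁ z) = cong (_* neq (ch n) (suc i)) z
  ⇒inChain i n (inj₂ z) = trans (cong (ch n *_) (≡⇒neq z)) (*-zeroʳ (ch n))

  inChainTo⇒ : ∀ i J n → proj₁ (inChainTo i J) n ≡ 0 → ch n ≡ 0 ⊎ (ch n ≡ suc i × lv n < J)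
  inChainTo⇒ i J n h with m*n≡0⇒m≡0∨n≡0 (ch n) h
  ... | inj₁ z = inj₁ z
  ... | inj₂ z = inj₂ (neq⇒≡ (m+n≡0⇒m≡0 (neq (ch n) (suc i)) z) , m∸n≡0⇒m≤n (m+n≡0⇒n≡0 (neq (ch n) (suc i)) z))

  ⇒inChainTo : ∀ i J n → ch n ≡ 0 ⊎ (ch n ≡ suc i × lv n < J) → proj₁ (inChainTo i J) n ≡ 0
  ⇒inChainTo i J n (inj₁ z) = cong (_* (neq (ch n) (suc i) + (suc (lv n) ∸ J))) z
  ⇒inChainTo i J n (inj₂ (z , l)) =
    trans (cong (ch n *_) (cong₂ _+_ (≡⇒neq z) (m≤n⇒m∸n≡0 l))) (*-zeroʳ (ch n))

  inChainTo⊆ : ∀ i J n → proj₁ (inChainTo i J) n ≡ 0 → proj₁ (inChain i) n ≡ 0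
  inChainTo⊆ i J n h with inChainTo⇒ i J n h
  ... | inj₁ z = ⇒inChain i n (inj₁ z)
  ... | inj₂ (z , _) = ⇒inChain i n (inj₂ z)

  Mem : CE → ℕ → Set
  Mem E v = ch v ≡ 0 × InTF (W E) (π2 v)

  module Chains (em : ExcludedMiddle 0ℓ) where
    open Limit em

    private
      -- An external root is final, so a point is known to be absorbed as soon as its root is
      -- external at some stage, and E has then to be asked about one point only.
      absorbed : (E : CE) → Σ CE λ d → ∀ n → W d n ⇔ Mem E (lim n)
      absorbed E = proj₁ d , λ n → mk⇔ (fwd n) (bwd n)
        where
        d = atFound (λ s n → ch (root s n)) (λ s n → π2 (root s n))
          (computedBy (λ s n → ch (root s n)) (π1E (rootE v0 v1)) λ { (_ ∷ _ ∷ []) → refl })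
          (computedBy (λ s n → π2 (root s n)) (π2E (rootE v0 v1)) λ { (_ ∷ _ ∷ []) → refl }) (proj₁ (withTF E))
        fwd : ∀ n → W (proj₁ d) n → Mem E (lim n)
        fwd n w with proj₁ (proj₂ d n) w
        ... | s , z , x = subst (Mem E) (sym (lim-ext s n z)) (z , to (proj₂ (withTF E) _) x)
        bwd : ∀ n → Mem E (lim n) → W (proj₁ d) n
        bwd n (z , x) = proj₂ (proj₂ d n) (modulus n) z
          (λ t h → from (proj₂ (withTF E) _) (subst (λ v → InTF (W E) (π2 v)) (lim-ext t n h) x))

    abstract
      part : (E : CE) (u : Decider) → Σ CE λ e → ∀ n → W e n ⇔ (Mem E (lim n) × proj₁ u n ≡ 0)
      part E u = proj₁ (restrict (proj₁ (absorbed E)) u) , λ n → ⇔-trans (proj₂ (restrict (proj₁ (absorbed E)) u) n)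
        (mk⇔ (λ { (x , y) → to (proj₂ (absorbed E) n) x , y }) λ { (x , y) → from (proj₂ (absorbed E) n) x , y })

    S : CE → Decider → CE
    S E u = proj₁ (part E u)

    whole : CE → ℕ → CE
    whole E i = S E (inChain i)

    segment : CE → ℕ → ℕ → CE
    segment E i J = S E (inChainTo i J)

    mem-S : ∀ {E} u n → proj₁ u n ≡ 0 → W (S E u) n ⇔ Mem E (lim n)
    mem-S {E} u n h = mk⇔ (λ w → proj₁ (to (proj₂ (part E u) n) w)) (λ x → from (proj₂ (part E u) n) (x , h))

    mem-ext : ∀ {E} k → Mem E (lim (ext k)) ⇔ InTF (W E) k
    mem-ext {E} k = mk⇔ (λ { (_ , x) → subst (InTF (W E)) e x }) (λ x → trans (cong ch l) (ch-ext k) , subst (InTF (W E)) (sym e) x)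
      where
      l = lim-external (ext k) (ch-ext k)
      e : π2 (lim (ext k)) ≡ k
      e = trans (cong π2 l) (π2-pair 0 k)

    S-mono : ∀ {E} u u′ → (∀ n → proj₁ u n ≡ 0 → proj₁ u′ n ≡ 0) → S E u ≤m S E u′
    S-mono {E} u u′ sub = reduction (ifzE (fnE (proj₂ u) v0) (sucE (sucE v0)) (lit 0)) pf
      where
      pf : ∀ n → W (S E u) n ⇔ InTF (W (S E u′)) (ifz (proj₁ u n) (suc (suc n)) 0)
      pf n with proj₁ u n in eq
      ... | zero = ⇔-trans (mem-S u n eq) (⇔-sym (mem-S u′ n (sub n eq)))
      ... | suc _ = mk⇔ (λ w → 0≢1+n (trans (sym (proj₂ (to (proj₂ (part E u) n) w))) eq)) (λ ())

    base≤S : ∀ E u → (∀ k → proj₁ u (ext k) ≡ 0) → E ≤m S E u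
    -- The number n is represented by the external point `ext (n + 2)`, as `ext 0` and `ext 1` stand
    -- for the truth values.
    base≤S E u h = reduction (sucE (sucE (pairE (lit 0) (sucE (sucE v0)))))
      (λ n → ⇔-sym (⇔-trans (mem-S u _ (h _)) (mem-ext (suc (suc n)))))

    inChain-ext : ∀ i k → proj₁ (inChain i) (ext k) ≡ 0
    inChain-ext i k = ⇒inChain i _ (inj₁ (ch-ext k))

    inChainTo-ext : ∀ i J k → proj₁ (inChainTo i J) (ext k) ≡ 0
    inChainTo-ext i J k = ⇒inChainTo i J _ (inj₁ (ch-ext k))

    segment-zero : ∀ E i → segment E i 0 ≤m E
    segment-zero E i = reduction (ifzE (π1E v0) (π2E v0) (lit 0)) pf
      where
      pf : ∀ n → W (segment E i 0) n ⇔ InTF (W E) (ifz (π1 n) (π2 n) 0)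
      pf n with π1 n in eq
      ... | zero = ⇔-trans (mem-S (inChainTo i 0) n (⇒inChainTo i 0 n (inj₁ eq))) (mk⇔
          (λ { (_ , x) → subst (λ v → InTF (W E) (π2 v)) (lim-external n eq) x })
          (λ x → trans (cong ch (lim-external n eq)) eq , subst (λ v → InTF (W E) (π2 v)) (sym (lim-external n eq)) x))
      ... | suc _ = mk⇔ out (λ ())
        where
        out : W (segment E i 0) n → ⊥
        out w with inChainTo⇒ i 0 n (proj₂ (to (proj₂ (part E (inChainTo i 0)) n) w))
        ... | inj₁ z = 0≢1+n (trans (sym z) eq)
        ... | inj₂ (_ , ())

    -- To answer a question about m, wait until m is seen to be equivalent to some point enumerated
    -- by F, say at t, and pass on `h t`. Equivalent points have the same limit, hence the same
    -- membership.
    fromLinks : ∀ {E q} {F h : ℕ → ℕ} (u : Decider) → Computable F → Computable h →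
                (∀ m → proj₁ u m ≡ 0 → Σ ℕ λ v → Enumerated F v × Σ ℕ λ s → root s v ≡ root s m) →
                (∀ t v → F t ≡ suc v → Mem E (lim v) ⇔ InTF (W q) (h t)) → S E u ≤m q
    fromLinks {E} {q} {F} {h} u FC hC linked eqv = reduction (ifzE (fnE (proj₂ u) v0) (fnE hC (π1E (fnE (proj₁ (proj₂ μ)) v0))) (lit 0)) pf
      where
      g : Fn 2
      g z m = ifz (proj₁ u m) (neg (F (π1 z)) + neq (root (π2 z) (pred (F (π1 z)))) (root (π2 z) m)) 0
      gC : Comp 2 g
      gC = computedBy g (ifzE (fnE (proj₂ u) v1) (negE (fnE FC (π1E v0)) +E
             neqE (rootE (π2E v0) (predE (fnE FC (π1E v0)))) (rootE (π2E v0) v1)) (lit 0)) λ { (_ ∷ _ ∷ []) → refl }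
      ex : ∀ m → Σ ℕ λ z → g z m ≡ 0
      ex m with proj₁ u m ≟ 0
      ... | no nz = 0 , ifz-nonzero nz
      ... | yes z with linked m z
      ... | v , (t , Ft) , s , r = pair t s , trans (ifz-zero z) e
        where
        e : neg (F (π1 (pair t s))) + neq (root (π2 (pair t s)) (pred (F (π1 (pair t s))))) (root (π2 (pair t s)) m) ≡ 0
        e rewrite π1-pair t s | π2-pair t s | Ft = cong₂ _+_ {x = neg (suc v)} {y = 0} (0∸n≡0 v) (≡⇒neq r)
      μ = search g gC ex
      pf : ∀ m → W (S E u) m ⇔ InTF (W q) (ifz (proj₁ u m) (h (π1 (proj₁ μ m))) 0)
      pf m with proj₁ u m in eq | proj₂ (proj₂ μ) m
      ... | suc _ | _ = mk⇔ (λ w → 0≢1+n (trans (sym (proj₂ (to (proj₂ (part E u) m) w))) eq)) (λ ())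
      ... | zero | e = ⇔-trans (mem-S u m eq) (⇔-trans (≡→⇔ {Mem E} (sym (lim-merge s _ m same))) (eqv t _ Ft))
        where
        t = π1 (proj₁ μ m)
        s = π2 (proj₁ μ m)
        e′ : neg (F t) + neq (root s (pred (F t))) (root s m) ≡ 0
        e′ = e
        Ft : F t ≡ suc (pred (F t))
        Ft = sym (suc-pred (F t) ⦃ ≢-nonZero (neg⇒≢0 (m+n≡0⇒m≡0 (neg (F t)) e′)) ⦄)
        same : root s (pred (F t)) ≡ root s m
        same = neq⇒≡ (m+n≡0⇒n≡0 (neg (F t)) e′)

    abstract
      -- Finitely many values can be built into a program, although nothing tells effectively which
      -- ones; excluded middle chooses them.
      table : (P : ℕ → Set) (N : ℕ) → Σ Decider λ τ → ∀ v → proj₁ τ v ≡ 0 ⇔ (v < N × P v)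
      table P zero = decider (λ _ → 1) (lit 1) (λ _ → refl) , λ v → mk⇔ (λ ()) (λ { (() , _) })
      table P (suc N) with table P N | em {P N}
      ... | (τ , τC) , h | yes p = decider (λ v → ifz (neq v N) 0 (τ v)) (ifzE (neqE v0 (lit N)) (lit 0) (fnE τC v0)) (λ _ → refl) , pf
        where
        pf : ∀ v → ifz (neq v N) 0 (τ v) ≡ 0 ⇔ (v < suc N × P v)
        pf v with v ≟ N
        ... | yes refl rewrite ifz-zero {neq v v} {0} {τ v} (≡⇒neq {v} refl) = mk⇔ (λ _ → ≤-refl , p) (λ _ → refl)
        ... | no ne rewrite ifz-nonzero {neq v N} {0} {τ v} (λ z → ne (neq⇒≡ z)) =
          mk⇔ (λ z → m≤n⇒m≤1+n (proj₁ (to (h v) z)) , proj₂ (to (h v) z)) (λ { (lt , q) → from (h v) (≤∧≢⇒< (≤-pred lt) ne , q) })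
      ... | (τ , τC) , h | no p = (τ , τC) , λ v → mk⇔ (λ z → m≤n⇒m≤1+n (proj₁ (to (h v) z)) , proj₂ (to (h v) z))
          (λ { (lt , q) → from (h v) (≤∧≢⇒< (≤-pred lt) (λ { refl → p q }) , q) })

    -- A reduction to S E u, with its values turned into points of u and its truth values into external points.
    record Pointed (E c : CE) (u : Decider) : Set where
      field
        ν   : ℕ → ℕ
        νC  : Computable ν
        νu  : ∀ n → proj₁ u (ν n) ≡ 0
        mem : ∀ n → W c n ⇔ Mem E (lim (ν n))

    pointed : ∀ {E c} u → (∀ k → proj₁ u (ext k) ≡ 0) → c ≤m S E u → Pointed E c u
    pointed {E} {c} (u , uC) ue (f , fC , p) = record
      { ν = λ n → point (f n)
      ; νC = computable (computedBy (λ n → point (f n)) (ifzE (fnE fC v0) (pairE (lit 0) (lit 0)) (ifzE (predE (fnE fC v0)) (pairE (lit 0) (lit 1))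
               (ifzE (fnE uC (fnE fC v0 ∸E lit 2)) (fnE fC v0 ∸E lit 2) (pairE (lit 0) (lit 0))))) λ { (_ ∷ []) → refl })
      ; νu = λ n → inside (f n)
      ; mem = λ n → ⇔-trans (p n) (member (f n)) }
      where
      point : ℕ → ℕ
      point k = ifz k (ext 0) (ifz (pred k) (ext 1) (ifz (u (k ∸ 2)) (k ∸ 2) (ext 0)))
      inside : ∀ k → u (point k) ≡ 0
      inside zero = ue 0
      inside (suc zero) = ue 1
      inside (suc (suc k)) with u k in eq
      ... | zero = eq
      ... | suc _ = ue 0
      member : ∀ k → InTF (W (S E (u , uC))) k ⇔ Mem E (lim (point k))
      member zero = ⇔-sym (mem-ext 0)
      member (suc zero) = ⇔-sym (mem-ext 1)
      member (suc (suc k)) with u k in eq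
      ... | zero = mem-S (u , uC) k eq
      ... | suc _ = mk⇔ (λ w → ⊥-elim (0≢1+n (trans (sym (proj₂ (to (proj₂ (part E (u , uC)) k) w))) eq)))
                        (λ x → ⊥-elim (to (mem-ext 0) x))

    module Dichotomy {E c : CE} (i : ℕ) (P : Pointed E c (inChain i)) where
      open Pointed P

      chain-lim : ∀ n → ch (lim (ν n)) ≡ 0 ⊎ ch (lim (ν n)) ≡ suc i
      chain-lim n with lim-below (ν n) | inChain⇒ i (ν n) (νu n)
      ... | inj₁ z | _ = inj₁ z
      ... | inj₂ (e , _) | inj₁ z = inj₁ (trans e z)
      ... | inj₂ (e , _) | inj₂ z = inj₂ (trans e z)

      Unbounded : ℕ → Set
      Unbounded J = ∀ N → Σ ℕ λ n → N ≤ lim (ν n) × ch (lim (ν n)) ≢ 0 × J ≤ lv (lim (ν n))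

      F : ℕ → ℕ
      F n = suc (ν n)

      FC : Computable F
      FC = computable (computedBy F (sucE (fnE νC v0)) λ { (_ ∷ []) → refl })

      links : ∀ m → proj₁ (inChain i) m ≡ 0 → ∀ {J} → Unbounded J → ch m ≡ 0 ⊎ lv m ≤ J → Σ ℕ λ v → Enumerated F v × Σ ℕ λ s → root s v ≡ root s m
      links m um {J} unb lm = link FC m λ N → ν (proj₁ (unb N)) , (proj₁ (unb N) , refl) , proj₁ (proj₂ (unb N)) ,
        proj₁ (proj₂ (proj₂ (unb N))) , below (proj₁ (unb N)) (proj₁ (proj₂ (proj₂ (unb N)))) (proj₂ (proj₂ (proj₂ (unb N)))) lm
        where
        below : ∀ n → ch (lim (ν n)) ≢ 0 → J ≤ lv (lim (ν n)) → ch m ≡ 0 ⊎ lv m ≤ J → Below (lim m) (lim (ν n))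
        below n nz le lm′ with lim-below m | inChain⇒ i m um | chain-lim n | lm′
        ... | inj₁ z | _ | _ | _ = inj₁ z
        ... | _ | _ | inj₁ z | _ = ⊥-elim (nz z)
        ... | inj₂ (e , _) | inj₁ z | _ | _ = inj₁ (trans e z)
        ... | inj₂ (e , _) | _ | _ | inj₁ z = inj₁ (trans e z)
        ... | inj₂ (e , l) | inj₂ z | inj₂ z′ | inj₂ l′ = inj₂ (trans e (trans z (sym z′)) , ≤-trans l (≤-trans l′ le))

      from-links : ∀ u → (∀ m → proj₁ u m ≡ 0 → proj₁ (inChain i) m ≡ 0 × Σ ℕ λ J → Unbounded J × (ch m ≡ 0 ⊎ lv m ≤ J)) → S E u ≤m c
      -- The point enumerated at t is `ν t`, and its membership is the question whether t is in c.
      from-links u h = fromLinks {h = λ t → suc (suc t)} u FC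
        (computable (computedBy (λ t → suc (suc t)) (sucE (sucE v0)) λ { (_ ∷ []) → refl }))
        (λ m z → links m (proj₁ (h m z)) (proj₁ (proj₂ (proj₂ (h m z)))) (proj₂ (proj₂ (proj₂ (h m z)))))
        (λ t v e → subst (λ w → Mem E (lim w) ⇔ W c t) (suc-injective e) (⇔-sym (mem t)))

      -- Wait until the root of `ν n` is a point of the segment or one of the finitely many
      -- surviving roots below N that are not external. The latter stay outside for ever and are
      -- answered by FALSE; otherwise the root itself becomes the query.
      into-segment : ∀ J N → (∀ n → ch (lim (ν n)) ≡ 0 ⊎ (lv (lim (ν n)) < J ⊎ lim (ν n) < N)) → c ≤m segment E i J
      into-segment J N bound = reduction (ifzE (fnE τC (rootE (fnE μC v0) (fnE νC v0))) (lit 0) (sucE (sucE (rootE (fnE μC v0) (fnE νC v0))))) pf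
        where
        P′ : ℕ → Set
        P′ v = lim v ≡ v × ch v ≢ 0
        τ = proj₁ (proj₁ (table P′ N))
        τC = proj₂ (proj₁ (table P′ N))
        τ-spec = proj₂ (table P′ N)
        u = proj₁ (inChainTo i J)
        g : Fn 2
        g s n = u (root s (ν n)) * τ (root s (ν n))
        gC : Comp 2 g
        gC = computedBy g (fnE (proj₂ (inChainTo i J)) (rootE v0 (fnE νC v1)) *E fnE τC (rootE v0 (fnE νC v1))) λ { (_ ∷ _ ∷ []) → refl }
        ex : ∀ n → Σ ℕ λ s → g s n ≡ 0
        ex n = modulus (ν n) , found (bound n) (chain-lim n)
          where
          found : _ → _ → g (modulus (ν n)) n ≡ 0
          found (inj₁ z) _ = cong (_* τ (lim (ν n))) (⇒inChainTo i J _ (inj₁ z))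
          found (inj₂ _) (inj₁ z) = cong (_* τ (lim (ν n))) (⇒inChainTo i J _ (inj₁ z))
          found (inj₂ (inj₁ l)) (inj₂ z) = cong (_* τ (lim (ν n))) (⇒inChainTo i J _ (inj₂ (z , l)))
          found (inj₂ (inj₂ l)) (inj₂ z) = trans (cong (u (lim (ν n)) *_)
            (from (τ-spec _) (l , lim-idem (ν n) , λ e → 0≢1+n (trans (sym e) z)))) (*-zeroʳ (u (lim (ν n))))
        μ = search g gC ex
        μC = proj₁ (proj₂ μ)
        pf : ∀ n → W c n ⇔ InTF (W (segment E i J)) (ifz (τ (root (proj₁ μ n) (ν n))) 0 (suc (suc (root (proj₁ μ n) (ν n)))))
        pf n = ⇔-trans (mem n) (⇔-trans (≡→⇔ {Mem E} (sym (lim-of-root s (ν n)))) (output (proj₂ (proj₂ μ) n)))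
          where
          s = proj₁ μ n
          r = root s (ν n)
          output : u r * τ r ≡ 0 → Mem E (lim r) ⇔ InTF (W (segment E i J)) (ifz (τ r) 0 (suc (suc r)))
          output e with τ r in eq
          ... | zero = mk⇔ (λ x → proj₂ (proj₂ (to (τ-spec r) eq)) (subst (λ z → ch z ≡ 0) (proj₁ (proj₂ (to (τ-spec r) eq))) (proj₁ x))) (λ ())
          ... | suc k with m*n≡0⇒m≡0∨n≡0 (u r) e
          ... | inj₁ z = ⇔-sym (mem-S (inChainTo i J) r z)

      bounded : ∀ J → ¬ Unbounded J → Σ ℕ λ N → ∀ n → ch (lim (ν n)) ≡ 0 ⊎ (lv (lim (ν n)) < J ⊎ lim (ν n) < N)
      bounded J h with em {Σ ℕ λ N → ∀ n → ch (lim (ν n)) ≡ 0 ⊎ (lv (lim (ν n)) < J ⊎ lim (ν n) < N)}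
      ... | yes p = p
      ... | no np = ⊥-elim (h λ N → witness N)
        where
        witness : ∀ N → Σ ℕ λ n → N ≤ lim (ν n) × ch (lim (ν n)) ≢ 0 × J ≤ lv (lim (ν n))
        witness N with em {Σ ℕ λ n → N ≤ lim (ν n) × ch (lim (ν n)) ≢ 0 × J ≤ lv (lim (ν n))}
        ... | yes p = p
        ... | no nw = ⊥-elim (np (N , λ n → cases n))
          where
          cases : ∀ n → ch (lim (ν n)) ≡ 0 ⊎ (lv (lim (ν n)) < J ⊎ lim (ν n) < N)
          cases n with ch (lim (ν n)) ≟ 0 | J ≤? lv (lim (ν n)) | N ≤? lim (ν n)
          ... | yes z | _ | _ = inj₁ z
          ... | no _ | no l | _ = inj₂ (inj₁ (≰⇒> l))
          ... | no _ | yes _ | no l = inj₂ (inj₂ (≰⇒> l))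
          ... | no a | yes b | yes d = ⊥-elim (nw (n , d , a , b))

      unbounded-mono : ∀ {J J′} → J′ ≤ J → Unbounded J → Unbounded J′
      unbounded-mono le h N with h N
      ... | n , a , b , d = n , a , b , ≤-trans le d

      first-bounded : ∀ J → ¬ Unbounded J → Σ ℕ λ K → ¬ Unbounded K × (K ≡ 0 ⊎ Σ ℕ λ L → K ≡ suc L × Unbounded L)
      first-bounded zero h = 0 , h , inj₁ refl
      first-bounded (suc J) h with em {Unbounded J}
      ... | yes p = suc J , h , inj₂ (J , refl , p)
      ... | no np = first-bounded J np

      -- At the least bounded K the two estimates meet: boundedness puts c below the segment up to
      -- K, and unboundedness one level earlier links all points of that segment to values of `ν`.
      -- For `K ≡ 0` there is no earlier level, and only the upper estimate is obtained.
      dichotomy : whole E i ≤m c ⊎ Σ ℕ λ J → c ≤m segment E i J × (J ≡ 0 ⊎ segment E i J ≤m c)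
      dichotomy with em {Σ ℕ λ J → ¬ Unbounded J}
      ... | no h = inj₁ (from-links (inChain i) λ m z → z , lv m , unb (lv m) , inj₂ ≤-refl)
        where
        unb : ∀ J → Unbounded J
        unb J with em {Unbounded J}
        ... | yes p = p
        ... | no np = ⊥-elim (h (J , np))
      ... | yes (J , h) with first-bounded J h
      ... | K , nb , inj₁ z = inj₂ (K , into-segment K (proj₁ (bounded K nb)) (proj₂ (bounded K nb)) , inj₁ z)
      ... | .(suc L) , nb , inj₂ (L , refl , unb) =
        inj₂ (suc L , into-segment (suc L) (proj₁ (bounded (suc L) nb)) (proj₂ (bounded (suc L) nb)) , inj₂ (from-links (inChainTo i (suc L)) lower))
        where
        lower : ∀ m → proj₁ (inChainTo i (suc L)) m ≡ 0 → proj₁ (inChain i) m ≡ 0 × Σ ℕ λ J → Unbounded J × (ch m ≡ 0 ⊎ lv m ≤ J)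
        lower m z with inChainTo⇒ i (suc L) m z
        ... | inj₁ e       = inChainTo⊆ i (suc L) m z , L , unb , inj₁ e
        ... | inj₂ (_ , l) = inChainTo⊆ i (suc L) m z , L , unb , inj₂ (≤-pred l)

    below-whole : ∀ {E c} i → c ≤m whole E i → whole E i ≤m c ⊎ Σ ℕ λ J → c ≤m segment E i J × (J ≡ 0 ⊎ segment E i J ≤m c)
    below-whole i h = Dichotomy.dichotomy i (pointed (inChain i) (inChain-ext i) h)

-- Strictness and independence of segments; strong covers.

module Independence where

  open PrimitiveRecursion
  open Collapsing
  open Roots
  open Reductions
  open Segments

  module Strictness (em : ExcludedMiddle 0ℓ) where
    open Limit em
    open Chains em

    Infinitely : (ℕ → Set) → Set
    Infinitely R = ∀ K → Σ ℕ λ t → K ≤ t × R t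

    infinitely-split : ∀ {R P Q : ℕ → Set} N → Infinitely R → (∀ t → N ≤ t → R t → P t ⊎ Q t) →
                       Infinitely (λ t → R t × P t) ⊎ Infinitely (λ t → R t × Q t)
    infinitely-split {R} {P} {Q} N inf h with em {Σ ℕ λ K → ∀ t → K ≤ t → R t → ¬ P t}
    ... | yes (K , none) = inj₂ second
      where
      second : Infinitely (λ t → R t × Q t)
      second K′ with inf (K + K′ + N)
      ... | t , le , r with h t (≤-trans (m≤n+m N (K + K′)) le) r
      ... | inj₁ p = ⊥-elim (none t (≤-trans (≤-trans (m≤m+n K K′) (m≤m+n (K + K′) N)) le) r p)
      ... | inj₂ q = t , ≤-trans (≤-trans (m≤n+m K′ K) (m≤m+n (K + K′) N)) le , r , q
    ... | no np = inj₁ first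
      where
      first : Infinitely (λ t → R t × P t)
      first K with em {Σ ℕ λ t → K ≤ t × R t × P t}
      ... | yes p = p
      ... | no nq = ⊥-elim (np (K , λ t le r p → nq (t , le , r , p)))

    Fixed : ℕ → ℕ → ℕ → Set
    Fixed i J t = ch t ≡ suc i × lv t ≡ J × lim t ≡ t

    fixed-infinite : ∀ i J → Infinitely (Fixed i J)
    fixed-infinite i J K with fixed-points (suc i) J K
    ... | x , le , e = pair (suc i) (pair J x) , ≤-trans le (≤-trans (right≤pair J x) (right≤pair (suc i) _)) ,
                       π1-pair (suc i) _ , trans (cong π1 (π2-pair (suc i) _)) (π1-pair J x) , e

    fixed-linkable : ∀ {i J m t} → ch m ≡ 0 ⊎ (ch m ≡ suc i × lv m ≤ J) → Fixed i J t → Linkable m t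
    fixed-linkable {i} {J} {m} {t} h (c , l , f) = (λ z → 0≢1+n (trans (sym z) (trans (cong ch f) c))) , below h (lim-below m)
      where
      below : ch m ≡ 0 ⊎ (ch m ≡ suc i × lv m ≤ J) → Below (lim m) m → Below (lim m) (lim t)
      below _ (inj₁ z) = inj₁ z
      below (inj₁ z) (inj₂ (e , _)) = inj₁ (trans e z)
      below (inj₂ (z , l′)) (inj₂ (e , le)) = inj₂ (trans e (trans z (sym (trans (cong ch f) c))) ,
        ≤-trans le (≤-trans l′ (≤-reflexive (sym (trans (cong lv f) l)))))

    link-fixed : ∀ {f i J} → Computable f → ∀ m → ch m ≡ 0 ⊎ (ch m ≡ suc i × lv m ≤ J) →
                 Infinitely (λ t → Fixed i J t × Enumerated f t) →
                 Σ ℕ λ v → Enumerated f v × Σ ℕ λ s → root s v ≡ root s m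
    link-fixed c m h inf = link c m λ N → proj₁ (inf N) , proj₂ (proj₂ (proj₂ (inf N))) ,
      ≤-trans (proj₁ (proj₂ (inf N))) (≤-reflexive (sym (proj₂ (proj₂ (proj₁ (proj₂ (proj₂ (inf N)))))))) ,
      fixed-linkable h (proj₁ (proj₂ (proj₂ (inf N))))

    -- Over the empty base the point for TRUE is the only external member, so the truth value of an
    -- external root can be read off.
    mem-ext-𝟎 : ∀ r → Mem 𝟎 r → r ≡ ext 1
    mem-ext-𝟎 r (c , x) with π2 r in eq
    ... | suc zero = trans (sym (pair-π r)) (cong₂ pair c eq)
    ... | suc (suc k) = ⊥-elim (W-𝟎 k x)

    -- By separation, for every surviving t from N on, `γ t` must end in an external point or in one
    -- of finitely many other classes, so that its truth value becomes visible at some stage. One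
    -- truth value is visible for infinitely many surviving t; linking one point of this enumeration
    -- to the external point of the opposite truth value contradicts the preservation of membership.
    module NoReduction (i J : ℕ) (γ : ℕ → ℕ) (γC : Computable γ)
      (red : ∀ m → ch m ≡ suc i → lv m ≡ J → (Mem 𝟎 (lim m) ⇔ Mem 𝟎 (lim (γ m))) ×
               (ch (γ m) ≡ 0 ⊎ ¬ (ch (γ m) ≡ suc i × J ≤ lv (γ m)))) where
      col : ℕ → ℕ
      col t = neq (ch t) (suc i) + neq (lv t) J
      colE : ∀ {n} → Exp n → Exp n
      colE t = neqE (π1E t) (lit (suc i)) +E neqE (π1E (π2E t)) (lit J)
      col-sound : ∀ t → col t ≡ 0 → ch t ≡ suc i × lv t ≡ J
      col-sound t h = neq⇒≡ (m+n≡0⇒m≡0 (neq (ch t) (suc i)) h) , neq⇒≡ (m+n≡0⇒n≡0 (neq (ch t) (suc i)) h)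
      col-complete : ∀ t → ch t ≡ suc i → lv t ≡ J → col t ≡ 0
      col-complete t a b = cong₂ _+_ (≡⇒neq a) (≡⇒neq b)

      F : ℕ → ℕ
      F t = ifz (col t) (suc (pair t (γ t))) 0
      sep = separate (computable (computedBy F (ifzE (colE v0) (sucE (pairE v0 (fnE γC v0))) (lit 0)) λ { (_ ∷ []) → refl }))
      N = proj₁ sep

      Q : ℕ → Set
      Q v = lim v ≡ v × ch v ≢ 0
      τ = proj₁ (proj₁ (table Q N))
      τC = proj₂ (proj₁ (table Q N))
      τ-spec = proj₂ (table Q N)

      -- Tests on a root of `γ t`: `δT` recognises the true root, and `δF` recognises every other
      -- external root together with the surviving roots below `N`, which never enter the set.
      δT δF : Decider
      δT = decider (λ r → neq r (ext 1)) (neqE v0 (pairE (lit 0) (lit 1))) λ _ → refl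
      δF = decider (λ r → (ch r + neg (neq r (ext 1))) * τ r)
        ((π1E v0 +E negE (neqE v0 (pairE (lit 0) (lit 1)))) *E fnE τC v0) λ _ → refl

      reaching : Decider → ℕ → ℕ
      reaching (δ , _) z = ifz (col (π1 z) + δ (root (π2 z) (γ (π1 z)))) (suc (π1 z)) 0

      reachingC : ∀ d → Computable (reaching d)
      reachingC d@(δ , δC) = computable (computedBy (reaching d)
        (ifzE (colE (π1E v0) +E fnE δC (rootE (π2E v0) (fnE γC (π1E v0)))) (sucE (π1E v0)) (lit 0)) λ { (_ ∷ []) → refl })

      reaching-sound : ∀ d t → Enumerated (reaching d) t → ch t ≡ suc i × lv t ≡ J × Σ ℕ λ s → proj₁ d (root s (γ t)) ≡ 0
      reaching-sound (δ , _) t (z , e) with col (π1 z) + δ (root (π2 z) (γ (π1 z))) in eq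
      reaching-sound (δ , _) .(π1 z) (z , refl) | zero =
        proj₁ (col-sound _ (m+n≡0⇒m≡0 (col (π1 z)) eq)) , proj₂ (col-sound _ (m+n≡0⇒m≡0 (col (π1 z)) eq)) ,
        π2 z , m+n≡0⇒n≡0 (col (π1 z)) eq

      reaching-complete : ∀ d t → ch t ≡ suc i → lv t ≡ J → proj₁ d (lim (γ t)) ≡ 0 → Enumerated (reaching d) t
      reaching-complete (δ , _) t a b h = pair t s , trans (cong₂ (λ x y → ifz (col x + δ (root y (γ x))) (suc x) 0) (π1-pair t s) (π2-pair t s))
          (ifz-zero (cong₂ _+_ (col-complete t a b) h))
        where s = modulus (γ t)

      lim-from : ∀ {s x y} → root s x ≡ y → lim x ≡ lim y
      lim-from {s} {x} refl = sym (lim-of-root s x)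

      hit : ∀ t → N ≤ t → Fixed i J t → Enumerated (reaching δT) t ⊎ Enumerated (reaching δF) t
      hit t le (a , b , f) with lim (γ t) ≟ ext 1
      ... | yes e = inj₁ (reaching-complete δT t a b (≡⇒neq e))
      ... | no ne with ch (lim (γ t)) ≟ 0
      ... | yes z = inj₂ (reaching-complete δF t a b (cong (_* τ (lim (γ t))) (cong₂ _+_ z (≢0⇒neg (λ q → ne (neq⇒≡ q))))))
      ... | no nz with N ≤? lim (γ t)
      ... | no l = inj₂ (reaching-complete δF t a b (trans (cong ((ch (lim (γ t)) + neg (neq (lim (γ t)) (ext 1))) *_)
               (from (τ-spec _) (≰⇒> l , lim-idem (γ t) , nz))) (*-zeroʳ (ch (lim (γ t)) + neg (neq (lim (γ t)) (ext 1))))))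
      -- Here t and `γ t` end in distinct large classes that are not external, so separation makes
      -- some point true and its image under γ false.
      ... | yes big = ⊥-elim (absurd (proj₂ sep (pair t (γ t)) (t , ifz-zero (col-complete t a b))
              (subst (λ x → ch (lim x) ≢ 0) (sym p1) (λ z → 0≢1+n (trans (sym z) (trans (cong ch f) a))))
              (subst (λ x → N ≤ lim x) (sym p1) (≤-trans le (≤-reflexive (sym f))))
              (subst (λ x → ch (lim x) ≢ 0) (sym p2) nz)
              (subst (λ x → N ≤ lim x) (sym p2) big)
              (subst₂ (λ x y → lim x ≢ lim y) (sym p1) (sym p2) distinct)))
        where
        p1 = π1-pair t (γ t)
        p2 = π2-pair t (γ t)
        -- A root that is not external stays in its chain and never rises to a higher level, so
        -- `γ t` cannot end at t.
        distinct : lim t ≢ lim (γ t)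
        distinct e with lim-below (γ t) | proj₂ (red t a b)
        ... | inj₁ z | _ = nz z
        ... | inj₂ (c , l) | inj₁ z = nz (trans c z)
        ... | inj₂ (c , l) | inj₂ nn = nn (trans (sym c) (trans (cong ch (sym t≡)) a) , ≤-trans (≤-reflexive (trans (sym b) (cong lv t≡))) l)
          where
          t≡ : t ≡ lim (γ t)
          t≡ = trans (sym f) e
        absurd : (Σ ℕ λ w → Enumerated F w × Σ ℕ λ s → root s (π1 w) ≡ ext 1 × root s (π2 w) ≡ ext 0) → ⊥
        absurd (w , (z , e) , s , r₁ , r₂) with col z in eq
        absurd (.(pair z (γ z)) , (z , refl) , s , r₁ , r₂) | zero =
          to (mem-ext 0) (subst (Mem 𝟎) (lim-from {s} (trans (cong (root s) (sym (π2-pair z (γ z)))) r₂))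
            (to (proj₁ (red z (proj₁ (col-sound z eq)) (proj₂ (col-sound z eq))))
              (subst (Mem 𝟎) (sym (lim-from {s} (trans (cong (root s) (sym (π1-pair z (γ z)))) r₁))) (from (mem-ext 1) tt))))

      lim-linked-ext : ∀ {s v k} → root s v ≡ root s (ext k) → lim v ≡ lim (ext k)
      lim-linked-ext {s} {v} {k} e = lim-merge s v (ext k) e

      Linked : Decider → ℕ → Set
      Linked d k = Σ ℕ λ v → Enumerated (reaching d) v × Σ ℕ λ s → root s v ≡ root s (ext k)

      false-linked : Linked δT 0 → ⊥
      false-linked (v , en , s , e) = refute (reaching-sound δT v en)
        where
        refute : ch v ≡ suc i × lv v ≡ J × (Σ ℕ λ s → neq (root s (γ v)) (ext 1) ≡ 0) → ⊥
        refute (a , b , s′ , h) = to (mem-ext 0) (subst (Mem 𝟎) (lim-linked-ext e) (from (proj₁ (red v a b))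
          (subst (Mem 𝟎) (sym (lim-from {s′} (neq⇒≡ h))) (from (mem-ext 1) tt))))

      true-linked : Linked δF 1 → ⊥
      true-linked (v , en , s , e) = refute (reaching-sound δF v en)
        where
        refute : ch v ≡ suc i × lv v ≡ J × (Σ ℕ λ s → proj₁ δF (root s (γ v)) ≡ 0) → ⊥
        refute (a , b , s′ , h) = cases (m*n≡0⇒m≡0∨n≡0 (ch r + neg (neq r (ext 1))) h)
          where
          r = root s′ (γ v)
          m : Mem 𝟎 (lim (γ v))
          m = to (proj₁ (red v a b)) (subst (Mem 𝟎) (sym (lim-linked-ext e)) (from (mem-ext 1) tt))
          cases : ch r + neg (neq r (ext 1)) ≡ 0 ⊎ τ r ≡ 0 → ⊥
          cases (inj₁ z) = neg⇒≢0 (m+n≡0⇒n≡0 (ch r) z) (≡⇒neq (trans (sym (lim-ext s′ (γ v) (m+n≡0⇒m≡0 (ch r) z))) (mem-ext-𝟎 _ m)))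
          cases (inj₂ z) = proj₂ (proj₂ (to (τ-spec r) z))
            (trans (cong ch (trans (sym (proj₁ (proj₂ (to (τ-spec r) z)))) (lim-of-root s′ (γ v)))) (proj₁ m))

      finish : Infinitely (λ t → Fixed i J t × Enumerated (reaching δT) t) ⊎ Infinitely (λ t → Fixed i J t × Enumerated (reaching δF) t) → ⊥
      finish (inj₁ inf) = false-linked (link-fixed (reachingC δT) (ext 0) (inj₁ (ch-ext 0)) inf)
      finish (inj₂ inf) = true-linked (link-fixed (reachingC δF) (ext 1) (inj₁ (ch-ext 1)) inf)

      impossible : ⊥
      impossible = finish (infinitely-split N (fixed-infinite i J) hit)

    segment-strict : ∀ i J → ¬ (segment 𝟎 i (suc J) ≤m segment 𝟎 i J)
    segment-strict i J h = NoReduction.impossible i J ν νC λ m c l →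
        ⇔-trans (⇔-sym (mem-S (inChainTo i (suc J)) m (⇒inChainTo i (suc J) m (inj₂ (c , s≤s (≤-reflexive l)))))) (mem m) , outside m
      where
      open Pointed (pointed (inChainTo i J) (inChainTo-ext i J) h)
      outside : ∀ m → ch (ν m) ≡ 0 ⊎ ¬ (ch (ν m) ≡ suc i × J ≤ lv (ν m))
      outside m with inChainTo⇒ i J (ν m) (νu m)
      ... | inj₁ z = inj₁ z
      ... | inj₂ (_ , lt) = inj₂ λ { (_ , le) → <-irrefl refl (≤-trans lt le) }

    segment-independent : ∀ i j → i ≢ j → ¬ (segment 𝟎 i 1 ≤m whole 𝟎 j)
    segment-independent i j ne h = NoReduction.impossible i 0 ν νC λ m c l →
        ⇔-trans (⇔-sym (mem-S (inChainTo i 1) m (⇒inChainTo i 1 m (inj₂ (c , s≤s (≤-reflexive l)))))) (mem m) , outside m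
      where
      open Pointed (pointed (inChain j) (inChain-ext j) h)
      outside : ∀ m → ch (ν m) ≡ 0 ⊎ ¬ (ch (ν m) ≡ suc i × 0 ≤ lv (ν m))
      outside m with inChain⇒ j (ν m) (νu m)
      ... | inj₁ z = inj₁ z
      ... | inj₂ z = inj₂ λ { (e , _) → ne (suc-injective (trans (sym e) z)) }

    segment-mono : ∀ E i {J K} → J ≤ K → segment E i J ≤m segment E i K
    segment-mono E i {J} {K} le = S-mono (inChainTo i J) (inChainTo i K) sub
      where
      sub : ∀ n → proj₁ (inChainTo i J) n ≡ 0 → proj₁ (inChainTo i K) n ≡ 0
      sub n h with inChainTo⇒ i J n h
      ... | inj₁ z = ⇒inChainTo i K n (inj₁ z)
      ... | inj₂ (z , lt) = ⇒inChainTo i K n (inj₂ (z , ≤-trans lt le))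

    segment≤whole : ∀ E i J → segment E i J ≤m whole E i
    segment≤whole E i J = S-mono (inChainTo i J) (inChain i) (inChainTo⊆ i J)

    cover : CE → CE
    cover E = segment E 0 1

    cover-above : ∀ E → E ≤m cover E
    cover-above E = base≤S E (inChainTo 0 1) (inChainTo-ext 0 1)

    cover-below : ∀ {E c} → c ≤m cover E → c ≤m E ⊎ cover E ≤m c
    cover-below {E} {c} h with below-whole 0 (≤m-trans {c} {cover E} {whole E 0} h (segment≤whole E 0 1))
    ... | inj₁ le = inj₂ (≤m-trans {cover E} {whole E 0} {c} (segment≤whole E 0 1) le)
    ... | inj₂ (zero , le , _) = inj₁ (≤m-trans {c} {segment E 0 0} {E} le (segment-zero E 0))
    ... | inj₂ (suc J , le , inj₂ ge) = inj₂ (≤m-trans {cover E} {segment E 0 (suc J)} {c} (segment-mono E 0 (s≤s z≤n)) ge)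

    -- A reduction of the cover to the join decides a side for every point. Some side occurs at
    -- infinitely many surviving points of level 0, and each point of the cover can be linked to an
    -- enumerated point with that side. So the cover, and with it the whole join, reduces to one of
    -- a and b.
    cover-join : ∀ {a b} → cover (a ∨m b) ≤m (a ∨m b) → a ≤m b ⊎ b ≤m a
    cover-join {a} {b} (g , gC , p) = finish (infinitely-split 0 (fixed-infinite 0 0) split)
      where
      E = a ∨m b
      u = inChainTo 0 1
      Fₗ Fᵣ : ℕ → ℕ
      Fₗ t = ifz (proj₁ u t + side (g t)) (suc t) 0
      Fᵣ t = ifz (proj₁ u t + neg (side (g t))) (suc t) 0
      FₗC : Computable Fₗ
      FₗC = computable (computedBy Fₗ (ifzE (fnE (proj₂ u) v0 +E sideE (fnE gC v0)) (sucE v0) (lit 0)) λ { (_ ∷ []) → refl })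
      FᵣC : Computable Fᵣ
      FᵣC = computable (computedBy Fᵣ (ifzE (fnE (proj₂ u) v0 +E negE (sideE (fnE gC v0))) (sucE v0) (lit 0)) λ { (_ ∷ []) → refl })
      hC : Computable (λ t → unside (g t))
      hC = computable (computedBy (λ t → unside (g t)) (unsideE (fnE gC v0)) λ { (_ ∷ []) → refl })
      split : ∀ t → 0 ≤ t → Fixed 0 0 t → Enumerated Fₗ t ⊎ Enumerated Fᵣ t
      split t _ (c , l , f) with side (g t) ≟ 0
      ... | yes z = inj₁ (t , ifz-zero (cong₂ _+_ (⇒inChainTo 0 1 t (inj₂ (c , s≤s (≤-reflexive l)))) z))
      ... | no nz = inj₂ (t , ifz-zero (cong₂ _+_ (⇒inChainTo 0 1 t (inj₂ (c , s≤s (≤-reflexive l)))) (≢0⇒neg nz)))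
      level : ∀ m → proj₁ u m ≡ 0 → ch m ≡ 0 ⊎ (ch m ≡ 1 × lv m ≤ 0)
      level m h with inChainTo⇒ 0 1 m h
      ... | inj₁ z = inj₁ z
      ... | inj₂ (z , lt) = inj₂ (z , ≤-pred lt)
      member : ∀ t → proj₁ u t ≡ 0 → Mem E (lim t) ⇔ InTF (W E) (g t)
      member t h = ⇔-trans (⇔-sym (mem-S u t h)) (p t)
      eqvₗ : ∀ t v → Fₗ t ≡ suc v → Mem E (lim v) ⇔ InTF (W a) (unside (g t))
      eqvₗ t v e with proj₁ u t + side (g t) in eq
      eqvₗ t .t refl | zero = ⇔-trans (member t (m+n≡0⇒m≡0 (proj₁ u t) eq)) (side-left a b (g t) (m+n≡0⇒n≡0 (proj₁ u t) eq))
      eqvᵣ : ∀ t v → Fᵣ t ≡ suc v → Mem E (lim v) ⇔ InTF (W b) (unside (g t))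
      eqvᵣ t v e with proj₁ u t + neg (side (g t)) in eq
      eqvᵣ t .t refl | zero = ⇔-trans (member t (m+n≡0⇒m≡0 (proj₁ u t) eq)) (side-right a b (g t) (neg⇒≢0 (m+n≡0⇒n≡0 (proj₁ u t) eq)))
      finish : Infinitely (λ t → Fixed 0 0 t × Enumerated Fₗ t) ⊎ Infinitely (λ t → Fixed 0 0 t × Enumerated Fᵣ t) → a ≤m b ⊎ b ≤m a
      finish (inj₁ inf) = inj₂ (≤m-trans {b} {E} {a} (∨m-right a b) (≤m-trans {E} {cover E} {a} (cover-above E)
        (fromLinks {h = λ t → unside (g t)} u FₗC hC (λ m h → link-fixed FₗC m (level m h) inf) eqvₗ)))
      finish (inj₂ inf) = inj₁ (≤m-trans {a} {E} {b} (∨m-left a b) (≤m-trans {E} {cover E} {b} (cover-above E)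
        (fromLinks {h = λ t → unside (g t)} u FᵣC hC (λ m h → link-fixed FᵣC m (level m h) inf) eqvᵣ)))

-- Arithmetic of finite chains in a distributive semilattice.

module ChainArithmetic where

  -- The coding argument sees computability only through these properties of the order.
  record OrderFacts (C : Set) (_≤_ : C → C → Set) : Set where
    field
      ≤-id    : ∀ {a} → a ≤ a
      ≤-tr    : ∀ {a b c} → a ≤ b → b ≤ c → a ≤ c
      _∨_     : C → C → C
      ∨-l     : ∀ {a b} → a ≤ (a ∨ b)
      ∨-r     : ∀ {a b} → b ≤ (a ∨ b)
      ∨-lub   : ∀ {a b c} → a ≤ c → b ≤ c → (a ∨ b) ≤ c
      ∨-split : ∀ {x a b} → x ≤ (a ∨ b) → Σ C λ a′ → Σ C λ b′ → a′ ≤ a × b′ ≤ b × x ≤ (a′ ∨ b′) × (a′ ∨ b′) ≤ x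
      o       : C
      o-min   : ∀ {a} → o ≤ a
      cov       : C → C
      cov-above : ∀ {a} → a ≤ cov a
      cov-below : ∀ {a c} → c ≤ cov a → c ≤ a ⊎ cov a ≤ c
      cov-join  : ∀ {a b} → cov (a ∨ b) ≤ (a ∨ b) → a ≤ b ⊎ b ≤ a
      seg       : ℕ → ℕ → C
      lim       : ℕ → C
      seg-zero   : ∀ {i} → seg i 0 ≤ o
      seg-mono   : ∀ {i J K} → J ℕ.≤ K → seg i J ≤ seg i K
      seg-strict : ∀ {i J} → ¬ (seg i (suc J) ≤ seg i J)
      seg≤lim    : ∀ {i J} → seg i J ≤ lim i
      lim-below  : ∀ {i x} → x ≤ lim i → lim i ≤ x ⊎ Σ ℕ λ J → x ≤ seg i J × seg i J ≤ x
      seg-indep  : ∀ {i j} → i ≢ j → ¬ (seg i 1 ≤ lim j)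

  -- The predicates of the coding, in terms of the order alone.

  module Coding {C : Set} (_≤_ : C → C → Set) where

    infix 4 _≈_
    _≈_ : C → C → Set
    a ≈ b = a ≤ b × b ≤ a

    -- Quantifying over upper bounds replaces the join, which is not a symbol of the language.
    JoinBelow : C → C → C → Set
    JoinBelow u a b = ∀ v → a ≤ v → b ≤ v → u ≤ v

    StrongCover : C → C → C → Set
    StrongCover z a b = a ≤ z × b ≤ z × ¬ JoinBelow z a b × (∀ u → u ≤ z → z ≤ u ⊎ JoinBelow u a b)

    -- One parameter codes every pair with a strong cover below it. Incomparability excludes
    -- degenerate pairs: if `a ≤ b`, the strong cover condition depends on b alone and says nothing
    -- else about a.
    Code : C → C → C → Set
    Code p a b = ¬ a ≤ b × ¬ b ≤ a × Σ C λ z → z ≤ p × StrongCover z a b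

    Rel : C → C → C → C → C → Set
    Rel y p q a b = Σ C λ m → m ≤ y × Code p a m × Code q m b

    In : C → C → C → Set
    In l x a = a ≤ x × ¬ a ≤ l

    -- The last clause, applied to equivalent elements, makes R single-valued and injective up to
    -- `_≈_`.
    IsoBy : (C → C → Set) → C → C → C → C → Set
    IsoBy R l x l′ x′ =
      (∀ a → In l x a → Σ C λ b → In l′ x′ b × R a b) ×
      (∀ b → In l′ x′ b → Σ C λ a → In l x a × R a b) ×
      (∀ a a′ b b′ → In l x a → In l x a′ → In l′ x′ b → In l′ x′ b′ → R a b → R a′ b′ →
         (a ≤ a′ → b ≤ b′) × (b ≤ b′ → a ≤ a′))

    Iso : C → C → C → C → Set
    Iso l x l′ x′ = Σ C λ y → Σ C λ p → Σ C λ q → IsoBy (Rel y p q) l x l′ x′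

    Zero : C → Set
    Zero z = ∀ u → z ≤ u

    Ind : C → Set
    Ind w = ¬ Zero w × (∀ c → c ≤ w × ¬ w ≤ c →
      Σ C λ d → (d ≤ w × ¬ w ≤ d) × (c ≤ d × ¬ d ≤ c) × (∀ u → u ≤ w → u ≤ c ⊎ d ≤ u))

    Number : C → Set
    Number x = ∀ z → Zero z → ∀ w → Ind w → Σ C λ c → (c ≤ w × ¬ w ≤ c) × Iso z x z c

    Equal : C → C → Set
    Equal x y = Σ C λ z → Zero z × Iso z x z y

    Add : C → C → C → Set
    Add x y s = Σ C λ z → Zero z × Σ C λ c → c ≤ s × Iso z x z c × Iso z y c s

    -- The bottom is comparable with everything, so `Rel` never holds of it; the pair of bottoms is
    -- therefore added separately.
    Graph : C → C → C → C → C → C → Set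
    Graph z y p q a b = (a ≤ z × b ≤ z) ⊎ Rel y p q a b

    Next : C → C → C → Set
    Next x a a′ = a′ ≤ x × a ≤ a′ × ¬ a′ ≤ a × (∀ u → u ≤ a′ → u ≤ a ⊎ a′ ≤ u)

    -- The graph maps the elements of x to the multiples of y in t, and the bottom to the bottom.
    Times : C → C → C → C → Set
    Times z x y t = Σ C λ y′ → Σ C λ p → Σ C λ q →
      Graph z y′ p q x t ×
      (∀ a b b′ → a ≤ x → b ≤ t → b′ ≤ t → Graph z y′ p q a b → Graph z y′ p q a b′ → b ≤ b′) ×
      (∀ a a′ → Next x a a′ → Σ C λ b → Σ C λ b′ → b ≤ b′ × b′ ≤ t × Graph z y′ p q a b × Graph z y′ p q a′ b′ × Iso b b′ z y)

    -- A zero factor y is a case of its own: all multiples of y are then the bottom, which `Rel`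
    -- cannot assign to the other elements of x.
    Mul : C → C → C → Set
    Mul x y t = Σ C λ z → Zero z × ((y ≤ z × t ≤ z) ⊎ (¬ y ≤ z × Times z x y t))

  -- Correctness of the predicates for finite chains.

  module Arithmetic (em : ExcludedMiddle 0ℓ) {C : Set} {_≤_ : C → C → Set} (facts : OrderFacts C _≤_) where
    open OrderFacts facts
    open Coding _≤_

    ≈-refl : ∀ {a} → a ≈ a
    ≈-refl = ≤-id , ≤-id

    ≈-sym : ∀ {a b} → a ≈ b → b ≈ a
    ≈-sym (p , q) = q , p

    ≈-trans : ∀ {a b c} → a ≈ b → b ≈ c → a ≈ c
    ≈-trans (p , q) (r , s) = ≤-tr p r , ≤-tr s q

    code-resp : ∀ {p a a′ b b′} → a ≈ a′ → b ≈ b′ → Code p a b → Code p a′ b′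
    code-resp {_} {a} {a′} {b} {b′} (a≤ , a≥) (b≤ , b≥) (i₁ , i₂ , z , zp , s₁ , s₂ , s₃ , s₄) =
      (λ h → i₁ (≤-tr a≤ (≤-tr h b≥))) , (λ h → i₂ (≤-tr b≤ (≤-tr h a≥))) , z , zp , ≤-tr a≥ s₁ , ≤-tr b≥ s₂ ,
      (λ jb → s₃ λ v x y → jb v (≤-tr a≥ x) (≤-tr b≥ y)) , λ u h → alt (s₄ u h)
      where
      alt : ∀ {u} → z ≤ u ⊎ JoinBelow u a b → z ≤ u ⊎ JoinBelow u a′ b′
      alt (inj₁ h)  = inj₁ h
      alt (inj₂ jb) = inj₂ λ v x y → jb v (≤-tr a≤ x) (≤-tr b≤ y)

    rel-resp : ∀ {y p q a a′ b b′} → a ≈ a′ → b ≈ b′ → Rel y p q a b → Rel y p q a′ b′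
    rel-resp e f (m , my , c , d) = m , my , code-resp e ≈-refl c , code-resp ≈-refl f d

    graph-resp : ∀ {z y p q a a′ b b′} → a ≈ a′ → b ≈ b′ → Graph z y p q a b → Graph z y p q a′ b′
    graph-resp e f (inj₁ (u , v)) = inj₁ (≤-tr (proj₂ e) u , ≤-tr (proj₂ f) v)
    graph-resp e f (inj₂ r)       = inj₂ (rel-resp e f r)

    Linear : C → Set
    Linear x = ∀ u v → u ≤ x → v ≤ x → u ≤ v ⊎ v ≤ u

    JoinPrime : C → Set
    JoinPrime z = ∀ u v → z ≤ (u ∨ v) → z ≤ u ⊎ z ≤ v

    -- Distributivity splits a into a part below u and a part below v; in a chain the larger part is
    -- all of a.
    linear-prime : ∀ {x} → Linear x → ∀ {a} → a ≤ x → JoinPrime a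
    linear-prime lin a≤x u v h with ∨-split h
    ... | u′ , v′ , u′≤u , v′≤v , up , down with lin u′ v′ (≤-tr ∨-l (≤-tr down a≤x)) (≤-tr ∨-r (≤-tr down a≤x))
    ... | inj₁ le = inj₂ (≤-tr up (≤-tr (∨-lub le ≤-id) v′≤v))
    ... | inj₂ le = inj₁ (≤-tr up (≤-tr (∨-lub ≤-id le) u′≤u))

    joinBelow : ∀ {u a b} → u ≤ (a ∨ b) → JoinBelow u a b
    joinBelow h v a≤v b≤v = ≤-tr h (∨-lub a≤v b≤v)

    -- Split z along `u ∨ v`. If neither part were above z, both would lie below the join of a and
    -- b, and then so would z.
    cover-prime : ∀ {z a b} → StrongCover z a b → JoinPrime z
    cover-prime {z} {a} {b} (_ , _ , ne , alt) u v h with ∨-split h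
    ... | u′ , v′ , u′≤u , v′≤v , up , down with alt u′ (≤-tr ∨-l down) | alt v′ (≤-tr ∨-r down)
    ... | inj₁ le | _ = inj₁ (≤-tr le u′≤u)
    ... | _ | inj₁ le = inj₂ (≤-tr le v′≤v)
    ... | inj₂ j | inj₂ k = ⊥-elim (ne λ w a≤w b≤w → ≤-tr up (∨-lub (j w a≤w b≤w) (k w a≤w b≤w)))

    ⋁ : (ℕ → C) → ℕ → C
    ⋁ f zero    = o
    ⋁ f (suc k) = f k ∨ ⋁ f k

    ≤⋁ : ∀ f {k j} → j < k → f j ≤ ⋁ f k
    ≤⋁ f {suc k} {j} lt with j ≟ k
    ... | yes refl = ∨-l
    ... | no ne = ≤-tr (≤⋁ f (≤∧≢⇒< (≤-pred lt) ne)) ∨-r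

    prime-⋁ : ∀ {z} f k → JoinPrime z → z ≤ ⋁ f k → z ≤ o ⊎ Σ ℕ λ j → j < k × z ≤ f j
    prime-⋁ f zero pr h = inj₁ h
    prime-⋁ f (suc k) pr h with pr (f k) (⋁ f k) h
    ... | inj₁ le = inj₂ (k , ≤-refl , le)
    ... | inj₂ le with prime-⋁ f k pr le
    ... | inj₁ z = inj₁ z
    ... | inj₂ (j , lt , le′) = inj₂ (j , m≤n⇒m≤1+n lt , le′)

    cov-strong : ∀ {a b} → ¬ a ≤ b → ¬ b ≤ a → StrongCover (cov (a ∨ b)) a b
    cov-strong {a} {b} n m = ≤-tr ∨-l cov-above , ≤-tr ∨-r cov-above , strict , alt
      where
      strict : ¬ JoinBelow (cov (a ∨ b)) a b
      strict h with cov-join (h _ ∨-l ∨-r)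
      ... | inj₁ le = n le
      ... | inj₂ le = m le
      alt : ∀ u → u ≤ cov (a ∨ b) → cov (a ∨ b) ≤ u ⊎ JoinBelow u a b
      alt u h with cov-below h
      ... | inj₁ le = inj₂ (joinBelow le)
      ... | inj₂ le = inj₁ le

    -- The strong covers of the joins aⱼ ∨ mⱼ are exactly the strong covers below the join of them all.
    module Pairs {x y : C} (lin-x : Linear x) (lin-y : Linear y) (disjoint : ∀ u → u ≤ x → u ≤ y → u ≤ o)
                 (k : ℕ) (a m : ℕ → C)
                 (a≤ : ∀ j → j < k → In o x (a j)) (m≤ : ∀ j → j < k → In o y (m j)) where

      z : ℕ → C
      z j = cov (a j ∨ m j)

      param : C
      param = ⋁ z k

      incomparable : ∀ {a m} → In o x a → In o y m → ¬ a ≤ m × ¬ m ≤ a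
      incomparable (ax , a≰) (my , m≰) = (λ h → a≰ (disjoint _ ax (≤-tr h my))) , (λ h → m≰ (disjoint _ (≤-tr h ax) my))

      encode : ∀ j → j < k → ∀ {b n} → b ≈ a j → n ≈ m j → Code param b n
      encode j lt e f = code-resp (≈-sym e) (≈-sym f) (proj₁ inc , proj₂ inc , z j , ≤⋁ z lt , cov-strong (proj₁ inc) (proj₂ inc))
        where inc = incomparable (a≤ j lt) (m≤ j lt)

      -- Join primeness puts the strong cover s below a single `z j`. If s is also below
      -- `a j ∨ m j`, it lies inside one of the two chains, where b and n would be comparable.
      -- Otherwise s is equivalent to `z j`; each pair is then below the join of the other, and
      -- primeness with disjointness matches the components.
      decode : ∀ {b n} → b ≤ x → n ≤ y → Code param b n → Σ ℕ λ j → j < k × b ≈ a j × n ≈ m j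
      decode {b} {n} bx ny (i₁ , i₂ , s , s≤ , sc@(bs , ns , strict , alt)) with prime-⋁ z k (cover-prime sc) s≤
      ... | inj₁ le = ⊥-elim (strict λ v _ _ → ≤-tr le o-min)
      ... | inj₂ (j , lt , s≤z) with cov-below s≤z
      ... | inj₁ le with cover-prime sc (a j) (m j) le
      ... | inj₁ sa with lin-x b n (≤-tr bs (≤-tr sa (proj₁ (a≤ j lt)))) (≤-tr ns (≤-tr sa (proj₁ (a≤ j lt))))
      ... | inj₁ h = ⊥-elim (i₁ h)
      ... | inj₂ h = ⊥-elim (i₂ h)
      decode {b} {n} bx ny (i₁ , i₂ , s , s≤ , sc@(bs , ns , strict , alt)) | inj₂ (j , lt , s≤z) | inj₁ le | inj₂ sm
        with lin-y b n (≤-tr bs (≤-tr sm (proj₁ (m≤ j lt)))) (≤-tr ns (≤-tr sm (proj₁ (m≤ j lt))))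
      ... | inj₁ h = ⊥-elim (i₁ h)
      ... | inj₂ h = ⊥-elim (i₂ h)
      decode {b} {n} bx ny (i₁ , i₂ , s , s≤ , sc@(bs , ns , strict , alt)) | inj₂ (j , lt , s≤z) | inj₂ z≤s =
        j , lt , (b≤a , a≤b) , (n≤m , m≤n)
        where
        inc = incomparable (a≤ j lt) (m≤ j lt)
        cs = cov-strong (proj₁ inc) (proj₂ inc)
        below-join : ∀ {u} → u ≤ s → ¬ s ≤ u → u ≤ (a j ∨ m j)
        below-join us ns′ with cov-below (≤-tr us s≤z)
        ... | inj₁ le = le
        ... | inj₂ le = ⊥-elim (ns′ (≤-tr s≤z le))
        under : ∀ {u} → u ≤ s → ¬ s ≤ u → u ≤ (b ∨ n)
        under us ns′ with alt _ us
        ... | inj₁ le = ⊥-elim (ns′ le)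
        ... | inj₂ jb = jb _ ∨-l ∨-r
        b≤a : b ≤ a j
        b≤a with linear-prime lin-x bx (a j) (m j) (below-join bs λ h → i₂ (≤-tr ns h))
        ... | inj₁ h = h
        ... | inj₂ h = ⊥-elim (i₁ (≤-tr (disjoint b bx (≤-tr h (proj₁ (m≤ j lt)))) o-min))
        n≤m : n ≤ m j
        n≤m with linear-prime lin-y ny (a j) (m j) (below-join ns λ h → i₁ (≤-tr bs h))
        ... | inj₂ h = h
        ... | inj₁ h = ⊥-elim (i₂ (≤-tr (disjoint n (≤-tr h (proj₁ (a≤ j lt))) ny) o-min))
        a≤b : a j ≤ b
        a≤b with linear-prime lin-x (proj₁ (a≤ j lt)) b n (under (≤-tr (proj₁ cs) z≤s)
                   (λ h → proj₂ inc (≤-tr (≤-tr (proj₁ (proj₂ cs)) z≤s) h)))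
        ... | inj₁ h = h
        ... | inj₂ h = ⊥-elim (proj₂ (a≤ j lt) (disjoint _ (proj₁ (a≤ j lt)) (≤-tr h ny)))
        m≤n : m j ≤ n
        m≤n with linear-prime lin-y (proj₁ (m≤ j lt)) b n (under (≤-tr (proj₁ (proj₂ cs)) z≤s)
                   (λ h → proj₁ inc (≤-tr (≤-tr (proj₁ cs) z≤s) h)))
        ... | inj₂ h = h
        ... | inj₁ h = ⊥-elim (proj₂ (m≤ j lt) (disjoint _ (≤-tr h bx) (proj₁ (m≤ j lt))))

    seg-reflect : ∀ {i J K} → seg i J ≤ seg i K → J ℕ.≤ K
    seg-reflect {i} {J} {K} h with J ≤? K
    ... | yes le = le
    ... | no nle = ⊥-elim (seg-strict (≤-tr (seg-mono (≰⇒> nle)) h))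

    lim≰seg : ∀ {i J} → ¬ lim i ≤ seg i J
    lim≰seg h = seg-strict (≤-tr seg≤lim h)

    below-seg : ∀ {i J u} → u ≤ seg i J → Σ ℕ λ K → u ≈ seg i K
    below-seg h with lim-below (≤-tr h seg≤lim)
    ... | inj₁ le = ⊥-elim (lim≰seg (≤-tr le h))
    ... | inj₂ r = r

    seg-linear : ∀ i J → Linear (seg i J)
    seg-linear i J u v hu hv with below-seg hu | below-seg hv
    ... | K , ku , uk | L , lv′ , vl with ≤-total K L
    ... | inj₁ le = inj₁ (≤-tr ku (≤-tr (seg-mono le) vl))
    ... | inj₂ le = inj₂ (≤-tr lv′ (≤-tr (seg-mono le) uk))

    seg-disjoint : ∀ {i J x} → ¬ seg i 1 ≤ x → ∀ u → u ≤ x → u ≤ seg i J → u ≤ o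
    seg-disjoint n u ux us with below-seg us
    ... | zero , h , _ = ≤-tr h seg-zero
    ... | suc K , _ , h = ⊥-elim (n (≤-tr (seg-mono (s≤s z≤n)) (≤-tr h ux)))

    not-both : ∀ {x i j} → Linear x → i ≢ j → seg i 1 ≤ x → ¬ seg j 1 ≤ x
    not-both {x} {i} {j} lin ne p q with lin _ _ p q
    ... | inj₁ h = seg-indep ne (≤-tr h seg≤lim)
    ... | inj₂ h = seg-indep (λ e → ne (sym e)) (≤-tr h seg≤lim)

    -- Each of two chains contains at most one of three disjoint atoms.
    fresh : ∀ {x x′} → Linear x → Linear x′ → Σ ℕ λ i → ¬ seg i 1 ≤ x × ¬ seg i 1 ≤ x′
    fresh {x} {x′} lin lin′ = go (em {seg 0 1 ≤ x}) (em {seg 0 1 ≤ x′}) (em {seg 1 1 ≤ x}) (em {seg 1 1 ≤ x′})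
      where
      go : Dec (seg 0 1 ≤ x) → Dec (seg 0 1 ≤ x′) → Dec (seg 1 1 ≤ x) → Dec (seg 1 1 ≤ x′) → _
      go (no a) (no b) _ _ = 0 , a , b
      go _ _ (no a) (no b) = 1 , a , b
      go (yes a) (yes b) _ _ = 2 , not-both lin (λ ()) a , not-both lin′ (λ ()) b
      go _ _ (yes a) (yes b) = 2 , not-both lin (λ ()) a , not-both lin′ (λ ()) b
      go (yes a) _ (yes b) _ = ⊥-elim (not-both lin (λ ()) a b)
      go _ (yes a) _ (yes b) = ⊥-elim (not-both lin′ (λ ()) a b)
      go (yes a) _ _ (yes b) = 2 , not-both lin (λ ()) a , not-both lin′ (λ ()) b
      go _ (yes a) (yes b) _ = 2 , not-both lin (λ ()) b , not-both lin′ (λ ()) a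

    Coded : C → C → ℕ → (ℕ → C) → (ℕ → C) → Set
    Coded x x′ k a b = Σ C λ y → Σ C λ p → Σ C λ q →
      (∀ j → j < k → Rel y p q (a j) (b j)) ×
      (∀ {u v} → u ≤ x → v ≤ x′ → Rel y p q u v → Σ ℕ λ j → j < k × u ≈ a j × v ≈ b j)

    coded : ∀ {x x′} → Linear x → Linear x′ → ∀ k a b → (∀ j → j < k → In o x (a j)) → (∀ j → j < k → In o x′ (b j)) →
            Coded x x′ k a b
    coded {x} {x′} lin lin′ k a b a≤ b≤ with fresh lin lin′
    ... | i , nx , nx′ = y , P.param , Q.param , enc , dec
      where
      y = seg i k
      m : ℕ → C
      -- The j-th pair passes through an element of its own in the fresh chain; hence the two halves
      -- of a decoded pair have the same index.
      m j = seg i (suc j)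
      m≤ : ∀ j → j < k → In o y (m j)
      m≤ j lt = seg-mono lt , λ h → seg-strict (≤-tr (seg-mono (s≤s z≤n)) (≤-tr h (o-min {seg i 0})))
      module P = Pairs lin (seg-linear i k) (λ u ux uy → seg-disjoint nx u ux uy) k a m a≤ m≤
      module Q = Pairs (seg-linear i k) lin′ (λ u uy ux → seg-disjoint nx′ u ux uy) k m b m≤ b≤
      enc : ∀ j → j < k → Rel y P.param Q.param (a j) (b j)
      enc j lt = m j , seg-mono lt , P.encode j lt ≈-refl ≈-refl , Q.encode j lt ≈-refl ≈-refl
      dec : ∀ {u v} → u ≤ x → v ≤ x′ → Rel y P.param Q.param u v → Σ ℕ λ j → j < k × u ≈ a j × v ≈ b j
      dec ux vx (n , ny , c₁ , c₂) with P.decode ux ny c₁ | Q.decode ny vx c₂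
      ... | j , lt , ua , nm | j′ , lt′ , nm′ , vb with suc-injective (≤-antisym (seg-reflect (≤-tr (proj₂ nm) (proj₁ nm′))) (seg-reflect (≤-tr (proj₂ nm′) (proj₁ nm))))
      ... | refl = j , lt , ua , vb

    -- The interval from l to x is a chain with k elements besides l.
    record Chain (l x : C) (k : ℕ) : Set where
      field
        g    : ℕ → C
        bot  : g 0 ≈ l
        top  : g k ≈ x
        step : ∀ i → i < k → g i ≤ g (suc i) × ¬ g (suc i) ≤ g i
        all  : ∀ u → u ≤ x → u ≤ l ⊎ Σ ℕ λ i → i ℕ.≤ k × u ≈ g i

      mono : ∀ {i j} → i ℕ.≤ j → j ℕ.≤ k → g i ≤ g j
      mono {i} {zero} z≤n _ = ≤-id
      mono {i} {suc j} le h with i ≟ suc j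
      ... | yes refl = ≤-id
      ... | no ne = ≤-tr (mono (≤-pred (≤∧≢⇒< le ne)) (<⇒≤ h)) (proj₁ (step j h))

      reflect : ∀ {i j} → i ℕ.≤ k → j ℕ.≤ k → g i ≤ g j → i ℕ.≤ j
      reflect {i} {j} hi hj h with i ≤? j
      ... | yes le = le
      ... | no nle = ⊥-elim (proj₂ (step j (≤-trans (≰⇒> nle) hi)) (≤-tr (mono (≰⇒> nle) hi) h))

      g≤x : ∀ {i} → i ℕ.≤ k → g i ≤ x
      g≤x h = ≤-tr (mono h ≤-refl) (proj₁ top)

      l≤g : ∀ {i} → i ℕ.≤ k → l ≤ g i
      l≤g h = ≤-tr (proj₂ bot) (mono z≤n h)

      l≤x : l ≤ x
      l≤x = ≤-tr (l≤g ≤-refl) (proj₁ top)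

      g≰l : ∀ {i} → suc i ℕ.≤ k → ¬ g (suc i) ≤ l
      g≰l h p with reflect h z≤n (≤-tr p (proj₂ bot))
      ... | ()

      interior : ∀ {i} → suc i ℕ.≤ k → In l x (g (suc i))
      interior h = g≤x h , g≰l h

      position : ∀ {u} → In l x u → Σ ℕ λ i → suc i ℕ.≤ k × u ≈ g (suc i)
      position {u} (ux , ul) with all u ux
      ... | inj₁ h = ⊥-elim (ul h)
      ... | inj₂ (zero , _ , e) = ⊥-elim (ul (≤-tr (proj₁ e) (proj₁ bot)))
      ... | inj₂ (suc i , h , e) = i , h , e

      comparable : ∀ u → u ≤ x → u ≤ l ⊎ l ≤ u
      comparable u h with all u h
      ... | inj₁ le = inj₁ le
      ... | inj₂ (i , le , e) = inj₂ (≤-tr (l≤g le) (proj₂ e))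

    open Chain

    Size : C → ℕ → Set
    Size = Chain o

    size-linear : ∀ {x n} → Size x n → Linear x
    size-linear c u v hu hv with all c u hu | all c v hv
    ... | inj₁ h | _ = inj₁ (≤-tr h o-min)
    ... | _ | inj₁ h = inj₂ (≤-tr h o-min)
    ... | inj₂ (i , li , e) | inj₂ (j , lj , f) with ≤-total i j
    ... | inj₁ le = inj₁ (≤-tr (proj₁ e) (≤-tr (mono c le lj) (proj₂ f)))
    ... | inj₂ le = inj₂ (≤-tr (proj₁ f) (≤-tr (mono c le li) (proj₂ e)))

    chain-resp : ∀ {l l′ x x′ k} → l ≈ l′ → x ≈ x′ → Chain l x k → Chain l′ x′ k
    chain-resp e f c = record { g = g c ; bot = ≈-trans (bot c) e ; top = ≈-trans (top c) f ; step = step c ; all = all′ }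
      where
      all′ : ∀ u → u ≤ _ → _
      all′ u h with all c u (≤-tr h (proj₂ f))
      ... | inj₁ le = inj₁ (≤-tr le (proj₁ e))
      ... | inj₂ r = inj₂ r

    -- By induction, the i-th element of the first chain occupies a place of the second that is at
    -- least i.
    chain-≤ : ∀ {l x j k} → Chain l x j → Chain l x k → j ℕ.≤ k
    chain-≤ {l} {x} {j} {k} c d with climb j ≤-refl
      where
      climb : ∀ i → i ℕ.≤ j → Σ ℕ λ i′ → i′ ℕ.≤ k × i ℕ.≤ i′ × g c i ≈ g d i′
      climb zero h = 0 , z≤n , z≤n , ≈-trans (bot c) (≈-sym (bot d))
      climb (suc i) h with climb i (<⇒≤ h) | position d (interior c h)
      ... | i′ , hi′ , le , e | i″ , hi″ , f with suc i″ ≤? i′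
      ... | no nle = suc i″ , hi″ , ≤-trans (s≤s le) (≰⇒> nle) , f
      ... | yes le′ = ⊥-elim (proj₂ (step c i h) (≤-tr (proj₁ f) (≤-tr (mono d le′ hi′) (proj₂ e))))
    ... | i′ , h , le , _ = ≤-trans le h

    chain-unique : ∀ {l x j k} → Chain l x j → Chain l x k → j ≡ k
    chain-unique c d = ≤-antisym (chain-≤ c d) (chain-≤ d c)

    subchain : ∀ {l x k} (c : Chain l x k) i d → i + d ℕ.≤ k → Chain (g c i) (g c (i + d)) d
    subchain {l} {x} {k} c i d h = record
      { g = λ t → g c (i + t)
      ; bot = subst (λ t → g c t ≈ g c i) (sym (+-identityʳ i)) ≈-refl
      ; top = ≈-refl
      ; step = λ t lt → subst (λ s → g c (i + t) ≤ g c s × ¬ g c s ≤ g c (i + t)) (sym (+-suc i t)) (step c (i + t) (≤-trans (+-monoʳ-< i lt) h))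
      ; all = all′ }
      where
      all′ : ∀ u → u ≤ g c (i + d) → u ≤ g c i ⊎ Σ ℕ λ t → t ℕ.≤ d × u ≈ g c (i + t)
      all′ u le with all c u (≤-tr le (g≤x c h))
      ... | inj₁ p = inj₁ (≤-tr p (l≤g c (≤-trans (m≤m+n i d) h)))
      ... | inj₂ (t , t≤k , e) with ≤-total t i
      ... | inj₁ q = inj₁ (≤-tr (proj₁ e) (mono c q (≤-trans (m≤m+n i d) h)))
      ... | inj₂ q = inj₂ (t ∸ i , ≤-trans (∸-monoˡ-≤ i (reflect c t≤k h (≤-tr (proj₂ e) le))) (≤-reflexive (m+n∸m≡n i d)) ,
                           subst (λ s → u ≈ g c s) (sym (m+[n∸m]≡n q)) e)

    iso-flip : ∀ {R : C → C → Set} {l x l′ x′} → IsoBy R l x l′ x′ → IsoBy (λ a b → R b a) l′ x′ l x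
    iso-flip (f , h , ord) = h , f , λ a a′ b b′ ia ia′ ib ib′ r r′ →
      proj₂ (ord b b′ a a′ ib ib′ ia ia′ r r′) , proj₁ (ord b b′ a a′ ib ib′ ia ia′ r r′)

    -- The images of the elements of c exhaust the target interval and increase strictly, so
    -- finiteness of the target is a conclusion. That its elements lie above l′ does not follow from
    -- `IsoBy`, as `In` also admits elements incomparable with l′; this is the last hypothesis.
    iso-chain : ∀ {R : C → C → Set} {l x l′ x′ k} → IsoBy R l x l′ x′ → Chain l x k →
                l′ ≤ x′ → (∀ u → u ≤ x′ → u ≤ l′ ⊎ l′ ≤ u) → Chain l′ x′ k
    iso-chain {R} {l} {x} {l′} {x′} {k} (f , h , ord) c l′≤x′ cmp = record
      { g = g′ ; bot = ≈-refl ; top = top′ k refl ; step = step′ ; all = all′ }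
      where
      g′ : ℕ → C
      g′ zero = l′
      g′ (suc i) with suc i ≤? k
      ... | yes p = proj₁ (f _ (interior c p))
      ... | no _ = x′
      image : ∀ {i} → suc i ℕ.≤ k → In l′ x′ (g′ (suc i)) × R (g c (suc i)) (g′ (suc i))
      image {i} p with suc i ≤? k
      ... | yes q = proj₂ (f _ (interior c q))
      ... | no n = ⊥-elim (n p)
      same : ∀ {i b} → suc i ℕ.≤ k → In l′ x′ b → ∀ {a} → In l x a → R a b → a ≈ g c (suc i) → b ≈ g′ (suc i)
      same p ib ia r e = proj₁ (ord _ _ _ _ ia (interior c p) ib (proj₁ (image p)) r (proj₂ (image p))) (proj₁ e) ,
                         proj₁ (ord _ _ _ _ (interior c p) ia (proj₁ (image p)) ib (proj₂ (image p)) r) (proj₂ e)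
      all′ : ∀ u → u ≤ x′ → u ≤ l′ ⊎ Σ ℕ λ i → i ℕ.≤ k × u ≈ g′ i
      all′ u ux with em {u ≤ l′}
      ... | yes p = inj₁ p
      ... | no n with h u (ux , n)
      ... | a , ia , r with position c ia
      ... | i , p , e = inj₂ (suc i , p , same p (ux , n) ia r e)
      top′ : ∀ k′ → k′ ≡ k → g′ k ≈ x′
      top′ zero refl with all′ x′ ≤-id
      ... | inj₁ p = l′≤x′ , p
      ... | inj₂ (zero , _ , e) = ≈-sym e
      top′ (suc k′) refl with all′ x′ ≤-id
      ... | inj₁ p = ⊥-elim (proj₂ (proj₁ (image {k′} ≤-refl)) (≤-tr (proj₁ (proj₁ (image {k′} ≤-refl))) p))
      ... | inj₂ (zero , _ , e) = ⊥-elim (proj₂ (proj₁ (image {k′} ≤-refl)) (≤-tr (proj₁ (proj₁ (image {k′} ≤-refl))) (proj₁ e)))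
      ... | inj₂ (suc i , p , e) = proj₁ (proj₁ (image {k′} ≤-refl)) , ≤-tr (proj₁ e)
              (proj₁ (ord _ _ _ _ (interior c p) (interior c ≤-refl) (proj₁ (image p)) (proj₁ (image {k′} ≤-refl)) (proj₂ (image p)) (proj₂ (image {k′} ≤-refl)))
                     (mono c p ≤-refl))
      step′ : ∀ i → i < k → g′ i ≤ g′ (suc i) × ¬ g′ (suc i) ≤ g′ i
      step′ zero lt with cmp _ (proj₁ (proj₁ (image {0} lt)))
      ... | inj₁ p = ⊥-elim (proj₂ (proj₁ (image {0} lt)) p)
      ... | inj₂ p = p , proj₂ (proj₁ (image {0} lt))
      step′ (suc i) lt with ord _ _ _ _ (interior c (<⇒≤ lt)) (interior c lt) (proj₁ (image (<⇒≤ lt))) (proj₁ (image lt)) (proj₂ (image (<⇒≤ lt))) (proj₂ (image lt))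
                          | ord _ _ _ _ (interior c lt) (interior c (<⇒≤ lt)) (proj₁ (image lt)) (proj₁ (image (<⇒≤ lt))) (proj₂ (image lt)) (proj₂ (image (<⇒≤ lt)))
      ... | up , _ | _ , down = up (proj₁ (step c (suc i) lt)) , λ q → proj₂ (step c (suc i) lt) (down q)

    iso-size : ∀ {l x l′ x′ k k′} → Iso l x l′ x′ → Chain l x k → Chain l′ x′ k′ → k ≡ k′
    iso-size (_ , _ , _ , iso) c d = chain-unique (iso-chain iso c (l≤x d) (comparable d)) d

    size-iso : ∀ {l x l′ x′ k n n′} → Size x n → Size x′ n′ → Chain l x k → Chain l′ x′ k → Iso l x l′ x′
    size-iso {l} {x} {l′} {x′} {k} sx sx′ c d with coded (size-linear sx) (size-linear sx′) k (λ j → g c (suc j)) (λ j → g d (suc j))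
        (λ j lt → g≤x c lt , λ h → g≰l c lt (≤-tr h o-min)) (λ j lt → g≤x d lt , λ h → g≰l d lt (≤-tr h o-min))
    ... | y , p , q , enc , dec = y , p , q , forth , back , ord
      where
      forth : ∀ a → In l x a → Σ C λ b → In l′ x′ b × Rel y p q a b
      forth a ia with position c ia
      ... | i , h , e = g d (suc i) , interior d h , rel-resp (≈-sym e) ≈-refl (enc i h)
      back : ∀ b → In l′ x′ b → Σ C λ a → In l x a × Rel y p q a b
      back b ib with position d ib
      ... | i , h , e = g c (suc i) , interior c h , rel-resp ≈-refl (≈-sym e) (enc i h)
      ord : ∀ a a′ b b′ → In l x a → In l x a′ → In l′ x′ b → In l′ x′ b′ → Rel y p q a b → Rel y p q a′ b′ → (a ≤ a′ → b ≤ b′) × (b ≤ b′ → a ≤ a′)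
      ord a a′ b b′ ia ia′ ib ib′ r r′ with dec (proj₁ ia) (proj₁ ib) r | dec (proj₁ ia′) (proj₁ ib′) r′
      ... | j , lt , e₁ , e₂ | j′ , lt′ , f₁ , f₂ =
        (λ h → ≤-tr (proj₁ e₂) (≤-tr (mono d (reflect c lt lt′ (≤-tr (proj₂ e₁) (≤-tr h (proj₁ f₁)))) lt′) (proj₂ f₂))) ,
        (λ h → ≤-tr (proj₁ e₁) (≤-tr (mono c (reflect d lt lt′ (≤-tr (proj₂ e₂) (≤-tr h (proj₁ f₂)))) lt′) (proj₂ f₁)))

    zero≈o : ∀ {z} → Zero z → z ≈ o
    zero≈o h = h o , o-min

    o-zero : Zero o
    o-zero u = o-min

    chain-zero : ∀ {z x n} → Zero z → Size x n → Chain z x n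
    chain-zero h = chain-resp (≈-sym (zero≈o h)) ≈-refl

    seg-size : ∀ i n → Size (seg i n) n
    seg-size i n = record { g = seg i ; bot = seg-zero , o-min ; top = ≈-refl ; step = λ j _ → seg-mono (n≤1+n j) , seg-strict ; all = all′ }
      where
      all′ : ∀ u → u ≤ seg i n → u ≤ o ⊎ Σ ℕ λ j → j ℕ.≤ n × u ≈ seg i j
      all′ u h with below-seg h
      ... | j , e = inj₂ (j , seg-reflect (≤-tr (proj₂ e) h) , e)

    lim-ind : ∀ i → Ind (lim i)
    lim-ind i = (λ z → lim≰seg {i} {0} (z (seg i 0))) , next
      where
      next : ∀ c → c ≤ lim i × ¬ lim i ≤ c → _
      next c (cl , lc) with lim-below cl
      ... | inj₁ h = ⊥-elim (lc h)
      ... | inj₂ (J , e , e′) = seg i (suc J) , (seg≤lim , lim≰seg) ,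
             (≤-tr e (seg-mono (n≤1+n J)) , λ h → seg-strict (≤-tr h e)) , alt
        where
        alt : ∀ u → u ≤ lim i → u ≤ c ⊎ seg i (suc J) ≤ u
        alt u h with lim-below h
        ... | inj₁ p = inj₂ (≤-tr seg≤lim p)
        ... | inj₂ (K , p , q) with K ≤? J
        ... | yes le = inj₁ (≤-tr p (≤-tr (seg-mono le) e′))
        ... | no nle = inj₂ (≤-tr (seg-mono (≰⇒> nle)) q)

    -- One limit suffices as a test: everything strictly below `lim 0` is a segment, hence a finite
    -- chain, and the isomorphism carries the chain back to x.
    number⇒size : ∀ {x} → Number x → Σ ℕ λ n → Size x n
    number⇒size {x} h with h o o-zero (lim 0) (lim-ind 0)
    ... | c , (cl , lc) , y , p , q , iso with lim-below cl
    ... | inj₁ le = ⊥-elim (lc le)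
    ... | inj₂ (J , e) = J , iso-chain (iso-flip iso) (chain-resp ≈-refl (≈-sym e) (seg-size 0 J)) o-min (λ u _ → inj₂ o-min)

    extend : ∀ {l c d n} → Chain l c n → c ≤ d → ¬ d ≤ c → (∀ u → u ≤ d → u ≤ c ⊎ d ≤ u) → Chain l d (suc n)
    extend {l} {c} {d} {n} ch c≤d d≰c alt = record { g = g′ ; bot = bot ch ; top = top′ ; step = step′ ; all = all′ }
      where
      g′ : ℕ → C
      g′ i with i ≤? n
      ... | yes _ = g ch i
      ... | no _  = d
      old : ∀ {i} → i ℕ.≤ n → g′ i ≡ g ch i
      old {i} h with i ≤? n
      ... | yes _ = refl
      ... | no nh = ⊥-elim (nh h)
      new : g′ (suc n) ≡ d
      new with suc n ≤? n
      ... | yes h = ⊥-elim (<-irrefl refl h)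
      ... | no _ = refl
      top′ : g′ (suc n) ≈ d
      top′ = subst (_≈ d) (sym new) ≈-refl
      step′ : ∀ i → i < suc n → g′ i ≤ g′ (suc i) × ¬ g′ (suc i) ≤ g′ i
      step′ i lt with i ≟ n
      ... | yes refl = subst₂ (λ a b → a ≤ b × ¬ b ≤ a) (sym (old ≤-refl)) (sym new)
            (≤-tr (proj₁ (top ch)) c≤d , λ h → d≰c (≤-tr h (proj₁ (top ch))))
      ... | no ne = subst₂ (λ a b → a ≤ b × ¬ b ≤ a) (sym (old (<⇒≤ i<n))) (sym (old i<n)) (step ch i i<n)
        where
        i<n : i < n
        i<n = ≤∧≢⇒< (≤-pred lt) ne
      all′ : ∀ u → u ≤ d → u ≤ l ⊎ Σ ℕ λ i → i ℕ.≤ suc n × u ≈ g′ i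
      all′ u h with alt u h
      ... | inj₂ p = inj₂ (suc n , ≤-refl , subst (u ≈_) (sym new) (h , p))
      ... | inj₁ p with all ch u p
      ... | inj₁ q = inj₁ q
      ... | inj₂ (i , le , e) = inj₂ (i , m≤n⇒m≤1+n le , subst (u ≈_) (sym (old le)) e)

    -- Starting from the bottom and taking successors n times stays strictly below w, so every such
    -- w has room for every finite chain.
    ind-chain : ∀ {w} → Ind w → ∀ n → Σ C λ c → (c ≤ w × ¬ w ≤ c) × Size c n
    ind-chain (nz , next) zero = o , (o-min , λ h → nz λ u → ≤-tr h o-min) ,
      record { g = λ _ → o ; bot = ≈-refl ; top = ≈-refl ; step = λ { _ () } ; all = λ u h → inj₁ h }
    ind-chain {w} (nz , next) (suc n) with ind-chain (nz , next) n
    ... | c , cw , sz with next c cw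
    ... | d , (dw , wd) , (cd , dc) , alt = d , (dw , wd) , extend sz cd dc (λ u h → alt u (≤-tr h dw))

    size⇒number : ∀ {x n} → Size x n → Number x
    size⇒number {x} {n} s z hz w ind with ind-chain ind n
    ... | c , cw , s′ = c , cw , size-iso s s′ (chain-zero hz s) (chain-zero hz s′)

    equal⇔ : ∀ {x y m n} → Size x m → Size y n → Equal x y ⇔ m ≡ n
    equal⇔ s t = mk⇔ (λ { (z , hz , iso) → iso-size iso (chain-zero hz s) (chain-zero hz t) })
                     λ { refl → o , o-zero , size-iso s t s t }

    below-size : ∀ {x n c} → (s : Size x n) → c ≤ x → Σ ℕ λ i → i ℕ.≤ n × c ≈ g s i
    below-size s h with all s _ h
    ... | inj₁ p = 0 , z≤n , ≈-trans (p , o-min) (≈-sym (bot s))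
    ... | inj₂ r = r

    initial : ∀ {x n} (s : Size x n) i → i ℕ.≤ n → Size (g s i) i
    initial s i h = chain-resp (bot s) ≈-refl (subchain s 0 i h)

    final : ∀ {x n} (s : Size x n) i d → i + d ≡ n → Chain (g s i) x d
    final s i d refl = chain-resp ≈-refl (top s) (subchain s i d ≤-refl)

    add⇔ : ∀ {x y t m n k} → Size x m → Size y n → Size t k → Add x y t ⇔ k ≡ m + n
    add⇔ {x} {y} {t} {m} {n} {k} sx sy st = mk⇔ sound complete
      where
      sound : Add x y t → k ≡ m + n
      sound (z , hz , c , ct , iso₁ , iso₂) with below-size st ct
      ... | i , h , e = trans (sym (m+[n∸m]≡n h)) (cong₂ _+_
        (sym (iso-size iso₁ (chain-zero hz sx) (chain-zero hz (chain-resp ≈-refl (≈-sym e) (initial st i h)))))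
        (sym (iso-size iso₂ (chain-zero hz sy) (chain-resp (≈-sym e) ≈-refl (final st i (k ∸ i) (m+[n∸m]≡n h))))))
      complete : k ≡ m + n → Add x y t
      complete refl = o , o-zero , g st m , g≤x st (m≤m+n m n) ,
        size-iso sx (initial st m (m≤m+n m n)) sx (initial st m (m≤m+n m n)) , size-iso sy st sy (final st m n refl)

    size-zero : ∀ {x n} → Size x n → x ≤ o → n ≡ 0
    size-zero {n = zero} s h = refl
    size-zero {n = suc n} s h = ⊥-elim (proj₂ (interior s {n} ≤-refl) (≤-tr (proj₁ (top s)) h))

    zero-size : ∀ {x} → Size x 0 → x ≤ o
    zero-size s = ≤-tr (proj₂ (top s)) (proj₁ (bot s))

    next-in : ∀ {x n} (s : Size x n) i → i < n → Next x (g s i) (g s (suc i))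
    next-in s i lt = g≤x s lt , proj₁ (step s i lt) , proj₂ (step s i lt) , alt
      where
      alt : ∀ u → u ≤ g s (suc i) → u ≤ g s i ⊎ g s (suc i) ≤ u
      alt u h with below-size s (≤-tr h (g≤x s lt))
      ... | j , le , e with j ≤? i
      ... | yes p = inj₁ (≤-tr (proj₁ e) (mono s p (<⇒≤ lt)))
      ... | no np = inj₂ (≤-tr (mono s (≰⇒> np) le) (proj₂ e))

    next-unique : ∀ {x n} (s : Size x n) {a a′} → a ≤ x → Next x a a′ → Σ ℕ λ i → i < n × a ≈ g s i × a′ ≈ g s (suc i)
    next-unique s {a} {a′} ax (a′x , aa′ , a′a , alt) with below-size s ax | below-size s a′x
    ... | i , hi , e | j , hj , f = i , i<n , e , ≈-trans f (mono s j≤ i<n , mono s i<j hj)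
      where
      i<j : i < j
      i<j with suc i ≤? j
      ... | yes p = p
      ... | no np = ⊥-elim (a′a (≤-tr (proj₁ f) (≤-tr (mono s (≤-pred (≰⇒> np)) hi) (proj₂ e))))
      i<n : i < _
      i<n = ≤-trans i<j hj
      j≤ : j ℕ.≤ suc i
      j≤ with alt (g s (suc i)) (≤-tr (mono s i<j hj) (proj₂ f))
      ... | inj₁ h = ⊥-elim (proj₂ (step s i i<n) (≤-tr h (proj₁ e)))
      ... | inj₂ h = reflect s hj i<n (≤-tr (proj₂ f) h)

    module _ {x y t : C} {m n k : ℕ} (sx : Size x m) (sy : Size y n) (st : Size t k) where

      -- By induction on i, the graph sends the i-th element of x to the element of t at place
      -- `i * n`: the images of neighbours bound an interval isomorphic to y, and functionality
      -- makes the intervals fit together.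
      times-sound : ∀ {z} → Zero z → Times z x y t → k ≡ m * n
      times-sound {z} hz (y′ , p , q , gr , fun , nxt) with below-multiple m ≤-refl t ≤-id (graph-resp (≈-sym (top sx)) ≈-refl gr)
        where
        below-multiple : ∀ i → i ℕ.≤ m → ∀ b → b ≤ t → Graph z y′ p q (g sx i) b → Σ ℕ λ j → j ℕ.≤ k × b ≈ g st j × j ≡ i * n
        -- Functionality compares b with the bottom, which the first disjunct of `Graph` assigns to
        -- the bottom of x.
        below-multiple zero h b bt r = 0 , z≤n , (≤-tr (fun (g sx 0) b z (g≤x sx z≤n) bt (hz t) r (inj₁ (≤-tr (proj₁ (bot sx)) o-min , ≤-id))) (hz _) , ≤-tr (proj₁ (bot st)) o-min) , refl
        below-multiple (suc i) h b bt r with nxt (g sx i) (g sx (suc i)) (next-in sx i h)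
        ... | b₁ , b₂ , b₁₂ , b₂t , r₁ , r₂ , iso with below-multiple i (<⇒≤ h) b₁ (≤-tr b₁₂ b₂t) r₁ | below-size st b₂t
        ... | j , hj , e , j≡ | j′ , hj′ , f =
          j′ , hj′ , ≈-trans (fun _ _ _ (g≤x sx h) bt b₂t r r₂ , fun _ _ _ (g≤x sx h) b₂t bt r₂ r) f , eq
          where
          j≤j′ : j ℕ.≤ j′
          j≤j′ = reflect st hj hj′ (≤-tr (proj₂ e) (≤-tr b₁₂ (proj₁ f)))
          d = j′ ∸ j
          jd : j + d ≡ j′
          jd = m+[n∸m]≡n j≤j′
          block : Chain b₁ b₂ d
          block = chain-resp (≈-sym e) (≈-sym f) (subst (λ v → Chain (g st j) (g st v) d) jd (subchain st j d (≤-trans (≤-reflexive jd) hj′)))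
          eq : j′ ≡ n + i * n
          eq = trans (sym jd) (trans (+-comm j d) (cong₂ _+_ (iso-size iso block (chain-zero hz sy)) j≡))
      ... | j , hj , e , eq = trans (≤-antisym (reflect st ≤-refl hj (≤-tr (proj₁ (top st)) (proj₁ e))) hj) eq

      times-complete : k ≡ m * n → n ≢ 0 → Times o x y t
      times-complete refl nz with coded (size-linear sx) (size-linear st) m (λ j → g sx (suc j)) (λ j → g st (suc j * n))
          (λ j lt → interior sx lt) multiple
        where
        multiple : ∀ j → j < m → In o t (g st (suc j * n))
        -- Only elements off the bottom can be coded; this is where `n ≢ 0` enters.
        multiple j lt = g≤x st (*-monoˡ-≤ n lt) , λ h → nz (m+n≡0⇒m≡0 n (n≤0⇒n≡0 (reflect st (*-monoˡ-≤ n lt) z≤n (≤-tr h o-min))))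
      ... | y′ , p , q , enc , dec = y′ , p , q , graph-resp (top sx) (top st) (graph m ≤-refl) , fun , nxt
        where
        graph : ∀ i → i ℕ.≤ m → Graph o y′ p q (g sx i) (g st (i * n))
        graph zero h = inj₁ (proj₁ (bot sx) , proj₁ (bot st))
        graph (suc i) h = inj₂ (enc i h)
        index : ∀ {a b} → a ≤ x → b ≤ t → Graph o y′ p q a b → Σ ℕ λ i → i ℕ.≤ m × a ≈ g sx i × b ≈ g st (i * n)
        index ax bt (inj₁ (u , v)) = 0 , z≤n , (≤-tr u o-min , ≤-tr (proj₁ (bot sx)) o-min) , (≤-tr v o-min , ≤-tr (proj₁ (bot st)) o-min)
        index ax bt (inj₂ r) with dec ax bt r
        ... | j , lt , e , f = suc j , lt , e , f
        fun : ∀ a b b′ → a ≤ x → b ≤ t → b′ ≤ t → Graph o y′ p q a b → Graph o y′ p q a b′ → b ≤ b′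
        fun a b b′ ax bt bt′ r r′ with index ax bt r | index ax bt′ r′
        ... | i , hi , e , f | i′ , hi′ , e′ , f′ =
          ≤-tr (proj₁ f) (≤-tr (mono st (*-monoˡ-≤ n (reflect sx hi hi′ (≤-tr (proj₂ e) (proj₁ e′)))) (*-monoˡ-≤ n hi′)) (proj₂ f′))
        nxt : ∀ a a′ → Next x a a′ → Σ C λ b → Σ C λ b′ → b ≤ b′ × b′ ≤ t × Graph o y′ p q a b × Graph o y′ p q a′ b′ × Iso b b′ o y
        nxt a a′ nx with next-unique sx (≤-tr (proj₁ (proj₂ nx)) (proj₁ nx)) nx
        ... | i , lt , e , f = g st (i * n) , g st (suc i * n) , mono st (m≤n+m (i * n) n) (*-monoˡ-≤ n lt) , g≤x st (*-monoˡ-≤ n lt) ,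
            graph-resp (≈-sym e) ≈-refl (graph i (<⇒≤ lt)) , graph-resp (≈-sym f) ≈-refl (graph (suc i) lt) ,
            size-iso (initial st (suc i * n) (*-monoˡ-≤ n lt)) sy block sy
          where
          shift : i * n + n ≡ suc i * n
          shift = +-comm (i * n) n
          block : Chain (g st (i * n)) (g st (suc i * n)) n
          block = subst (λ v → Chain (g st (i * n)) (g st v) n) shift
                    (subchain st (i * n) n (≤-trans (≤-reflexive shift) (*-monoˡ-≤ n lt)))

      mul⇔ : Mul x y t ⇔ k ≡ m * n
      mul⇔ = mk⇔ sound complete
        where
        sound : Mul x y t → k ≡ m * n
        sound (z , hz , inj₁ (yz , tz)) = trans (size-zero st (≤-tr tz (hz o))) (sym (trans (cong (m *_) (size-zero sy (≤-tr yz (hz o)))) (*-zeroʳ m)))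
        sound (z , hz , inj₂ (_ , ts)) = times-sound hz ts
        complete : k ≡ m * n → Mul x y t
        complete eq with n ≟ 0
        ... | yes refl = o , o-zero , inj₁ (zero-size sy , zero-size (subst (Size t) (trans eq (*-zeroʳ m)) st))
        ... | no nz = o , o-zero , inj₂ ((λ h → nz (size-zero sy h)) , times-complete eq nz)

open Reductions using (𝟎; 𝟎-min; ≤m-refl; ≤m-trans; _∨m_; ∨m-left; ∨m-right; ∨m-least; ∨m-distrib)
open ChainArithmetic

-- The order-theoretic facts for the many-one degrees.

module Facts (em : ExcludedMiddle 0ℓ) where
  open Segments.Chains em
  open Independence.Strictness em

  -- The lower bound that `below-whole` leaves open for `J ≡ 0` holds here because the base is the
  -- least degree.
  below-whole-𝟎 : ∀ {i x} → x ≤m whole 𝟎 i → whole 𝟎 i ≤m x ⊎ Σ ℕ λ J → x ≤m segment 𝟎 i J × segment 𝟎 i J ≤m x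
  below-whole-𝟎 {i} {x} h with below-whole {𝟎} {x} i h
  ... | inj₁ le = inj₁ le
  ... | inj₂ (zero , le , _) = inj₂ (0 , le , ≤m-trans {segment 𝟎 i 0} {𝟎} {x} (segment-zero 𝟎 i) (𝟎-min x))
  ... | inj₂ (suc J , le , inj₂ ge) = inj₂ (suc J , le , ge)

  facts : OrderFacts CE _≤m_
  facts = record
    { ≤-id = λ {a} → ≤m-refl a
    ; ≤-tr = λ {a} {b} {c} → ≤m-trans {a} {b} {c}
    ; _∨_ = _∨m_
    ; ∨-l = λ {a} {b} → ∨m-left a b
    ; ∨-r = λ {a} {b} → ∨m-right a b
    ; ∨-lub = λ {a} {b} {c} → ∨m-least {a} {b} {c}
    ; ∨-split = λ {x} {a} {b} h → ∨m-distrib {x} {a} {b} h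
    ; o = 𝟎
    ; o-min = λ {a} → 𝟎-min a
    ; cov = cover
    ; cov-above = λ {a} → cover-above a
    ; cov-below = λ {a} {c} → cover-below {a} {c}
    ; cov-join = λ {a} {b} → cover-join {a} {b}
    ; seg = segment 𝟎
    ; lim = whole 𝟎
    ; seg-zero = λ {i} → segment-zero 𝟎 i
    ; seg-mono = λ {i} → segment-mono 𝟎 i
    ; seg-strict = λ {i} {J} → segment-strict i J
    ; seg≤lim = λ {i} {J} → segment≤whole 𝟎 i J
    ; lim-below = λ {i} {x} → below-whole-𝟎 {i} {x}
    ; seg-indep = λ {i} {j} → segment-independent i j
    }

-- The coding predicates as first-order formulas.

zeroF : ∀ {n} → Fin n → Formula n
zeroF z = ∀' (suc z ≤' zero)

joinBelowF strongCoverF codeF inF : ∀ {n} → Fin n → Fin n → Fin n → Formula n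
joinBelowF u a b = ∀' ((suc a ≤' zero) ⇒' ((suc b ≤' zero) ⇒' (suc u ≤' zero)))
strongCoverF z a b = (a ≤' z) ∧' ((b ≤' z) ∧' ((¬' joinBelowF z a b) ∧'
  ∀' ((zero ≤' suc z) ⇒' ((suc z ≤' zero) ∨' joinBelowF zero (suc a) (suc b)))))
codeF p a b = (¬' (a ≤' b)) ∧' ((¬' (b ≤' a)) ∧' ∃' ((zero ≤' suc p) ∧' strongCoverF zero (suc a) (suc b)))
inF l x a = (a ≤' x) ∧' (¬' (a ≤' l))

relF : ∀ {n} → Fin n → Fin n → Fin n → Fin n → Fin n → Formula n
relF y p q a b = ∃' ((zero ≤' suc y) ∧' (codeF (suc p) (suc a) zero ∧' codeF (suc q) zero (suc b)))

isoByF : ∀ {n} (y p q l x l′ x′ : Fin n) → Formula n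
isoByF y p q l x l′ x′ =
  ∀' (inF (suc l) (suc x) zero ⇒'
    ∃' (inF (suc (suc l′)) (suc (suc x′)) zero ∧' relF (suc (suc y)) (suc (suc p)) (suc (suc q)) (suc zero) zero)) ∧'
  (∀' (inF (suc l′) (suc x′) zero ⇒'
    ∃' (inF (suc (suc l)) (suc (suc x)) zero ∧' relF (suc (suc y)) (suc (suc p)) (suc (suc q)) zero (suc zero))) ∧'
  ∀' (∀' (∀' (∀' (inF (s l) (s x) a ⇒' (inF (s l) (s x) a′ ⇒' (inF (s l′) (s x′) b ⇒' (inF (s l′) (s x′) b′ ⇒'
    (relF (s y) (s p) (s q) a b ⇒' (relF (s y) (s p) (s q) a′ b′ ⇒'
      (((a ≤' a′) ⇒' (b ≤' b′)) ∧' ((b ≤' b′) ⇒' (a ≤' a′)))))))))))))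
  where
  s : ∀ {n} → Fin n → Fin (4 + n)
  s i = suc (suc (suc (suc i)))
  a a′ b b′ : ∀ {n} → Fin (4 + n)
  a  = suc (suc (suc zero))
  a′ = suc (suc zero)
  b  = suc zero
  b′ = zero

isoF : ∀ {n} (l x l′ x′ : Fin n) → Formula n
isoF l x l′ x′ = ∃' (∃' (∃' (isoByF (suc (suc zero)) (suc zero) zero (s l) (s x) (s l′) (s x′))))
  where
  s : ∀ {n} → Fin n → Fin (3 + n)
  s i = suc (suc (suc i))

indF : ∀ {n} → Fin n → Formula n
indF w = (¬' zeroF w) ∧' ∀' (((zero ≤' suc w) ∧' (¬' (suc w ≤' zero))) ⇒'
  ∃' (((zero ≤' suc (suc w)) ∧' (¬' (suc (suc w) ≤' zero))) ∧'
    (((suc zero ≤' zero) ∧' (¬' (zero ≤' suc zero))) ∧'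
     ∀' ((zero ≤' suc (suc (suc w))) ⇒' ((zero ≤' suc (suc zero)) ∨' (suc zero ≤' zero))))))

-- Satisfaction of this formula unfolds to `Number x`, and the other formulas unfold to their
-- predicates in the same way, so that the results on `Coding` apply to them as they stand.
numberF : Formula 1
numberF = ∀' (zeroF zero ⇒' ∀' (indF zero ⇒'
  ∃' (((zero ≤' suc zero) ∧' (¬' (suc zero ≤' zero))) ∧' isoF (suc (suc zero)) (suc (suc (suc zero))) (suc (suc zero)) zero)))

equalF : Formula 2
equalF = ∃' (zeroF zero ∧' isoF zero (suc zero) zero (suc (suc zero)))

addF : Formula 3
addF = ∃' (zeroF zero ∧' ∃' ((zero ≤' suc (suc (suc (suc zero)))) ∧'
  (isoF (suc zero) (suc (suc zero)) (suc zero) zero ∧'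
   isoF (suc zero) (suc (suc (suc zero))) zero (suc (suc (suc (suc zero)))))))

graphF : ∀ {n} (z y p q a b : Fin n) → Formula n
graphF z y p q a b = ((a ≤' z) ∧' (b ≤' z)) ∨' relF y p q a b

nextF : ∀ {n} → Fin n → Fin n → Fin n → Formula n
nextF x a a′ = (a′ ≤' x) ∧' ((a ≤' a′) ∧' ((¬' (a′ ≤' a)) ∧'
  ∀' ((zero ≤' suc a′) ⇒' ((zero ≤' suc a) ∨' (suc a′ ≤' zero)))))

timesF : ∀ {n} (z x y t : Fin n) → Formula n
timesF z x y t = ∃' (∃' (∃' (
  graphF (s₃ z) y′ p q (s₃ x) (s₃ t) ∧'
  (∀' (∀' (∀' ((a ≤' s₃ (s₃ x)) ⇒' ((b ≤' s₃ (s₃ t)) ⇒' ((b′ ≤' s₃ (s₃ t)) ⇒'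
     (graphF (s₃ (s₃ z)) (s₃ y′) (s₃ p) (s₃ q) a b ⇒' (graphF (s₃ (s₃ z)) (s₃ y′) (s₃ p) (s₃ q) a b′ ⇒' (b ≤' b′)))))))) ∧'
   ∀' (∀' (nextF (s₂ (s₃ x)) (suc zero) zero ⇒'
     ∃' (∃' ((suc zero ≤' zero) ∧' ((zero ≤' s₂ (s₂ (s₃ t))) ∧'
       (graphF (s₂ (s₂ (s₃ z))) (s₂ (s₂ y′)) (s₂ (s₂ p)) (s₂ (s₂ q)) (s₂ (suc zero)) (suc zero) ∧'
       (graphF (s₂ (s₂ (s₃ z))) (s₂ (s₂ y′)) (s₂ (s₂ p)) (s₂ (s₂ q)) (s₂ zero) zero ∧'
        isoF (suc zero) zero (s₂ (s₂ (s₃ z))) (s₂ (s₂ (s₃ y))))))))))))))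
  where
  s₂ : ∀ {n} → Fin n → Fin (2 + n)
  s₂ i = suc (suc i)
  s₃ : ∀ {n} → Fin n → Fin (3 + n)
  s₃ i = suc (suc (suc i))
  y′ p q a b b′ : ∀ {n} → Fin (3 + n)
  y′ = suc (suc zero)
  p  = suc zero
  q  = zero
  a  = suc (suc zero)
  b  = suc zero
  b′ = zero

mulF : Formula 3
mulF = ∃' (zeroF zero ∧' ((((suc (suc zero)) ≤' zero) ∧' ((suc (suc (suc zero))) ≤' zero)) ∨'
  ((¬' ((suc (suc zero)) ≤' zero)) ∧' timesF zero (suc zero) (suc (suc zero)) (suc (suc (suc zero))))))

open Coding _≤m_

-- The isomorphism with the natural numbers.

module Interpretation (em : ExcludedMiddle 0ℓ) where
  open Arithmetic em (Facts.facts em)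
  open OrderFacts (Facts.facts em) using (seg)

  IsNumber : CE → Set
  IsNumber x = Sat numberF (x ∷ [])

  -- The value 0 is a default for degrees that are not finite chains; on numbers the value is
  -- determined by `chain-unique`.
  size : CE → ℕ
  size x with em {Σ ℕ (Size x)}
  ... | yes (n , _) = n
  ... | no _        = 0

  has-size : ∀ x → IsNumber x → Size x (size x)
  has-size x d with em {Σ ℕ (Size x)}
  ... | yes (_ , s) = s
  ... | no ns       = ⊥-elim (ns (number⇒size {x} d))

  number-seg : ∀ n → IsNumber (seg 0 n)
  number-seg n = size⇒number {seg 0 n} (seg-size 0 n)

  size-seg : ∀ n → size (seg 0 n) ≡ n
  size-seg n = chain-unique (has-size (seg 0 n) (number-seg n)) (seg-size 0 n)

  E⇔ : ∀ x y → IsNumber x → IsNumber y → Sat equalF (x ∷ y ∷ []) ⇔ size x ≡ size y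
  E⇔ x y d e = equal⇔ (has-size x d) (has-size y e)

  A⇔ : ∀ x y t → IsNumber x → IsNumber y → IsNumber t → Sat addF (x ∷ y ∷ t ∷ []) ⇔ size t ≡ size x + size y
  A⇔ x y t d e f = add⇔ (has-size x d) (has-size y e) (has-size t f)

  M⇔ : ∀ x y t → IsNumber x → IsNumber y → IsNumber t → Sat mulF (x ∷ y ∷ t ∷ []) ⇔ size t ≡ size x * size y
  M⇔ x y t d e f = mul⇔ (has-size x d) (has-size y e) (has-size t f)

  codes : CodesArithmetic numberF equalF addF mulF
  codes = record
    { nonempty = seg 0 0 , number-seg 0
    ; E-refl   = λ x d → from (E⇔ x x d d) refl
    ; E-sym    = λ x y d e h → from (E⇔ y x e d) (sym (to (E⇔ x y d e) h))
    ; E-trans  = λ x y z d e f h k → from (E⇔ x z d f) (trans (to (E⇔ x y d e) h) (to (E⇔ y z e f) k))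
    ; A-compat = λ x x′ y y′ z z′ d d′ e e′ f f′ p q r h → from (A⇔ x′ y′ z′ d′ e′ f′)
        (trans (sym (to (E⇔ z z′ f f′) r)) (trans (to (A⇔ x y z d e f) h) (cong₂ _+_ (to (E⇔ x x′ d d′) p) (to (E⇔ y y′ e e′) q))))
    ; M-compat = λ x x′ y y′ z z′ d d′ e e′ f f′ p q r h → from (M⇔ x′ y′ z′ d′ e′ f′)
        (trans (sym (to (E⇔ z z′ f f′) r)) (trans (to (M⇔ x y z d e f) h) (cong₂ _*_ (to (E⇔ x x′ d d′) p) (to (E⇔ y y′ e e′) q))))
    ; A-total  = λ x y d e → seg 0 (size x + size y) , number-seg (size x + size y) ,
        from (A⇔ x y (seg 0 (size x + size y)) d e (number-seg (size x + size y))) (size-seg (size x + size y))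
    ; A-func   = λ x y z z′ d e f f′ h k → from (E⇔ z z′ f f′) (trans (to (A⇔ x y z d e f) h) (sym (to (A⇔ x y z′ d e f′) k)))
    ; M-total  = λ x y d e → seg 0 (size x * size y) , number-seg (size x * size y) ,
        from (M⇔ x y (seg 0 (size x * size y)) d e (number-seg (size x * size y))) (size-seg (size x * size y))
    ; M-func   = λ x y z z′ d e f f′ h k → from (E⇔ z z′ f f′) (trans (to (M⇔ x y z d e f) h) (sym (to (M⇔ x y z′ d e f′) k)))
    ; h        = size
    ; h-resp   = λ x y d e → to (E⇔ x y d e)
    ; h-inj    = λ x y d e → from (E⇔ x y d e)
    ; h-surj   = λ n → seg 0 n , number-seg n , size-seg n
    ; h-add    = λ x y z d e f → to (A⇔ x y z d e f)
    ; h-mul    = λ x y z d e f → to (M⇔ x y z d e f)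
    }

theorem3p7 : ExcludedMiddle 0ℓ →
    Σ (Formula 1) λ φnum → Σ (Formula 2) λ φeq →
    Σ (Formula 3) λ φadd → Σ (Formula 3) λ φmul →
    CodesArithmetic φnum φeq φadd φmul
theorem3p7 em = numberF , equalF , addF , mulF , Interpretation.codes em
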